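{- Let $n\ge 3$. For positive integers $s,t$ let $f(n,s,t)$ be the maximum size of an $(s,t)$-union-intersecting system of subsets of $[n]$. Then: (a) $f(n,1,1)=2^{n-1}$. (b) $$f(n,1,2)=\begin{cases}\displaystyle\sum_{i=n/2}^{n}\binom{n}{i} & \text{if } n \text{ is even},\\[2mm] \displaystyle\binom{n-1}{\frac{n-3}{2}}+\sum_{i=(n+1)/2}^{n}\binom{n}{i} & \text{if } n\text{ is odd}.\end{cases}$$ (c) $$f(n,2,2)=\begin{cases}\displaystyle\sum_{i=(n-1)/2}^{n}\binom{n}{i} & \text{if } n \text{ is odd},\\[2mm] \displaystyle\binom{n-1}{\frac{n}{2}-2}+\sum_{i=n/2}^{n}\binom{n}{i} & \text{if } n\text{ is even}.\end{cases}$$ (d) $$f(n,1,3)=\begin{cases}\displaystyle\sum_{i=n/2}^{n}\binom{n}{i} & \text{if } n \text{ is even},\\[2mm] \displaystyle\binom{n-1}{\frac{n-1}{2}}+\sum_{i=(n+1)/2}^{n}\binom{n}{i} & \text{if } n\text{ is odd}.\end{cases}$$ (e) If $t\ge 4$, then $$2^{n-1}+\frac12\binom{n}{\lfloor n/2\rfloor}\le f(n,1,t)\le 2^{n-1}+\binom{n}{\lfloor n/2\rfloor}\left(\frac12+\frac{t-2}{n}+O(n^{ -2})\right).$$ (f) If $s\ge 2$ and $t\ge 3$, then $$2^{n-1}+\binom{n}{\lfloor n/2\rfloor}\frac{n}{n+2}\le f(n,s,t)\le 2^{n-1}+\binom{n}{\lfloor n/2\rfloor}\left(1+\frac{t+s-3}{n}+O(n^{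 -2})\right).$$
   Context: $[n]=\{1,2,\dots,n\}$. A set system is a family of distinct sets. A set system $\mathcal{F}$ is called $(s,t)$-union-intersecting if for all $s+t$ pairwise different sets $F_1,\dots,F_s,G_1,\dots,G_t\in\mathcal{F}$, $$\left(\bigcup_{i=1}^s F_i\right)\cap\left(\bigcup_{j=1}^t G_j\right)\ne\emptyset.$$ In (e) and (f), $s$ and $t$ are fixed and $O(n^{ -2})$ refers to $n\to\infty$; the implied constants may depend on $s$ and $t$ but not on $n$. -}

module Defs where

open import Data.Bool using (Bool; true; false)
open import Data.Bool.Properties using () renaming (_≟_ to _≟ᵇ_)
open import Data.Fin using (Fin; zero; suc; funToFin; finToFun)
open import Data.Fin.Properties using (finToFun-funToFin; injective⇒≤)
open import Data.Fin.Subset using (Subset; ⋃; _∩_; Nonempty)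
open import Data.Fin.Subset.Properties using (anySubset?; nonempty?)
open import Data.Integer using (+_)
open import Data.List using (applyUpTo)
open import Data.Nat using (ℕ; zero; suc; _+_; _∸_; _^_; _≤_; NonZero; s≤s)
open import Data.Nat.ListAction using (sum)
open import Data.Nat.Properties using (m^n≢0; m≤n⇒m<n∨m≡n)
open import Data.Product using (Σ; ∃; _×_; _,_; proj₁; proj₂)
open import Data.Rational using (ℚ; _/_; ∣_∣) renaming (_*_ to _*ℚ_; _≤_ to _≤ℚ_)
open import Data.Sum using (inj₁; inj₂)
open import Data.Vec using (Vec; []; _∷_; _++_; toList; lookup)
open import Data.Vec.Membership.Propositional using (_∈_)
import Data.Vec.Membership.DecPropositional as DecMembership
open import Data.Vec.Properties using (≡-dec; tabulate∘lookup; tabulate-cong)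
open import Data.Vec.Relation.Unary.All using (All; []; _∷_; all?)
open import Data.Vec.Relation.Unary.AllPairs using (allPairs?; [])
open import Data.Vec.Relation.Unary.Unique.Propositional using (Unique)
open import Data.Vec.Relation.Unary.Unique.Propositional.Properties using (lookup-injective)
open import Relation.Binary using (DecidableEquality)
open import Relation.Binary.PropositionalEquality
  using (_≡_; refl; sym; trans; cong)
open import Relation.Nullary using (Dec; yes; no; ¬?; contradiction; _→-dec_)
import Relation.Nullary.Decidable as Dec
open import Relation.Unary using (Decidable)

sumFromTo : ℕ → ℕ → (ℕ → ℕ) → ℕ
sumFromTo a b g = sum (applyUpTo (λ k → g (a + k)) (suc b ∸ a))

infix 5 sumFromTo
syntax sumFromTo a b (λ i → e) = ∑[ a ≤ i ≤ b ] e

fromℕ : ℕ → ℚ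
fromℕ m = + m / 1

-- ε(n) = O(n⁻²) as n → ∞.  The value of ε at 0 is irrelevant.
O[n⁻²] : (ℕ → ℚ) → Set
O[n⁻²] ε = ∃ λ (C : ℚ) → ∃ λ (N : ℕ) → ∀ n .{{_ : NonZero n}} → N ≤ n →
  ∣ ε n ∣ ≤ℚ C *ℚ (_/_ (+ 1) (n ^ 2) {{m^n≢0 n 2}})

-- A family of m distinct subsets of an n-element set, listed in some order.
record SetSystem (n m : ℕ) : Set where
  constructor _,_
  field
    members  : Vec (Subset n) m
    distinct : Unique members

open SetSystem public

UnionIntersecting : ∀ {n m} → ℕ → ℕ → SetSystem n m → Set
UnionIntersecting {n} s t 𝓕 =
  (Fs : Vec (Subset n) s) (Gs : Vec (Subset n) t) →
  All (_∈ members 𝓕) (Fs ++ Gs) → Unique (Fs ++ Gs) →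
  Nonempty (⋃ (toList Fs) ∩ ⋃ (toList Gs))

UnionIntersectingSystem : (n s t m : ℕ) → Set
UnionIntersectingSystem n s t m = Σ (SetSystem n m) (UnionIntersecting s t)

IsMaximumSize : (n s t m : ℕ) → Set
IsMaximumSize n s t m =
  UnionIntersectingSystem n s t m × (∀ k → UnionIntersectingSystem n s t k → k ≤ m)

private
  _≟_ : ∀ {n} → DecidableEquality (Subset n)
  _≟_ = ≡-dec _≟ᵇ_

  unique? : ∀ {n m} (xs : Vec (Subset n) m) → Dec (Unique xs)
  unique? = allPairs? (λ x y → ¬? (x ≟ y))

  anyVec? : ∀ {n} m {P : Vec (Subset n) m → Set} → Decidable P → Dec (∃ P)
  anyVec? zero    P? = Dec.map′ ([] ,_) (λ { ([] , p) → p }) (P? [])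
  anyVec? (suc m) P? = Dec.map′
    (λ (x , xs , p) → x ∷ xs , p)
    (λ { (x ∷ xs , p) → x , xs , p })
    (anySubset? (λ x → anyVec? m (λ xs → P? (x ∷ xs))))

  allVec? : ∀ {n} m {P : Vec (Subset n) m → Set} → Decidable P → Dec (∀ xs → P xs)
  allVec? m P? = Dec.map′
    (λ ¬∃ xs → Dec.decidable-stable (P? xs) (λ ¬p → ¬∃ (xs , ¬p)))
    (λ ∀P (xs , ¬p) → ¬p (∀P xs))
    (¬? (anyVec? m (λ xs → ¬? (P? xs))))

  unionIntersecting? : ∀ {n m} s t (𝓕 : SetSystem n m) → Dec (UnionIntersecting s t 𝓕)
  unionIntersecting? s t 𝓕 = allVec? s λ Fs → allVec? t λ Gs →
    all? (_∈? members 𝓕) (Fs ++ Gs) →-dec unique? (Fs ++ Gs) →-dec nonempty? _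
    where open DecMembership _≟_ using (_∈?_)

  system? : ∀ n s t m → Dec (UnionIntersectingSystem n s t m)
  system? n s t m = Dec.map′
    (λ (xs , u , p) → (xs , u) , p)
    (λ ((xs , u) , p) → xs , u , p)
    (anyVec? m check)
    where
    check : (xs : Vec (Subset n) m) → Dec (Σ (Unique xs) λ u → UnionIntersecting s t (xs , u))
    check xs with unique? xs
    ... | no ¬u = no (λ (u , _) → ¬u u)
    ... | yes u = Dec.map′ (λ p → u , p) proj₂ (unionIntersecting? s t (xs , u))

  toFin : Bool → Fin 2
  toFin true  = zero
  toFin false = suc zero

  toFin-injective : ∀ x y → toFin x ≡ toFin y → x ≡ y
  toFin-injective true  true  _ = refl
  toFin-injective false false _ = refl

  index : ∀ {n} → Subset n → Fin (2 ^ n)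
  index p = funToFin (λ i → toFin (lookup p i))

  index-injective : ∀ {n} (p q : Subset n) → index p ≡ index q → p ≡ q
  index-injective p q eq = trans (sym (tabulate∘lookup p))
    (trans (tabulate-cong λ i → toFin-injective _ _
      (trans (sym (finToFun-funToFin _ i))
        (trans (cong (λ k → finToFun k i) eq) (finToFun-funToFin _ i))))
      (tabulate∘lookup q))

  size≤2^n : ∀ {n m} → SetSystem n m → m ≤ 2 ^ n
  size≤2^n (xs , u) = injective⇒≤ {f = λ i → index (lookup xs i)}
    (λ {i} {j} eq → lookup-injective u i j (index-injective _ _ eq))

  emptySystem : ∀ n s t .{{_ : NonZero s}} → UnionIntersectingSystem n s t 0
  emptySystem n (suc s) t = ([] , []) , λ { (_ ∷ _) Gs (() ∷ _) _ }

  largest : {P : ℕ → Set} → Decidable P → P 0 → ∀ b →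
            ∃ λ m → P m × (∀ k → k ≤ b → P k → k ≤ m)
  largest P? p₀ zero = 0 , p₀ , λ _ k≤0 _ → k≤0
  largest P? p₀ (suc b) with P? (suc b)
  ... | yes p = suc b , p , λ _ k≤ _ → k≤
  ... | no ¬p with largest P? p₀ b
  ...   | m , p , max = m , p , bound
    where
    bound : ∀ k → k ≤ suc b → _ → k ≤ m
    bound k k≤ pk with m≤n⇒m<n∨m≡n k≤
    ... | inj₁ (s≤s k≤b) = max k k≤b pk
    ... | inj₂ refl      = contradiction pk ¬p

abstract
  maximumSize : ∀ n s t .{{_ : NonZero s}} .{{_ : NonZero t}} →
                ∃ (IsMaximumSize n s t)
  maximumSize n s t with largest (system? n s t) (emptySystem n s t) (2 ^ n)
  ... | m , p , max = m , p , λ k 𝓕 → max k (size≤2^n (proj₁ 𝓕)) 𝓕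

f : ∀ n s t .{{_ : NonZero s}} .{{_ : NonZero t}} → ℕ
f n s t = proj₁ (maximumSize n s t)

f-isMaximumSize : ∀ n s t .{{_ : NonZero s}} .{{_ : NonZero t}} →
                  IsMaximumSize n s t (f n s t)
f-isMaximumSize n s t = proj₂ (maximumSize n s t)

{-# OPTIONS --safe #-}
-- Let 𝓖 consist of the A ∈ 𝓕, other than ∅ and [n], whose complement is in 𝓕 as well; then 2|𝓕| exceeds
-- 2ⁿ + |𝓖| by at most 2, and by 0 if ∅ ∉ 𝓕.  For A ∈ 𝓖 the members of 𝓖 inside A and those inside ∁ A have
-- disjoint unions, so s − 1 strict subsets and t − 1 strict supersets of A in 𝓖 contradict the hypothesis:
-- 𝓖 is an antichain for (1,2), has no 3-chain for (2,2), and has no large forks in general.  Counting the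
-- members of 𝓖 and the pairs of members on a random maximal chain bounds such families in the style of De
-- Bonis and Katona.  Where this ignores the symmetry of 𝓖 under complements (the antichain in odd and the
-- 3-chain condition in even dimension), Katona's cycle method with a parity argument for complementary arcs
-- gives the exact bound.  The lower bounds come from families defined by a threshold on the size that
-- depends on whether the set contains a fixed element.
module Submission where

open import Defs
import Data.Bool
open import Data.Bool using (Bool; true; false; _∧_; _∨_; not)
import Data.Bool.Properties
open import Data.Empty using () renaming (⊥ to Falsum; ⊥-elim to absurd)
open import Data.Fin using (Fin; zero; suc; toℕ)
import Data.Fin.Subset
open import Data.Fin.Subset using (Subset; ∁; ⊤; ⊥; ⋃; _⊆_) renaming (∣_∣ to card)
import Data.Fin.Subset.Properties as Subₚ
import Data.Integer as ℤ
import Data.Integer.Properties as ℤₚ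
open import Data.List using (List; []; _∷_; _++_; map; length; cartesianProductWith; applyUpTo)
import Data.List.Membership.Propositional
import Data.List.Membership.Propositional.Properties as Memₚ
import Data.List.Properties
import Data.List.Relation.Unary.All as Allˡ
open import Data.List.Relation.Unary.All using () renaming (All to Allˡ; [] to []ᵃ)
import Data.List.Relation.Unary.AllPairs as AllPairsˡ
import Data.List.Relation.Unary.Any
import Data.List.Relation.Unary.Unique.Propositional
import Data.List.Relation.Unary.Unique.Propositional.Properties as Uniqueₚ
open import Data.Nat using (ℕ; zero; suc; _+_; _*_; _∸_; _^_; _≤_; _<_; _≤ᵇ_; _<ᵇ_; _≡ᵇ_; z≤n; s≤s; _/_; _%_; NonZero; _!; _≤?_; >-nonZero)
open import Data.Nat.Combinatorics using (_C_; nCk+nC[k+1]≡[n+1]C[k+1]; nCk≡n!/k![n-k]!; k![n∸k]!∣n!; nCk≡nC[n∸k])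
open import Data.Nat.Divisibility using (_∣_; _∤_; divides)
open import Data.Nat.DivMod using (m≡m%n+[m/n]*n; m%n<n; m/n*n≡m; m*n/n≡m; %-distribˡ-+; m%n≤m; m<n⇒m%n≡m; [m+n]%n≡m%n; m%n%n≡m%n)
import Data.Nat.ListAction
open import Data.Nat.Properties
open import Data.Nat.Tactic.RingSolver using (solve-∀)
open import Data.Product using (Σ; ∃; _×_; _,_; proj₁; proj₂)
import Data.Rational as ℚ
open import Data.Rational using (ℚ; ½; 1ℚ) renaming (_/_ to _/ℚ_; _+_ to _+ℚ_; _*_ to _*ℚ_; _≤_ to _≤ℚ_)
import Data.Rational.Properties as ℚₚ
import Data.Rational.Solver
import Data.Rational.Unnormalised as ℚᵘ
import Data.Rational.Unnormalised.Properties as ℚᵘₚ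
open import Data.Sum using (_⊎_; inj₁; inj₂)
import Data.Vec
open import Data.Vec using (Vec; []; _∷_; lookup; insertAt; removeAt; tabulate; toList) renaming (_++_ to _++ᵥ_)
open import Data.Vec.Membership.Propositional using () renaming (_∈_ to _∈ᵥ_)
import Data.Vec.Properties
open import Data.Vec.Relation.Unary.All using (All; []; _∷_)
import Data.Vec.Relation.Unary.All as All
import Data.Vec.Relation.Unary.All.Properties as Allₚ
import Data.Vec.Relation.Unary.AllPairs as AllPairs
import Data.Vec.Relation.Unary.AllPairs.Properties as AllPairsₚ
open import Data.Vec.Relation.Unary.Any using (here; there)
open import Data.Vec.Relation.Unary.Unique.Propositional using (Unique)
open import Function using (_∘_; id)
open import Relation.Binary.PropositionalEquality using (_≡_; _≢_; refl; sym; trans; cong; cong₂; subst; subst₂; module ≡-Reasoning)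
open import Relation.Nullary using (yes; no)

-- Sums over lists

-- Removing ∅ and [n] serves two purposes. The hypothesis speaks of pairwise different sets, and ∅
-- is the only set inside both `A` and `∁ A`; without it the two collections are disjoint
-- automatically. Moreover a nonempty proper subset of a `b`-element set lies on at most `(b ∸ 1) !`
-- of its maximal chains, the estimate behind the fork and pair bounds. The price of 2 is paid in
-- three ways: for s = 1 a family containing ∅ has at most t members; for (2,2) it forces an
-- antichain, which stays below the bound by at least 2; in (e) and (f) it enters the error. The
-- exact targets show why symmetry matters. For n = 2k+1 Sperner's bound is `n C k`, but the target
-- is 2k/n times that: one arc fewer on every cycle. For n = 2k two middle levels would give
-- `(n C k) + (n C (k ∸ 1))`, but the target is `2 * (n C (k ∸ 1))`, and the surplus sits in the
-- arcs of half length. For (1,3) with n odd, symmetry allows keeping only the half of 𝓖 that avoids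
-- a fixed element, a family in even dimension.

∑ : {X : Set} → List X → (X → ℕ) → ℕ
∑ []       g = 0
∑ (x ∷ xs) g = g x + ∑ xs g

module _ {X : Set} where

  ∑-mono : ∀ (xs : List X) {g h : X → ℕ} → (∀ x → g x ≤ h x) → ∑ xs g ≤ ∑ xs h
  ∑-mono []       le = z≤n
  ∑-mono (x ∷ xs) le = +-mono-≤ (le x) (∑-mono xs le)

  ∑-cong : ∀ (xs : List X) {g h : X → ℕ} → (∀ x → g x ≡ h x) → ∑ xs g ≡ ∑ xs h
  ∑-cong []       eq = refl
  ∑-cong (x ∷ xs) eq = cong₂ _+_ (eq x) (∑-cong xs eq)

  ∑-+ : ∀ (xs : List X) (g h : X → ℕ) → ∑ xs (λ x → g x + h x) ≡ ∑ xs g + ∑ xs h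
  ∑-+ []       g h = refl
  ∑-+ (x ∷ xs) g h rewrite ∑-+ xs g h = interchange (g x) (h x) (∑ xs g) (∑ xs h)
    where
    interchange : ∀ a b c d → a + b + (c + d) ≡ a + c + (b + d)
    interchange = solve-∀

  ∑-*ˡ : ∀ (xs : List X) c (g : X → ℕ) → ∑ xs (λ x → c * g x) ≡ c * ∑ xs g
  ∑-*ˡ []       c g = sym (*-zeroʳ c)
  ∑-*ˡ (x ∷ xs) c g rewrite ∑-*ˡ xs c g = sym (*-distribˡ-+ c (g x) (∑ xs g))

  ∑-*ʳ : ∀ (xs : List X) c (g : X → ℕ) → ∑ xs (λ x → g x * c) ≡ ∑ xs g * c
  ∑-*ʳ xs c g = trans (∑-cong xs (λ x → *-comm (g x) c)) (trans (∑-*ˡ xs c g) (*-comm c _))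

  ∑-0 : ∀ (xs : List X) → ∑ xs (λ _ → 0) ≡ 0
  ∑-0 []       = refl
  ∑-0 (_ ∷ xs) = ∑-0 xs

  ∑-const : ∀ (xs : List X) c → ∑ xs (λ _ → c) ≡ length xs * c
  ∑-const []       c = refl
  ∑-const (_ ∷ xs) c = cong (c +_) (∑-const xs c)

  ∑-++ : ∀ (xs ys : List X) (g : X → ℕ) → ∑ (xs ++ ys) g ≡ ∑ xs g + ∑ ys g
  ∑-++ []       ys g = refl
  ∑-++ (x ∷ xs) ys g rewrite ∑-++ xs ys g = sym (+-assoc (g x) _ _)

module _ {X Y : Set} where

  ∑-map : ∀ (φ : X → Y) xs (g : Y → ℕ) → ∑ (map φ xs) g ≡ ∑ xs (g ∘ φ)
  ∑-map φ []       g = refl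
  ∑-map φ (x ∷ xs) g = cong (g (φ x) +_) (∑-map φ xs g)

  ∑-swap : ∀ (xs : List X) (ys : List Y) (g : X → Y → ℕ) →
           ∑ xs (λ x → ∑ ys (g x)) ≡ ∑ ys (λ y → ∑ xs (λ x → g x y))
  ∑-swap []       ys g = sym (∑-0 ys)
  ∑-swap (x ∷ xs) ys g rewrite ∑-swap xs ys g = sym (∑-+ ys (g x) _)

∑-cartesian : ∀ {X Y Z : Set} (φ : X → Y → Z) xs ys (g : Z → ℕ) →
              ∑ (cartesianProductWith φ xs ys) g ≡ ∑ xs (λ x → ∑ ys (λ y → g (φ x y)))
∑-cartesian φ []       ys g = refl
∑-cartesian φ (x ∷ xs) ys g
  rewrite ∑-++ (map (φ x) ys) (cartesianProductWith φ xs ys) g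
        | ∑-map (φ x) ys g
        | ∑-cartesian φ xs ys g = refl

-- Indicators of Boolean conditions

⟦_⟧ : Bool → ℕ
⟦ true  ⟧ = 1
⟦ false ⟧ = 0

⟦⟧≤1 : ∀ b → ⟦ b ⟧ ≤ 1
⟦⟧≤1 true  = ≤-refl
⟦⟧≤1 false = z≤n

true≢false : ∀ {b} → b ≡ true → b ≡ false → Falsum
true≢false refl ()

∧-elimˡ : ∀ {a b} → a ∧ b ≡ true → a ≡ true
∧-elimˡ {true} _ = refl

∧-elimʳ : ∀ {a b} → a ∧ b ≡ true → b ≡ true
∧-elimʳ {true} p = p

∧-intro : ∀ {a b} → a ≡ true → b ≡ true → a ∧ b ≡ true
∧-intro refl refl = refl

⟦⟧-mono : ∀ {a b} → (a ≡ true → b ≡ true) → ⟦ a ⟧ ≤ ⟦ b ⟧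
⟦⟧-mono {true}  imp rewrite imp refl = ≤-refl
⟦⟧-mono {false} imp = z≤n

⟦⟧-*-mono : ∀ b {x y} → (b ≡ true → x ≤ y) → ⟦ b ⟧ * x ≤ ⟦ b ⟧ * y
⟦⟧-*-mono true  le = +-monoˡ-≤ 0 (le refl)
⟦⟧-*-mono false le = z≤n

≡ᵇ-from : ∀ {a b} → (a ≡ true → b ≡ true) → (b ≡ true → a ≡ true) → a ≡ b
≡ᵇ-from {true}  {true}  _ _ = refl
≡ᵇ-from {true}  {false} i _ = sym (i refl)
≡ᵇ-from {false} {true}  _ i = i refl
≡ᵇ-from {false} {false} _ _ = refl

≤ᵇ-to : ∀ {a b} → (a ≤ᵇ b) ≡ true → a ≤ b
≤ᵇ-to {a} {b} eq = ≤ᵇ⇒≤ a b (subst Data.Bool.T (sym eq) _)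

≤ᵇ-from : ∀ {a b} → a ≤ b → (a ≤ᵇ b) ≡ true
≤ᵇ-from {a} {b} le with a ≤ᵇ b | ≤⇒≤ᵇ le
... | true | _ = refl

<ᵇ-to : ∀ {a b} → (a <ᵇ b) ≡ true → a < b
<ᵇ-to {a} {b} eq = <ᵇ⇒< a b (subst Data.Bool.T (sym eq) _)

<ᵇ-from : ∀ {a b} → a < b → (a <ᵇ b) ≡ true
<ᵇ-from {a} {b} lt with a <ᵇ b | <⇒<ᵇ lt
... | true | _ = refl

bool-cases : ∀ b → b ≡ true ⊎ b ≡ false
bool-cases true  = inj₁ refl
bool-cases false = inj₂ refl

<ᵇ-false : ∀ {a b} → (a <ᵇ b) ≡ false → b ≤ a
<ᵇ-false {a} {b} eq = ≮⇒≥ (λ lt → true≢false (<ᵇ-from lt) eq)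

-- Subsets, families and complements

subsets : ∀ n → List (Subset n)
subsets zero    = [] ∷ []
subsets (suc n) = map (true ∷_) (subsets n) ++ map (false ∷_) (subsets n)

∑-subsets-suc : ∀ {n} (g : Subset (suc n) → ℕ) →
  ∑ (subsets (suc n)) g ≡ ∑ (subsets n) (λ A → g (true ∷ A)) + ∑ (subsets n) (λ A → g (false ∷ A))
∑-subsets-suc {n} g
  rewrite ∑-++ (map (true ∷_) (subsets n)) (map (false ∷_) (subsets n)) g
        | ∑-map {Y = Subset (suc n)} (true ∷_) (subsets n) g
        | ∑-map {Y = Subset (suc n)} (false ∷_) (subsets n) g = refl

-- A Boolean predicate on all subsets instead of a list of members: every count is a sum of
-- indicators over `subsets n`, and double counting is an exchange of sums.
Family : ℕ → Set
Family n = Subset n → Bool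

size : ∀ {n} → Family n → ℕ
size {n} P = ∑ (subsets n) (λ A → ⟦ P A ⟧)

_⊆ᵇ_ : ∀ {n} → Subset n → Subset n → Bool
[]      ⊆ᵇ []      = true
(a ∷ A) ⊆ᵇ (b ∷ B) = (not a ∨ b) ∧ (A ⊆ᵇ B)

_⊂ᵇ_ : ∀ {n} → Subset n → Subset n → Bool
A ⊂ᵇ B = (A ⊆ᵇ B) ∧ (card A <ᵇ card B)

_≡ᵇˢ_ : ∀ {n} → Subset n → Subset n → Bool
[]          ≡ᵇˢ []          = true
(true ∷ A)  ≡ᵇˢ (true ∷ B)  = A ≡ᵇˢ B
(false ∷ A) ≡ᵇˢ (false ∷ B) = A ≡ᵇˢ B
(true ∷ A)  ≡ᵇˢ (false ∷ B) = false
(false ∷ A) ≡ᵇˢ (true ∷ B)  = false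

infix 8 _⊆ᵇ_ _⊂ᵇ_ _≡ᵇˢ_ _∈ᵇ_

≡ᵇˢ-to : ∀ {n} (A B : Subset n) → A ≡ᵇˢ B ≡ true → A ≡ B
≡ᵇˢ-to []          []          _  = refl
≡ᵇˢ-to (true ∷ A)  (true ∷ B)  eq = cong (true ∷_) (≡ᵇˢ-to A B eq)
≡ᵇˢ-to (false ∷ A) (false ∷ B) eq = cong (false ∷_) (≡ᵇˢ-to A B eq)

≡ᵇˢ-refl : ∀ {n} (A : Subset n) → A ≡ᵇˢ A ≡ true
≡ᵇˢ-refl []          = refl
≡ᵇˢ-refl (true ∷ A)  = ≡ᵇˢ-refl A
≡ᵇˢ-refl (false ∷ A) = ≡ᵇˢ-refl A

⊆ᵇ-to : ∀ {n} {A B : Subset n} → A ⊆ᵇ B ≡ true → A ⊆ B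
⊆ᵇ-to {A = true ∷ A}  {true ∷ B}  eq Data.Vec.here      = Data.Vec.here
⊆ᵇ-to {A = true ∷ A}  {true ∷ B}  eq (Data.Vec.there x) = Data.Vec.there (⊆ᵇ-to eq x)
⊆ᵇ-to {A = false ∷ A} {b ∷ B}     eq (Data.Vec.there x) = Data.Vec.there (⊆ᵇ-to eq x)

⊆ᵇ-from : ∀ {n} {A B : Subset n} → A ⊆ B → A ⊆ᵇ B ≡ true
⊆ᵇ-from {A = []}        {[]}    _   = refl
⊆ᵇ-from {A = true ∷ A}  {b ∷ B} sub with sub Data.Vec.here
... | Data.Vec.here = ⊆ᵇ-from (Subₚ.drop-∷-⊆ sub)
⊆ᵇ-from {A = false ∷ A} {b ∷ B} sub = ⊆ᵇ-from (Subₚ.drop-∷-⊆ sub)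

⊆ᵇ-refl : ∀ {n} (A : Subset n) → A ⊆ᵇ A ≡ true
⊆ᵇ-refl A = ⊆ᵇ-from {A = A} {A} id

⊆⇒card≤ : ∀ {n} (A B : Subset n) → A ⊆ᵇ B ≡ true → card A ≤ card B
⊆⇒card≤ A B eq = Subₚ.p⊆q⇒∣p∣≤∣q∣ (⊆ᵇ-to {A = A} {B} eq)

⊂ᵇ⇒card< : ∀ {n} (A B : Subset n) → A ⊂ᵇ B ≡ true → card A < card B
⊂ᵇ⇒card< A B eq = <ᵇ-to (∧-elimʳ {A ⊆ᵇ B} eq)

⊆∧card≥⇒≡ : ∀ {n} (A B : Subset n) → A ⊆ᵇ B ≡ true → card B ≤ card A → A ≡ B
⊆∧card≥⇒≡ []          []          _  _        = refl
⊆∧card≥⇒≡ (true ∷ A)  (true ∷ B)  eq (s≤s le) = cong (true ∷_) (⊆∧card≥⇒≡ A B eq le)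
⊆∧card≥⇒≡ (false ∷ A) (true ∷ B)  eq le       =
  absurd (<-irrefl refl (≤-trans le (⊆⇒card≤ A B eq)))
⊆∧card≥⇒≡ (false ∷ A) (false ∷ B) eq le       = cong (false ∷_) (⊆∧card≥⇒≡ A B eq le)

∁-⊆ᵇ : ∀ {n} (A B : Subset n) → ∁ B ⊆ᵇ ∁ A ≡ A ⊆ᵇ B
∁-⊆ᵇ []      []      = refl
∁-⊆ᵇ (a ∷ A) (b ∷ B) rewrite ∁-⊆ᵇ A B = cong (_∧ A ⊆ᵇ B) (flip-∨ a b)
  where
  flip-∨ : ∀ a b → not (not b) ∨ not a ≡ not a ∨ b
  flip-∨ true  true  = refl
  flip-∨ true  false = refl
  flip-∨ false true  = refl
  flip-∨ false false = refl

∁-involutive : ∀ {n} (A : Subset n) → ∁ (∁ A) ≡ A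
∁-involutive []          = refl
∁-involutive (true ∷ A)  = cong (true ∷_) (∁-involutive A)
∁-involutive (false ∷ A) = cong (false ∷_) (∁-involutive A)

card-∁ : ∀ {n} (A : Subset n) → card A + card (∁ A) ≡ n
card-∁ []          = refl
card-∁ (true ∷ A)  = cong suc (card-∁ A)
card-∁ (false ∷ A) = trans (+-suc (card A) _) (cong suc (card-∁ A))

∁-⊂ᵇ : ∀ {n} (A B : Subset n) → ∁ B ⊂ᵇ ∁ A ≡ A ⊂ᵇ B
∁-⊂ᵇ A B rewrite ∁-⊆ᵇ A B = cong (A ⊆ᵇ B ∧_) (≡ᵇ-from
  (λ eq → <ᵇ-from (flip-< A B (card-∁ A) (card-∁ B) (<ᵇ-to eq)))
  (λ eq → <ᵇ-from (flip-< (∁ B) (∁ A) (trans (+-comm (card (∁ B)) _) (card-∁ B))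
                                      (trans (+-comm (card (∁ A)) _) (card-∁ A)) (<ᵇ-to eq))))
  where
  flip-< : ∀ {n a' b'} (A B : Subset n) → card A + a' ≡ n → card B + b' ≡ n → b' < a' → card A < card B
  flip-< A B eqA eqB lt = ≰⇒> λ ge →
    <-irrefl (trans eqB (sym eqA)) (+-mono-≤-< ge lt)

∑-∁ : ∀ {n} (g : Subset n → ℕ) → ∑ (subsets n) (g ∘ ∁) ≡ ∑ (subsets n) g
∑-∁ {zero}  g = refl
∑-∁ {suc n} g
  rewrite ∑-subsets-suc (g ∘ ∁)
        | ∑-subsets-suc g
        | ∑-∁ (λ A → g (true ∷ A))
        | ∑-∁ (λ A → g (false ∷ A)) = +-comm (∑ (subsets n) (λ A → g (false ∷ A))) _

∑-single : ∀ {n} (B : Subset n) (g : Subset n → ℕ) → ∑ (subsets n) (λ A → ⟦ A ≡ᵇˢ B ⟧ * g A) ≡ g B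
∑-single []          g = trans (+-identityʳ _) (+-identityʳ _)
∑-single {suc n} (true ∷ B)  g
  rewrite ∑-subsets-suc {n} (λ A → ⟦ A ≡ᵇˢ (true ∷ B) ⟧ * g A)
        | ∑-0 (subsets n) | ∑-single B (λ A → g (true ∷ A)) = +-identityʳ _
∑-single {suc n} (false ∷ B) g
  rewrite ∑-subsets-suc {n} (λ A → ⟦ A ≡ᵇˢ (false ∷ B) ⟧ * g A)
        | ∑-0 (subsets n) | ∑-single B (λ A → g (false ∷ A)) = refl

size-single : ∀ {n} (B : Subset n) → size (λ A → A ≡ᵇˢ B) ≡ 1
size-single {n} B = trans (∑-cong (subsets n) (λ A → sym (*-identityʳ _))) (∑-single B (λ _ → 1))

size-mono : ∀ {n} {P Q : Family n} → (∀ A → P A ≡ true → Q A ≡ true) → size P ≤ size Q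
size-mono {n} imp = ∑-mono (subsets n) (λ A → ⟦⟧-mono (imp A))

size-empty : ∀ {n} (P : Family n) → (∀ A → P A ≡ true → Falsum) → size P ≡ 0
size-empty {n} P empty = trans (∑-cong (subsets n) (λ A → zero-term A (P A) refl)) (∑-0 (subsets n))
  where
  zero-term : ∀ A b → P A ≡ b → ⟦ b ⟧ ≡ 0
  zero-term A true  p = absurd (empty A p)
  zero-term A false _ = refl

size-all : ∀ n → size {n} (λ _ → true) ≡ 2 ^ n
size-all zero    = refl
size-all (suc n) rewrite ∑-subsets-suc {n} (λ _ → 1) | size-all n = cong (2 ^ n +_) (sym (+-identityʳ _))

_without_ : ∀ {n} → Family n → Subset n → Family n
(P without B) A = P A ∧ not (A ≡ᵇˢ B)

without-≢ : ∀ {n} (P : Family n) B A → (P without B) A ≡ true → A ≢ B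
without-≢ P B A eq refl with ∧-elimʳ {P A} eq
... | q rewrite ≡ᵇˢ-refl A with q
... | ()

size-without : ∀ {n} (P : Family n) B → size P ≡ ⟦ P B ⟧ + size (P without B)
size-without {n} P B = begin
  size P  ≡⟨ ∑-cong (subsets n) split ⟩
  ∑ (subsets n) (λ A → ⟦ A ≡ᵇˢ B ⟧ * ⟦ P A ⟧ + ⟦ (P without B) A ⟧)  ≡⟨ ∑-+ (subsets n) _ _ ⟩
  ∑ (subsets n) (λ A → ⟦ A ≡ᵇˢ B ⟧ * ⟦ P A ⟧) + size (P without B)   ≡⟨ cong (_+ size (P without B)) (∑-single B _) ⟩
  ⟦ P B ⟧ + size (P without B) ∎
  where
  open ≡-Reasoning
  split : ∀ A → ⟦ P A ⟧ ≡ ⟦ A ≡ᵇˢ B ⟧ * ⟦ P A ⟧ + ⟦ (P without B) A ⟧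
  split A with A ≡ᵇˢ B | P A
  ... | true  | true  = refl
  ... | true  | false = refl
  ... | false | true  = refl
  ... | false | false = refl

-- Choosing distinct members

private
  fresh : ∀ {X : Set} {x : X} {k} (xs : List X) → Allˡ (x ≢_) xs →
          (v : Vec X k) → All (λ y → Data.List.Membership.Propositional._∈_ y xs) v → All (x ≢_) v
  fresh xs ne []      []       = []
  fresh xs ne (y ∷ v) (m ∷ ms) = Allˡ.lookup ne m ∷ fresh xs ne v ms

module _ {X : Set} where
  open Data.List.Relation.Unary.Unique.Propositional using () renaming (Unique to Uniqueˡ)
  open Data.List.Membership.Propositional using () renaming (_∈_ to _∈ˡ_)

  -- The membership component carries the induction: the head differs from all later choices because
  -- these come from the tail of a duplicate-free list.
  pick-list : ∀ (P : X → Bool) (xs : List X) → Uniqueˡ xs → ∀ t → t ≤ ∑ xs (λ x → ⟦ P x ⟧) →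
    Σ (Vec X t) λ v → Unique v × All (λ x → P x ≡ true) v × All (_∈ˡ xs) v
  pick-list P xs       u           zero    le = [] , AllPairs.[] , [] , []
  pick-list P (x ∷ xs) (ne AllPairsˡ.∷ u) (suc t) le with P x in eq
  ... | true with pick-list P xs u t (≤-pred le)
  ...   | v , uv , pv , mv = x ∷ v , fresh xs ne v mv AllPairs.∷ uv , eq ∷ pv ,
          Data.List.Relation.Unary.Any.here refl ∷ All.map Data.List.Relation.Unary.Any.there mv
  pick-list P (x ∷ xs) (ne AllPairsˡ.∷ u) (suc t) le | false with pick-list P xs u (suc t) le
  ...   | v , uv , pv , mv = v , uv , pv , All.map Data.List.Relation.Unary.Any.there mv

subsets-unique : ∀ n → Data.List.Relation.Unary.Unique.Propositional.Unique (subsets n)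
subsets-unique zero    = []ᵃ AllPairsˡ.∷ AllPairsˡ.[]
subsets-unique (suc n) = Uniqueₚ.++⁺
  (Uniqueₚ.map⁺ (λ { refl → refl }) (subsets-unique n))
  (Uniqueₚ.map⁺ (λ { refl → refl }) (subsets-unique n))
  (λ (p , q) → disjoint (Memₚ.∈-map⁻ (true ∷_) p) (Memₚ.∈-map⁻ (false ∷_) q))
  where
  disjoint : ∀ {n} {A : Subset (suc n)} {P Q : Subset n → Set} →
             ∃ (λ B → P B × A ≡ true ∷ B) → ∃ (λ B → Q B × A ≡ false ∷ B) → Falsum
  disjoint (_ , _ , refl) (_ , _ , ())

pick : ∀ {n} (P : Family n) t → t ≤ size P →
       Σ (Vec (Subset n) t) λ v → Unique v × All (λ A → P A ≡ true) v
pick {n} P t le with pick-list P (subsets n) (subsets-unique n) t le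
... | v , u , p , _ = v , u , p

_∈ᵇ_ : ∀ {n m} → Subset n → Vec (Subset n) m → Bool
A ∈ᵇ []      = false
A ∈ᵇ (B ∷ v) = A ≡ᵇˢ B ∨ A ∈ᵇ v

∈ᵇ-to : ∀ {n m} {A : Subset n} (v : Vec (Subset n) m) → A ∈ᵇ v ≡ true → A ∈ᵥ v
∈ᵇ-to {A = A} (B ∷ v) eq with A ≡ᵇˢ B in e
... | true  = here (≡ᵇˢ-to A B e)
... | false = there (∈ᵇ-to v eq)

∉ᵇ-from : ∀ {n m} {A : Subset n} (v : Vec (Subset n) m) → All (A ≢_) v → A ∈ᵇ v ≡ false
∉ᵇ-from []              []        = refl
∉ᵇ-from {A = A} (B ∷ v) (ne ∷ ns) with A ≡ᵇˢ B in e
... | true  = absurd (ne (≡ᵇˢ-to A B e))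
... | false = ∉ᵇ-from v ns

size-∈ᵇ : ∀ {n m} (v : Vec (Subset n) m) → Unique v → size (_∈ᵇ v) ≡ m
size-∈ᵇ {n} []      _              = ∑-0 (subsets n)
size-∈ᵇ {n} {suc m} (B ∷ v) (ne AllPairs.∷ u) = begin
  size (_∈ᵇ (B ∷ v))  ≡⟨ ∑-cong (subsets n) split ⟩
  ∑ (subsets n) (λ A → ⟦ A ≡ᵇˢ B ⟧ + ⟦ A ∈ᵇ v ⟧)        ≡⟨ ∑-+ (subsets n) _ _ ⟩
  size (_≡ᵇˢ B) + size (_∈ᵇ v)  ≡⟨ cong₂ _+_ (size-single B) (size-∈ᵇ v u) ⟩
  suc m                                                 ∎
  where
  open ≡-Reasoning
  split : ∀ A → ⟦ A ∈ᵇ (B ∷ v) ⟧ ≡ ⟦ A ≡ᵇˢ B ⟧ + ⟦ A ∈ᵇ v ⟧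
  split A with A ≡ᵇˢ B in e
  ... | false = refl
  ... | true rewrite ≡ᵇˢ-to A B e | ∉ᵇ-from v ne = refl

-- Complementary pairs

-- Two unions are disjoint exactly when some `A` contains one of them and `∁ A` the other.
-- Quantifying over the separating set turns the hypothesis into a statement about sizes, from which
-- `pick` extracts exactly `s` and `t` different members.
NoSplit : ∀ {n} → ℕ → ℕ → Family n → Set
NoSplit {n} s t 𝓕 = ∀ (A : Subset n) (P Q : Family n) →
  (∀ B → P B ≡ true → 𝓕 B ≡ true × B ⊆ᵇ A ≡ true) →
  (∀ B → Q B ≡ true → 𝓕 B ≡ true × B ⊆ᵇ ∁ A ≡ true) →
  (∀ B → P B ≡ true → Q B ≡ true → Falsum) →
  s ≤ size P → t ≤ size Q → Falsum

⋃-lub : ∀ {n k} (A : Subset n) (v : Vec (Subset n) k) → All (λ B → B ⊆ᵇ A ≡ true) v → ⋃ (toList v) ⊆ A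
⋃-lub A []      []         x∈ = absurd (Subₚ.∉⊥ x∈)
⋃-lub A (B ∷ v) (sub ∷ ss) x∈ with Subₚ.x∈p∪q⁻ B (⋃ (toList v)) x∈
... | inj₁ x∈B = ⊆ᵇ-to sub x∈B
... | inj₂ x∈v = ⋃-lub A v ss x∈v

noSplit : ∀ {n m s t} (𝓢 : SetSystem n m) → UnionIntersecting s t 𝓢 → NoSplit s t (_∈ᵇ members 𝓢)
noSplit {s = s} {t} 𝓢 ui A P Q P⊆ Q⊆ PQ s≤ t≤ with pick P s s≤ | pick Q t t≤
... | Fs , uF , pF | Gs , uG , pG with ui Fs Gs
      (Allₚ.++⁺ (All.map (λ {B} p → ∈ᵇ-to (members 𝓢) (proj₁ (P⊆ B p))) pF)
                (All.map (λ {B} q → ∈ᵇ-to (members 𝓢) (proj₁ (Q⊆ B q))) pG))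
      (AllPairsₚ.++⁺ uF uG (All.map (λ {B} p → All.map (λ { q refl → PQ B p q }) pG) pF))
... | x , x∈ with Subₚ.x∈p∩q⁻ (⋃ (toList Fs)) (⋃ (toList Gs)) x∈
... | x∈F , x∈G = Subₚ.x∈p⇒x∉∁p
  (⋃-lub A Fs (All.map (λ {B} p → proj₂ (P⊆ B p)) pF) x∈F)
  (⋃-lub (∁ A) Gs (All.map (λ {B} q → proj₂ (Q⊆ B q)) pG) x∈G)

SelfComplementary : ∀ {n} → Family n → Set
SelfComplementary 𝓖 = ∀ A → 𝓖 (∁ A) ≡ 𝓖 A

core : ∀ {n} → Family n → Family n
core 𝓕 A = 𝓕 A ∧ 𝓕 (∁ A)

-- Both `A` and `∁ A` are tested, which keeps the restricted core closed under complements.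
inner : ∀ {n} → Subset n → Bool
inner A = (0 <ᵇ card A) ∧ (0 <ᵇ card (∁ A))

innerCore : ∀ {n} → Family n → Family n
innerCore 𝓕 A = core 𝓕 A ∧ inner A

innerCore-selfComplementary : ∀ {n} (𝓕 : Family n) → SelfComplementary (innerCore 𝓕)
innerCore-selfComplementary 𝓕 A rewrite ∁-involutive A =
  cong₂ _∧_ (Data.Bool.Properties.∧-comm (𝓕 (∁ A)) (𝓕 A)) (Data.Bool.Properties.∧-comm (0 <ᵇ card (∁ A)) (0 <ᵇ card A))

-- Each complementary pair meets 𝓕 in one set plus possibly a second one, which the core counts.
size-core : ∀ {n} (𝓕 : Family n) → 2 * size 𝓕 ≤ 2 ^ n + size (core 𝓕)
size-core {n} 𝓕 = begin
  2 * size 𝓕  ≡⟨ cong (size 𝓕 +_) (+-identityʳ _) ⟩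
  size 𝓕 + size 𝓕  ≡⟨ cong (size 𝓕 +_) (sym (∑-∁ (λ A → ⟦ 𝓕 A ⟧))) ⟩
  size 𝓕 + size (𝓕 ∘ ∁)  ≡⟨ sym (∑-+ (subsets n) _ _) ⟩
  ∑ (subsets n) (λ A → ⟦ 𝓕 A ⟧ + ⟦ 𝓕 (∁ A) ⟧)             ≤⟨ ∑-mono (subsets n) (λ A → pair (𝓕 A) (𝓕 (∁ A))) ⟩
  ∑ (subsets n) (λ A → 1 + ⟦ core 𝓕 A ⟧)  ≡⟨ ∑-+ (subsets n) _ _ ⟩
  size {n} (λ _ → true) + size (core 𝓕)  ≡⟨ cong (_+ size (core 𝓕)) (size-all n) ⟩
  2 ^ n + size (core 𝓕) ∎
  where
  open ≤-Reasoning
  pair : ∀ a b → ⟦ a ⟧ + ⟦ b ⟧ ≤ 1 + ⟦ a ∧ b ⟧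
  pair true  b = ≤-refl
  pair false b = ⟦⟧≤1 b

card≡0⇒≡⊥ : ∀ {n} (A : Subset n) → card A ≡ 0 → A ≡ ⊥
card≡0⇒≡⊥ []          _  = refl
card≡0⇒≡⊥ (false ∷ A) eq = cong (false ∷_) (card≡0⇒≡⊥ A eq)

size-innerCore : ∀ {n} (𝓕 : Family n) → size (core 𝓕) ≤ size (innerCore 𝓕) + 2 * ⟦ 𝓕 ⊥ ⟧
size-innerCore {n} 𝓕 = begin
  size (core 𝓕)  ≤⟨ ∑-mono (subsets n) bound ⟩
  ∑ (subsets n) (λ A → ⟦ innerCore 𝓕 A ⟧ + (⟦ A ≡ᵇˢ ⊥ ⟧ * e + ⟦ ∁ A ≡ᵇˢ ⊥ ⟧ * e))
    ≡⟨ trans (∑-+ (subsets n) _ _) (cong (size (innerCore 𝓕) +_) (∑-+ (subsets n) _ _)) ⟩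
  size (innerCore 𝓕) + (∑ (subsets n) (λ A → ⟦ A ≡ᵇˢ ⊥ ⟧ * e) + ∑ (subsets n) (λ A → ⟦ ∁ A ≡ᵇˢ ⊥ ⟧ * e))
    ≡⟨ cong (size (innerCore 𝓕) +_) (cong₂ _+_ (∑-single {n} ⊥ (λ _ → e))
         (trans (∑-∁ {n} (λ A → ⟦ A ≡ᵇˢ ⊥ ⟧ * e)) (trans (∑-single {n} ⊥ (λ _ → e)) (sym (+-identityʳ e))))) ⟩
  size (innerCore 𝓕) + 2 * e ∎
  where
  open ≤-Reasoning
  e = ⟦ 𝓕 ⊥ ⟧
  ⊥-case : ∀ A → card A ≡ 0 → ⟦ 𝓕 A ⟧ ≤ ⟦ A ≡ᵇˢ ⊥ ⟧ * e
  ⊥-case A eq rewrite card≡0⇒≡⊥ A eq | ≡ᵇˢ-refl (⊥ {n}) = m≤m+n e 0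
  bound : ∀ A → ⟦ core 𝓕 A ⟧ ≤ ⟦ innerCore 𝓕 A ⟧ + (⟦ A ≡ᵇˢ ⊥ ⟧ * e + ⟦ ∁ A ≡ᵇˢ ⊥ ⟧ * e)
  bound A with card A in eq₁ | card (∁ A) in eq₂
  ... | zero  | _     = ≤-trans (⟦⟧-mono (∧-elimˡ {𝓕 A}))
        (≤-trans (⊥-case A eq₁) (≤-trans (m≤m+n _ _) (m≤n+m _ ⟦ core 𝓕 A ∧ false ⟧)))
  ... | suc _ | zero  = ≤-trans (⟦⟧-mono (∧-elimʳ {𝓕 A}))
        (≤-trans (⊥-case (∁ A) eq₂) (≤-trans (m≤n+m _ _) (m≤n+m _ ⟦ core 𝓕 A ∧ false ⟧)))
  ... | suc _ | suc _ = ≤-trans (⟦⟧-mono (λ c → ∧-intro c refl)) (m≤m+n _ _)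

-- Degrees in the core

sub sup : ∀ {n} → Family n → Subset n → ℕ
sub 𝓖 A = size (λ B → 𝓖 B ∧ B ⊂ᵇ A)
sup 𝓖 A = size (λ B → 𝓖 B ∧ A ⊂ᵇ B)

⊂ᵇ-irrefl : ∀ {n} (A : Subset n) → A ⊂ᵇ A ≡ false
⊂ᵇ-irrefl A with A ⊂ᵇ A in eq
... | false = refl
... | true  = absurd (<-irrefl (refl {x = card A}) (<ᵇ-to (∧-elimʳ {A ⊆ᵇ A} eq)))

sub-∁ : ∀ {n} (𝓖 : Family n) → SelfComplementary 𝓖 → ∀ A → sub 𝓖 (∁ A) ≡ sup 𝓖 A
sub-∁ {n} 𝓖 sc A = trans (sym (∑-∁ (λ B → ⟦ 𝓖 B ∧ B ⊂ᵇ ∁ A ⟧)))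
  (∑-cong (subsets n) (λ B → cong ⟦_⟧ (cong₂ _∧_ (sc B) (∁-⊂ᵇ A B))))

suc-sub : ∀ {n} (𝓖 : Family n) A → 𝓖 A ≡ true → suc (sub 𝓖 A) ≤ size (λ B → 𝓖 B ∧ B ⊆ᵇ A)
suc-sub {n} 𝓖 A 𝓖A = begin
  suc (sub 𝓖 A)  ≡⟨ cong (_+ sub 𝓖 A) (sym (size-single A)) ⟩
  size (_≡ᵇˢ A) + sub 𝓖 A  ≡⟨ sym (∑-+ (subsets n) _ _) ⟩
  ∑ (subsets n) (λ B → ⟦ B ≡ᵇˢ A ⟧ + ⟦ 𝓖 B ∧ B ⊂ᵇ A ⟧)      ≤⟨ ∑-mono (subsets n) split ⟩
  size (λ B → 𝓖 B ∧ B ⊆ᵇ A) ∎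
  where
  open ≤-Reasoning
  split : ∀ B → ⟦ B ≡ᵇˢ A ⟧ + ⟦ 𝓖 B ∧ B ⊂ᵇ A ⟧ ≤ ⟦ 𝓖 B ∧ B ⊆ᵇ A ⟧
  split B with B ≡ᵇˢ A in eq
  ... | true rewrite ≡ᵇˢ-to B A eq | 𝓖A | ⊂ᵇ-irrefl A | ⊆ᵇ-refl A = ≤-refl
  ... | false = ⟦⟧-mono (λ p → ∧-intro (∧-elimˡ {𝓖 B} p) (∧-elimˡ {B ⊆ᵇ A} (∧-elimʳ {𝓖 B} p)))

⊆∧⊆∁⇒card≡0 : ∀ {n} (A B : Subset n) → B ⊆ᵇ A ≡ true → B ⊆ᵇ ∁ A ≡ true → card B ≡ 0
⊆∧⊆∁⇒card≡0 []          []          _ _ = refl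
⊆∧⊆∁⇒card≡0 (true ∷ A)  (false ∷ B) p q = ⊆∧⊆∁⇒card≡0 A B p q
⊆∧⊆∁⇒card≡0 (false ∷ A) (false ∷ B) p q = ⊆∧⊆∁⇒card≡0 A B p q

innerCore-nonempty : ∀ {n} (𝓕 : Family n) B → innerCore 𝓕 B ≡ true → 0 < card B
innerCore-nonempty 𝓕 B p = <ᵇ-to (∧-elimˡ (∧-elimʳ {core 𝓕 B} p))

-- `A` and its proper subsets in 𝓖 lie inside `A`; `∁ A` and the complements of the proper supersets
-- lie inside `∁ A`. The sets `A` and `∁ A` themselves supply the `suc` on either side, and a common
-- member would be empty.
innerCore-degrees : ∀ {n s t} (𝓕 : Family n) → NoSplit s t 𝓕 → ∀ A → innerCore 𝓕 A ≡ true →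
  s ≤ suc (sub (innerCore 𝓕) A) → t ≤ suc (sup (innerCore 𝓕) A) → Falsum
innerCore-degrees {n} {s} {t} 𝓕 ns A 𝓖A s≤ t≤ = ns A
  (λ B → 𝓖 B ∧ B ⊆ᵇ A) (λ B → 𝓖 B ∧ B ⊆ᵇ ∁ A)
  (λ B p → ∧-elimˡ {𝓕 B} (∧-elimˡ {core 𝓕 B} (∧-elimˡ {𝓖 B} p)) , ∧-elimʳ {𝓖 B} p)
  (λ B p → ∧-elimˡ {𝓕 B} (∧-elimˡ {core 𝓕 B} (∧-elimˡ {𝓖 B} p)) , ∧-elimʳ {𝓖 B} p)
  (λ B p q → <-irrefl (sym (⊆∧⊆∁⇒card≡0 A B (∧-elimʳ {𝓖 B} p) (∧-elimʳ {𝓖 B} q)))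
                      (innerCore-nonempty 𝓕 B (∧-elimˡ {𝓖 B} p)))
  (≤-trans s≤ (suc-sub 𝓖 A 𝓖A))
  (≤-trans t≤ (≤-trans (≤-reflexive (cong suc (sym (sub-∁ 𝓖 sc A)))) (suc-sub 𝓖 (∁ A) (trans (sc A) 𝓖A))))
  where
  𝓖 = innerCore 𝓕
  sc = innerCore-selfComplementary 𝓕

⊆ᵇ∁⊥ : ∀ {n} (A : Subset n) → A ⊆ᵇ ∁ ⊥ ≡ true
⊆ᵇ∁⊥ []          = refl
⊆ᵇ∁⊥ (true ∷ A)  = ⊆ᵇ∁⊥ A
⊆ᵇ∁⊥ (false ∷ A) = ⊆ᵇ∁⊥ A

-- Take `A` empty: ∅ alone is one side of the split and everything else lies in `∁ ⊥`, so fewer than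
-- `t` other members remain.
size-with-∅ : ∀ {n t} (𝓕 : Family n) → NoSplit 1 t 𝓕 → 𝓕 ⊥ ≡ true → size 𝓕 ≤ t
size-with-∅ {n} {t} 𝓕 ns 𝓕⊥ = ≤-trans (≤-reflexive (trans (size-without 𝓕 ⊥) (cong (λ b → ⟦ b ⟧ + size (𝓕 without ⊥)) 𝓕⊥)))
  (≰⇒> λ t≤ → ns ⊥ (_≡ᵇˢ ⊥) (𝓕 without ⊥)
    (λ B p → only⊥ B (≡ᵇˢ-to B ⊥ p))
    (λ B p → ∧-elimˡ {𝓕 B} p , ⊆ᵇ∁⊥ B)
    (λ B p q → without-≢ 𝓕 ⊥ B q (≡ᵇˢ-to B ⊥ p))
    (≤-reflexive (sym (size-single (⊥ {n})))) t≤)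
  where
  only⊥ : ∀ B → B ≡ ⊥ → 𝓕 B ≡ true × B ⊆ᵇ ⊥ ≡ true
  only⊥ B refl = 𝓕⊥ , ⊆ᵇ-refl (⊥ {n})

-- A LYM inequality with comparable pairs

fins : ∀ n → List (Fin n)
fins zero    = []
fins (suc n) = zero ∷ map suc (fins n)

length-fins : ∀ n → length (fins n) ≡ n
length-fins zero    = refl
length-fins (suc n) = cong suc (trans (Data.List.Properties.length-map suc (fins n)) (length-fins n))

co : ∀ {n} → Subset n → ℕ
co A = card (∁ A)

-- Both sides count the pairs of a set `B` and an element `x` outside it. This drives the induction
-- over the coatom of a maximal chain.
∑-insertAt : ∀ n (g : Subset (suc n) → ℕ) →
  ∑ (fins (suc n)) (λ x → ∑ (subsets n) (λ B → g (insertAt B x false))) ≡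
  ∑ (subsets (suc n)) (λ B → co B * g B)
∑-insertAt zero    g = base (g (false ∷ []))
  where
  base : ∀ x → x + 0 + 0 ≡ x + 0 + 0
  base x = refl
∑-insertAt (suc n) g = begin
  Σ₀ + ∑ (map suc (fins (suc n))) (λ x → ∑ (subsets (suc n)) (λ B → g (insertAt B x false)))
    ≡⟨ cong (Σ₀ +_) (∑-map suc (fins (suc n)) _) ⟩
  Σ₀ + ∑ (fins (suc n)) (λ y → ∑ (subsets (suc n)) (λ B → g (insertAt B (suc y) false)))
    ≡⟨ cong (Σ₀ +_) (∑-cong (fins (suc n)) (λ y → ∑-subsets-suc (λ B → g (insertAt B (suc y) false)))) ⟩
  Σ₀ + ∑ (fins (suc n)) (λ y → ∑ (subsets n) (λ B → g (true ∷ insertAt B y false))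
                             + ∑ (subsets n) (λ B → g (false ∷ insertAt B y false)))
    ≡⟨ cong (Σ₀ +_) (∑-+ (fins (suc n)) (λ y → ∑ (subsets n) (λ B → g (true ∷ insertAt B y false)))
                                         (λ y → ∑ (subsets n) (λ B → g (false ∷ insertAt B y false)))) ⟩
  Σ₀ + (∑ (fins (suc n)) (λ y → ∑ (subsets n) (λ B → g (true ∷ insertAt B y false)))
      + ∑ (fins (suc n)) (λ y → ∑ (subsets n) (λ B → g (false ∷ insertAt B y false))))
    ≡⟨ cong (Σ₀ +_) (cong₂ _+_ (∑-insertAt n (λ B → g (true ∷ B))) (∑-insertAt n (λ B → g (false ∷ B)))) ⟩
  Σ₀ + (Σ₁ + Σ₂)
    ≡⟨ rearrange Σ₀ Σ₁ Σ₂ ⟩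
  Σ₁ + (Σ₀ + Σ₂)
    ≡⟨ cong (Σ₁ +_) (sym (∑-+ (subsets (suc n)) (λ B → g (false ∷ B)) (λ B → co B * g (false ∷ B)))) ⟩
  Σ₁ + ∑ (subsets (suc n)) (λ B → suc (co B) * g (false ∷ B))
    ≡⟨ sym (∑-subsets-suc (λ B → co B * g B)) ⟩
  ∑ (subsets (suc (suc n))) (λ B → co B * g B) ∎
  where
  open ≡-Reasoning
  Σ₀ = ∑ (subsets (suc n)) (λ B → g (false ∷ B))
  Σ₁ = ∑ (subsets (suc n)) (λ B → co B * g (true ∷ B))
  Σ₂ = ∑ (subsets (suc n)) (λ B → co B * g (false ∷ B))
  rearrange : ∀ a b c → a + (b + c) ≡ b + (a + c)
  rearrange = solve-∀

card-insertAt : ∀ {n} (B : Subset n) x → card (insertAt B x false) ≡ card B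
card-insertAt B           zero    = refl
card-insertAt (true ∷ B)  (suc x) = cong suc (card-insertAt B x)
card-insertAt (false ∷ B) (suc x) = card-insertAt B x

co-insertAt : ∀ {n} (B : Subset n) x → co (insertAt B x false) ≡ suc (co B)
co-insertAt B           zero    = refl
co-insertAt (true ∷ B)  (suc x) = co-insertAt B x
co-insertAt (false ∷ B) (suc x) = cong suc (co-insertAt B x)

⊆ᵇ-insertAt : ∀ {n} (A B : Subset n) x → insertAt A x false ⊆ᵇ insertAt B x false ≡ A ⊆ᵇ B
⊆ᵇ-insertAt A       B       zero    = refl
⊆ᵇ-insertAt (a ∷ A) (b ∷ B) (suc x) = cong ((not a ∨ b) ∧_) (⊆ᵇ-insertAt A B x)

⊂ᵇ-insertAt : ∀ {n} (A B : Subset n) x → insertAt A x false ⊂ᵇ insertAt B x false ≡ A ⊂ᵇ B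
⊂ᵇ-insertAt A B x rewrite ⊆ᵇ-insertAt A B x | card-insertAt A x | card-insertAt B x = refl

∑-insertAt-≤ : ∀ {n} x (g : Subset (suc n) → ℕ) →
  ∑ (subsets n) (λ B → g (insertAt B x false)) ≤ ∑ (subsets (suc n)) g
∑-insertAt-≤ zero g rewrite ∑-subsets-suc g = m≤n+m _ _
∑-insertAt-≤ {suc n} (suc x) g
  rewrite ∑-subsets-suc g | ∑-subsets-suc (λ B → g (insertAt B (suc x) false)) =
  +-mono-≤ (∑-insertAt-≤ x (λ B → g (true ∷ B))) (∑-insertAt-≤ x (λ B → g (false ∷ B)))

∑-term-≤ : ∀ {n} (B : Subset n) (g : Subset n → ℕ) → g B ≤ ∑ (subsets n) g
∑-term-≤ {n} B g = ≤-trans (≤-reflexive (sym (∑-single B g)))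
  (∑-mono (subsets n) (λ A → ≤-trans (*-monoˡ-≤ (g A) (⟦⟧≤1 (A ≡ᵇˢ B))) (≤-reflexive (*-identityˡ (g A)))))

-- `card A ! * (card B ∸ card A) !` is the number of maximal chains from ∅ to `B` through `A`. After
-- multiplication by `co B !` a summand counts the maximal chains of the whole cube through both
-- sets.
below : ∀ {n} → Family n → Subset n → ℕ
below {n} 𝓖 B = ∑ (subsets n) (λ A → ⟦ 𝓖 A ∧ A ⊂ᵇ B ⟧ * (card A ! * (card B ∸ card A) !))

below-insertAt : ∀ {n} (𝓖 : Family (suc n)) x B →
  below (λ A → 𝓖 (insertAt A x false)) B ≤ below 𝓖 (insertAt B x false)
below-insertAt {n} 𝓖 x B = ≤-trans
  (≤-reflexive (∑-cong (subsets n) (λ A → cong₂ _*_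
    (cong (λ b → ⟦ 𝓖 (insertAt A x false) ∧ b ⟧) (sym (⊂ᵇ-insertAt A B x)))
    (sym (cong₂ (λ a b → a ! * (b ∸ a) !) (card-insertAt A x) (card-insertAt B x))))))
  (∑-insertAt-≤ x (λ A → ⟦ 𝓖 A ∧ A ⊂ᵇ insertAt B x false ⟧ * (card A ! * (card (insertAt B x false) ∸ card A) !)))

co≡0⇒≡⊤ : ∀ {n} (B : Subset n) → co B ≡ 0 → B ≡ ⊤
co≡0⇒≡⊤ []         _  = refl
co≡0⇒≡⊤ (true ∷ B) eq = cong (true ∷_) (co≡0⇒≡⊤ B eq)

⊆ᵇ⊤ : ∀ {n} (B : Subset n) → B ⊆ᵇ ⊤ ≡ true
⊆ᵇ⊤ B = ⊆ᵇ-from {A = B} {⊤} Subₚ.⊆⊤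

-- On a random maximal chain, the number of members of 𝓖 exceeds the number of pairs of members by at
-- most 1; multiplied by n ! the expectations become the two sums.
chain-bound : ∀ n (𝓖 : Family n) →
  ∑ (subsets n) (λ B → ⟦ 𝓖 B ⟧ * (co B ! * card B !)) ≤
  n ! + ∑ (subsets n) (λ B → ⟦ 𝓖 B ⟧ * (co B ! * below 𝓖 B))
chain-bound zero 𝓖 = ≤-trans (≤-reflexive (trans (+-identityʳ _) (*-identityʳ ⟦ 𝓖 [] ⟧)))
  (≤-trans (⟦⟧≤1 (𝓖 [])) (m≤m+n 1 _))
chain-bound (suc n) 𝓖 with 𝓖 ⊤ in 𝓖⊤
-- If the full set is a member, its pairs with the other members already balance all members but
-- itself.
... | true = begin
  ∑ (subsets (suc n)) (λ B → ⟦ 𝓖 B ⟧ * (co B ! * card B !))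
    ≤⟨ ∑-mono (subsets (suc n)) split ⟩
  ∑ (subsets (suc n)) (λ B → ⟦ B ≡ᵇˢ ⊤ ⟧ * suc n ! + ⟦ 𝓖 B ∧ B ⊂ᵇ ⊤ ⟧ * (card B ! * (card (⊤ {suc n}) ∸ card B) !))
    ≡⟨ ∑-+ (subsets (suc n)) _ _ ⟩
  ∑ (subsets (suc n)) (λ B → ⟦ B ≡ᵇˢ ⊤ ⟧ * suc n !) + below 𝓖 ⊤
    ≡⟨ cong (_+ below 𝓖 ⊤) (∑-single (⊤ {suc n}) (λ _ → suc n !)) ⟩
  suc n ! + below 𝓖 ⊤
    ≤⟨ +-monoʳ-≤ (suc n !) (≤-trans (≤-reflexive top) (∑-term-≤ ⊤ (λ B → ⟦ 𝓖 B ⟧ * (co B ! * below 𝓖 B)))) ⟩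
  suc n ! + ∑ (subsets (suc n)) (λ B → ⟦ 𝓖 B ⟧ * (co B ! * below 𝓖 B)) ∎
  where
  open ≤-Reasoning
  co-⊤ : ∀ n → co (⊤ {n}) ≡ 0
  co-⊤ zero    = refl
  co-⊤ (suc n) = co-⊤ n
  top : below 𝓖 ⊤ ≡ ⟦ 𝓖 ⊤ ⟧ * (co (⊤ {suc n}) ! * below 𝓖 ⊤)
  top rewrite 𝓖⊤ | co-⊤ n = sym (trans (+-identityʳ _) (+-identityʳ _))
  split : ∀ B → ⟦ 𝓖 B ⟧ * (co B ! * card B !) ≤
    ⟦ B ≡ᵇˢ ⊤ ⟧ * suc n ! + ⟦ 𝓖 B ∧ B ⊂ᵇ ⊤ ⟧ * (card B ! * (card (⊤ {suc n}) ∸ card B) !)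
  split B with co B in eq
  ... | zero rewrite co≡0⇒≡⊤ B eq | 𝓖⊤ | ≡ᵇˢ-refl (⊤ {n}) | Subₚ.∣⊤∣≡n n
                   | +-identityʳ (suc n !) | +-identityʳ (suc n !) = m≤m+n (suc n !) _
  ... | suc c = ≤-trans (≤-reflexive (cong₂ _*_ (cong ⟦_⟧ inside) (trans (*-comm (suc c !) (card B !)) (cong (λ k → card B ! * k !) gap))))
                        (m≤n+m _ _)
    where
    lt : card B < card (⊤ {suc n})
    lt = subst (card B <_) (trans (card-∁ B) (sym (Subₚ.∣⊤∣≡n (suc n))))
           (subst (λ k → card B < card B + k) (sym eq) (m<m+n (card B) (s≤s z≤n)))
    inside : 𝓖 B ≡ 𝓖 B ∧ B ⊂ᵇ ⊤
    inside rewrite ⊆ᵇ⊤ B | <ᵇ-from lt = sym (Data.Bool.Properties.∧-identityʳ (𝓖 B))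
    gap : suc c ≡ card (⊤ {suc n}) ∸ card B
    gap = trans (sym eq) (trans (sym (m+n∸m≡n (card B) (co B)))
            (cong (_∸ card B) (trans (card-∁ B) (sym (Subₚ.∣⊤∣≡n (suc n))))))
-- Otherwise each maximal chain runs through one coatom, the complement of some `x`, and the
-- induction hypothesis for that coatom is summed over `x`. Inside it a set has one missing element
-- fewer, hence `co B ∸ 1`.
... | false = begin
  ∑ (subsets (suc n)) (λ B → ⟦ 𝓖 B ⟧ * (co B ! * card B !))
    ≤⟨ ∑-mono (subsets (suc n)) unroll ⟩
  ∑ (subsets (suc n)) (λ B → co B * g B)
    ≡⟨ sym (∑-insertAt n g) ⟩
  ∑ (fins (suc n)) (λ x → ∑ (subsets n) (λ B → g (insertAt B x false)))
    ≤⟨ ∑-mono (fins (suc n)) step ⟩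
  ∑ (fins (suc n)) (λ x → n ! + ∑ (subsets n) (λ B → h (insertAt B x false)))
    ≡⟨ ∑-+ (fins (suc n)) (λ _ → n !) (λ x → ∑ (subsets n) (λ B → h (insertAt B x false))) ⟩
  ∑ (fins (suc n)) (λ _ → n !) + ∑ (fins (suc n)) (λ x → ∑ (subsets n) (λ B → h (insertAt B x false)))
    ≡⟨ cong₂ _+_ (trans (∑-const (fins (suc n)) (n !)) (cong (_* n !) (length-fins (suc n)))) (∑-insertAt n h) ⟩
  suc n ! + ∑ (subsets (suc n)) (λ B → co B * h B)
    ≤⟨ +-monoʳ-≤ (suc n !) (∑-mono (subsets (suc n)) reroll) ⟩
  suc n ! + ∑ (subsets (suc n)) (λ B → ⟦ 𝓖 B ⟧ * (co B ! * below 𝓖 B)) ∎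
  where
  open ≤-Reasoning
  g h : Subset (suc n) → ℕ
  g B = ⟦ 𝓖 B ⟧ * ((co B ∸ 1) ! * card B !)
  h B = ⟦ 𝓖 B ⟧ * ((co B ∸ 1) ! * below 𝓖 B)
  pull : ∀ c b p q → b * ((p + c * p) * q) ≡ (1 + c) * (b * (p * q))
  pull = solve-∀
  unroll : ∀ B → ⟦ 𝓖 B ⟧ * (co B ! * card B !) ≤ co B * g B
  unroll B with co B in eq
  ... | zero rewrite co≡0⇒≡⊤ B eq | 𝓖⊤ = z≤n
  ... | suc c = ≤-reflexive (pull c ⟦ 𝓖 B ⟧ (c !) (card B !))
  reroll : ∀ B → co B * h B ≤ ⟦ 𝓖 B ⟧ * (co B ! * below 𝓖 B)
  reroll B with co B
  ... | zero  = z≤n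
  ... | suc c = ≤-reflexive (sym (pull c ⟦ 𝓖 B ⟧ (c !) (below 𝓖 B)))
  step : ∀ x → ∑ (subsets n) (λ B → g (insertAt B x false)) ≤ n ! + ∑ (subsets n) (λ B → h (insertAt B x false))
  step x = begin
    ∑ (subsets n) (λ B → g (insertAt B x false))
      ≡⟨ ∑-cong (subsets n) (λ B → cong (⟦ 𝓖 (insertAt B x false) ⟧ *_)
           (cong₂ (λ a b → (a ∸ 1) ! * b !) (co-insertAt B x) (card-insertAt B x))) ⟩
    ∑ (subsets n) (λ B → ⟦ 𝓖 (insertAt B x false) ⟧ * (co B ! * card B !))
      ≤⟨ chain-bound n (λ B → 𝓖 (insertAt B x false)) ⟩
    n ! + ∑ (subsets n) (λ B → ⟦ 𝓖 (insertAt B x false) ⟧ * (co B ! * below (λ A → 𝓖 (insertAt A x false)) B))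
      ≤⟨ +-monoʳ-≤ (n !) (∑-mono (subsets n) (λ B → *-monoʳ-≤ ⟦ 𝓖 (insertAt B x false) ⟧
           (*-mono-≤ (≤-reflexive (cong (λ a → (a ∸ 1) !) (sym (co-insertAt B x)))) (below-insertAt 𝓖 x B)))) ⟩
    n ! + ∑ (subsets n) (λ B → h (insertAt B x false)) ∎

-- Factorial weights and the middle level

!-merge : ∀ p q → suc p ! * suc q ! ≤ suc (p + q) !
!-merge p zero    = ≤-reflexive (trans (*-identityʳ (suc p !)) (cong (λ k → suc k !) (sym (+-identityʳ p))))
!-merge p (suc q) = begin
  suc p ! * ((2 + q) * suc q !)     ≡⟨ rearrange (suc p !) (2 + q) (suc q !) ⟩
  (2 + q) * (suc p ! * suc q !)     ≤⟨ *-mono-≤ (s≤s (s≤s (m≤n+m q p))) (!-merge p q) ⟩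
  (2 + (p + q)) * suc (p + q) !     ≡⟨ cong (λ k → suc k !) (sym (+-suc p q)) ⟩
  suc (p + suc q) ! ∎
  where
  open ≤-Reasoning
  rearrange : ∀ a b c → a * (b * c) ≡ b * (a * c)
  rearrange = solve-∀

-- For positive `p` and `q` with a given sum the product peaks when one of them is 1. So among the
-- `b !` maximal chains below a set of size `b`, at most `(b ∸ 1) !` pass through a given nonempty
-- proper subset.
!-merge′ : ∀ {p q} → 0 < p → 0 < q → p ! * q ! ≤ (p + q ∸ 1) !
!-merge′ {suc p} {suc q} _ _ = ≤-trans (!-merge p q) (≤-reflexive (cong _! (sym (+-suc p q))))

!≡pred : ∀ {b} → 0 < b → b ! ≡ b * (b ∸ 1) !
!≡pred {suc b} _ = refl

-- n ! times the weight of a set of size b and cosize c in the fork version of the LYM inequality.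
weight : ℕ → ℕ → ℕ → ℕ
weight r c b = c ! * ((b ∸ 1) ! * (b ∸ r))

module _ (r : ℕ) where
  private
    up-factor : ∀ c b → c ≤ suc b → c * (b ∸ r) ≤ b * (suc b ∸ r)
    up-factor c b c≤ with ≤-total r b
    ... | inj₂ ge rewrite m≤n⇒m∸n≡0 ge | *-zeroʳ c = z≤n
    ... | inj₁ le with m≤n⇒∃[o]m+o≡n le
    ...   | d , refl rewrite m+n∸m≡n r d | sym (+-suc r d) | m+n∸m≡n r (suc d) = begin
      c * d  ≤⟨ *-monoˡ-≤ d c≤ ⟩
      (r + suc d) * d              ≡⟨ expand r d ⟩
      (r * d + d * d + d)          ≤⟨ m≤m+n _ r ⟩
      (r * d + d * d + d) + r      ≡⟨ collect r d ⟩
      (r + d) * suc d ∎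
      where
      open ≤-Reasoning
      expand : ∀ r d → (r + (1 + d)) * d ≡ r * d + d * d + d
      expand = solve-∀
      collect : ∀ r d → (r * d + d * d + d) + r ≡ (r + d) * (1 + d)
      collect = solve-∀

    -- At the extreme `c = b + 2`, with `d = b − r`, the two sides differ as `r` and `d` do. This is
    -- where the restriction to sets of size at least `2 * r` originates.
    down-factor : ∀ c b → 2 * r ≤ b → suc (suc b) ≤ c → b * (suc b ∸ r) ≤ c * (b ∸ r)
    down-factor c b 2r≤ c≥ with m≤n⇒∃[o]m+o≡n (≤-trans (m≤m+n r (r + 0)) 2r≤)
    ... | d , refl rewrite m+n∸m≡n r d | sym (+-suc r d) | m+n∸m≡n r (suc d) = begin
      (r + d) * suc d  ≡⟨ sym (collect r d) ⟩
      (r * d + d * d + d) + r          ≤⟨ +-monoʳ-≤ (r * d + d * d + d) r≤d ⟩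
      (r * d + d * d + d) + d          ≡⟨ expand r d ⟩
      (2 + (r + d)) * d  ≤⟨ *-monoˡ-≤ d (≤-trans (≤-reflexive (cong suc (sym (+-suc r d)))) c≥) ⟩
      c * d ∎
      where
      open ≤-Reasoning
      r≤d : r ≤ d
      r≤d = +-cancelˡ-≤ r r d (subst (_≤ r + d) (cong (r +_) (+-identityʳ r)) 2r≤)
      expand : ∀ r d → (r * d + d * d + d) + d ≡ (2 + (r + d)) * d
      expand = solve-∀
      collect : ∀ r d → (r * d + d * d + d) + r ≡ (r + d) * (1 + d)
      collect = solve-∀

    lhs-form : ∀ c f p x → (f + c * f) * (p * x) ≡ f * (p * ((1 + c) * x))
    lhs-form = solve-∀
    rhs-form : ∀ f p b x → f * (p * (b * x)) ≡ f * ((b * p) * x)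
    rhs-form = solve-∀

    up : ∀ c b → 0 < b → suc c ≤ suc b → weight r (suc c) b ≤ weight r c (suc b)
    up c b@(suc b′) _ le = begin
      weight r (suc c) b  ≡⟨ lhs-form c (c !) (b′ !) (b ∸ r) ⟩
      c ! * (b′ ! * (suc c * (b ∸ r)))      ≤⟨ *-monoʳ-≤ (c !) (*-monoʳ-≤ (b′ !) (up-factor (suc c) b le)) ⟩
      c ! * (b′ ! * (b * (suc b ∸ r)))      ≡⟨ rhs-form (c !) (b′ !) b (suc b ∸ r) ⟩
      weight r c (suc b) ∎
      where open ≤-Reasoning

    down : ∀ c b → 0 < b → 2 * r ≤ b → suc (suc b) ≤ suc c → weight r c (suc b) ≤ weight r (suc c) b
    down c b@(suc b′) _ 2r≤ le = begin
      weight r c (suc b)  ≡⟨ sym (rhs-form (c !) (b′ !) b (suc b ∸ r)) ⟩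
      c ! * (b′ ! * (b * (suc b ∸ r)))      ≤⟨ *-monoʳ-≤ (c !) (*-monoʳ-≤ (b′ !) (down-factor (suc c) b 2r≤ le)) ⟩
      c ! * (b′ ! * (suc c * (b ∸ r)))      ≡⟨ sym (lhs-form c (c !) (b′ !) (b ∸ r)) ⟩
      weight r (suc c) b ∎
      where open ≤-Reasoning

  weight-up : ∀ c h j → 0 < h → c + j ≤ suc h → weight r (c + j) h ≤ weight r c (h + j)
  weight-up c h zero    _ _ rewrite +-identityʳ c | +-identityʳ h = ≤-refl
  weight-up c h (suc j) 0<h le rewrite +-suc c j | +-suc h j = ≤-trans
    (weight-up (suc c) h j 0<h le)
    (up c (h + j) (≤-trans 0<h (m≤m+n h j))
      (≤-trans (m≤m+n (suc c) j) (≤-trans le (s≤s (m≤m+n h j)))))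

  weight-down : ∀ c b j → 0 < b → 2 * r ≤ b → b + j ≤ c → weight r c (b + j) ≤ weight r (c + j) b
  weight-down c b zero    _ _ _ rewrite +-identityʳ c | +-identityʳ b = ≤-refl
  weight-down c b (suc j) 0<b 2r≤ le rewrite +-suc c j | +-suc b j = ≤-trans
    (down c (b + j) (≤-trans 0<b (m≤m+n b j)) (≤-trans 2r≤ (m≤m+n b j)) (s≤s le))
    (weight-down (suc c) b j 0<b 2r≤ (≤-trans (n≤1+n (b + j)) (≤-trans le (n≤1+n c))))

  -- From size `2 * r` on, the weights fall until level `h` and rise after it. In odd dimension `h`
  -- is the lower of the two middle levels, whose weight is no greater than that of the upper one.
  weight-min : ∀ h c₀ b c → 0 < h → h ≤ c₀ → c₀ ≤ suc h → 0 < b → 2 * r ≤ b → b + c ≡ h + c₀ →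
               weight r c₀ h ≤ weight r c b
  weight-min h c₀ b c 0<h h≤ c₀≤ 0<b 2r≤ eq with ≤-total h b
  ... | inj₁ h≤b with m≤n⇒∃[o]m+o≡n h≤b
  ...   | j , refl with +-cancelˡ-≡ h (j + c) c₀ (trans (sym (+-assoc h j c)) eq)
  ...     | refl rewrite +-comm j c = weight-up c h j 0<h c₀≤
  weight-min h c₀ b c 0<h h≤ c₀≤ 0<b 2r≤ eq | inj₂ b≤h with m≤n⇒∃[o]m+o≡n b≤h
  ...   | j , refl with +-cancelˡ-≡ b c (j + c₀) (trans eq (+-assoc b j c₀))
  ...     | refl rewrite +-comm j c₀ = weight-down c₀ b j 0<b 2r≤ h≤

nCk*k!*c! : ∀ h c → ((h + c) C h) * (h ! * c !) ≡ (h + c) !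
nCk*k!*c! h c = begin
  ((h + c) C h) * (h ! * c !)
    ≡⟨ cong₂ (λ x y → x * (h ! * y !)) (nCk≡n!/k![n-k]! h≤) (sym (m+n∸m≡n h c)) ⟩
  ((h + c) ! / (h ! * (h + c ∸ h) !)) * (h ! * (h + c ∸ h) !)
    ≡⟨ m/n*n≡m (k![n∸k]!∣n! h≤) ⟩
  (h + c) ! ∎
  where
  open ≡-Reasoning
  h≤ : h ≤ h + c
  h≤ = m≤m+n h c
  instance _ = h !* (h + c ∸ h) !≢0

below-≤ : ∀ {n} (𝓖 : Family n) r B → (∀ A → 𝓖 A ≡ true → 0 < card A) → sub 𝓖 B ≤ r →
          below 𝓖 B ≤ r * (card B ∸ 1) !
below-≤ {n} 𝓖 r B nonempty sub≤ = begin
  below 𝓖 B  ≤⟨ ∑-mono (subsets n) term ⟩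
  ∑ (subsets n) (λ A → ⟦ 𝓖 A ∧ A ⊂ᵇ B ⟧ * (card B ∸ 1) !)          ≡⟨ ∑-*ʳ (subsets n) ((card B ∸ 1) !) _ ⟩
  sub 𝓖 B * (card B ∸ 1) !  ≤⟨ *-monoˡ-≤ ((card B ∸ 1) !) sub≤ ⟩
  r * (card B ∸ 1) ! ∎
  where
  open ≤-Reasoning
  term : ∀ A → ⟦ 𝓖 A ∧ A ⊂ᵇ B ⟧ * (card A ! * (card B ∸ card A) !) ≤ ⟦ 𝓖 A ∧ A ⊂ᵇ B ⟧ * (card B ∸ 1) !
  term A = ⟦⟧-*-mono (𝓖 A ∧ A ⊂ᵇ B) λ p → let lt = ⊂ᵇ⇒card< A B (∧-elimʳ {𝓖 A} p) in
    ≤-trans (!-merge′ (nonempty A (∧-elimˡ {𝓖 A} p)) (m<n⇒0<n∸m lt))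
            (≤-reflexive (cong (λ k → (k ∸ 1) !) (m+[n∸m]≡n (<⇒≤ lt))))

-- The upper bound of De Bonis and Katona for families without an (r+1)-fork.
fork-bound : ∀ h c r (𝓖 : Family (h + c)) → 0 < h → h ≤ c → c ≤ suc h →
  (∀ A → 𝓖 A ≡ true → 0 < card A × 2 * r ≤ card A × sub 𝓖 A ≤ r) →
  size 𝓖 * (h ∸ r) ≤ h * ((h + c) C h)
fork-bound h c r 𝓖 0<h h≤c c≤ hyp = *-cancelʳ-≤ _ _ ((h ∸ 1) ! * c !) {{(h ∸ 1) !* c !≢0}} (begin
  size 𝓖 * (h ∸ r) * ((h ∸ 1) ! * c !)     ≡⟨ form₁ (size 𝓖) (h ∸ r) ((h ∸ 1) !) (c !) ⟩
  size 𝓖 * weight r c h  ≡⟨ sym (∑-*ʳ (subsets n) (weight r c h) _) ⟩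
  ∑ (subsets n) (λ B → ⟦ 𝓖 B ⟧ * weight r c h)
    ≤⟨ ∑-mono (subsets n) (λ B → ⟦⟧-*-mono (𝓖 B) (λ p → let pos , large , _ = hyp B p in
         weight-min r h c (card B) (co B) 0<h h≤c c≤ pos large (card-∁ B))) ⟩
  ∑ (subsets n) (λ B → ⟦ 𝓖 B ⟧ * weight r (co B) (card B))
    ≤⟨ +-cancelʳ-≤ Σfork _ _ total ⟩
  n !  ≡⟨ sym (nCk*k!*c! h c) ⟩
  (n C h) * (h ! * c !)  ≡⟨ cong (λ k → (n C h) * (k * c !)) (!≡pred 0<h) ⟩
  (n C h) * (h * (h ∸ 1) ! * c !)            ≡⟨ form₂ (n C h) h ((h ∸ 1) !) (c !) ⟩
  h * (n C h) * ((h ∸ 1) ! * c !) ∎)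
  where
  open ≤-Reasoning
  n = h + c
  Σfork = ∑ (subsets n) (λ B → ⟦ 𝓖 B ⟧ * (co B ! * (r * (card B ∸ 1) !)))
  form₁ : ∀ s d f g → s * d * (f * g) ≡ s * (g * (f * d))
  form₁ = solve-∀
  form₂ : ∀ x h f g → x * (h * f * g) ≡ h * x * (f * g)
  form₂ = solve-∀
  split : ∀ B → 0 < card B → 2 * r ≤ card B →
    weight r (co B) (card B) + co B ! * (r * (card B ∸ 1) !) ≡ co B ! * card B !
  split B pos large = trans (form₃ (co B !) ((card B ∸ 1) !) (card B ∸ r) r)
    (cong (co B ! *_) (trans (cong (_* (card B ∸ 1) !) (m∸n+n≡m (≤-trans (m≤m+n r (r + 0)) large))) (sym (!≡pred pos))))
    where
    form₃ : ∀ c p d r → c * (p * d) + c * (r * p) ≡ c * ((d + r) * p)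
    form₃ = solve-∀
  total : ∑ (subsets n) (λ B → ⟦ 𝓖 B ⟧ * weight r (co B) (card B)) + Σfork ≤ n ! + Σfork
  total = begin
    ∑ (subsets n) (λ B → ⟦ 𝓖 B ⟧ * weight r (co B) (card B)) + Σfork
      ≡⟨ sym (∑-+ (subsets n) _ _) ⟩
    ∑ (subsets n) (λ B → ⟦ 𝓖 B ⟧ * weight r (co B) (card B) + ⟦ 𝓖 B ⟧ * (co B ! * (r * (card B ∸ 1) !)))
      ≤⟨ ∑-mono (subsets n) (λ B → ≤-trans (≤-reflexive (sym (*-distribˡ-+ ⟦ 𝓖 B ⟧ _ _)))
           (⟦⟧-*-mono (𝓖 B) (λ p → let pos , large , _ = hyp B p in ≤-reflexive (split B pos large)))) ⟩
    ∑ (subsets n) (λ B → ⟦ 𝓖 B ⟧ * (co B ! * card B !))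
      ≤⟨ chain-bound n 𝓖 ⟩
    n ! + ∑ (subsets n) (λ B → ⟦ 𝓖 B ⟧ * (co B ! * below 𝓖 B))
      ≤⟨ +-monoʳ-≤ (n !) (∑-mono (subsets n) (λ B → ⟦⟧-*-mono (𝓖 B) (λ p → let _ , _ , few = hyp B p in
           *-monoʳ-≤ (co B !) (below-≤ 𝓖 r B (λ A q → proj₁ (hyp A q)) few)))) ⟩
    n ! + Σfork ∎

-- Each comparable pair is charged to its upper member if that lies above the middle level, and to its
-- lower member otherwise; a member then keeps at least the weight of a set in the middle level.
pair-bound : ∀ k (𝓖 : Family (k + k)) → 0 < k →
  (∀ A → 𝓖 A ≡ true → 0 < card A × sub 𝓖 A ≤ 1 × sup 𝓖 A ≤ 1) → size 𝓖 ≤ (k + k) C k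
pair-bound k 𝓖 0<k hyp = *-cancelʳ-≤ _ _ (k ! * k !) {{k !* k !≢0}} (begin
  size 𝓖 * (k ! * k !)  ≡⟨ sym (∑-*ʳ (subsets n) (k ! * k !) _) ⟩
  ∑ (subsets n) (λ B → ⟦ 𝓖 B ⟧ * (k ! * k !))     ≤⟨ +-cancelʳ-≤ Σcharge _ _ total ⟩
  n !  ≡⟨ sym (nCk*k!*c! k k) ⟩
  (n C k) * (k ! * k !) ∎)
  where
  open ≤-Reasoning
  n = k + k
  upper lower : Subset n → ℕ
  upper B = ⟦ k <ᵇ card B ⟧ * (co B ! * (card B ∸ 1) !)
  lower A = ⟦ card A <ᵇ k ⟧ * (card A ! * (co A ∸ 1) !)
  Σcharge = ∑ (subsets n) (λ B → ⟦ 𝓖 B ⟧ * (upper B + lower B))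
  -- What remains of `c ! * b !` after the charge is `weight 1 c b`. At `b = k + 1` it equals
  -- `k ! * k !` exactly, and it grows from there, so a member above the middle can afford exactly
  -- one pair.
  above-middle : ∀ b c → b + c ≡ k + k → k < b → k ! * k ! + c ! * (b ∸ 1) ! ≤ c ! * b !
  above-middle b c eq k<b = begin
    k ! * k ! + c ! * (b ∸ 1) !  ≤⟨ +-monoˡ-≤ _ (middle k 0<k) ⟩
    weight 1 (k ∸ 1) (suc k) + c ! * (b ∸ 1) !  ≤⟨ +-monoˡ-≤ _ climb ⟩
    weight 1 c b + c ! * (b ∸ 1) !              ≡⟨ merge b (≤-trans (s≤s z≤n) k<b) ⟩
    c ! * b ! ∎
    where
    middle : ∀ k → 0 < k → k ! * k ! ≤ weight 1 (k ∸ 1) (suc k)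
    middle (suc k) _ = ≤-reflexive (form (suc k) (k !) (suc k !))
      where
      form : ∀ x f g → (x * f) * g ≡ f * (g * x)
      form = solve-∀
    climb : weight 1 (k ∸ 1) (suc k) ≤ weight 1 c b
    climb with m≤n⇒∃[o]m+o≡n k<b
    ... | j , refl = subst (λ m → weight 1 m (suc k) ≤ weight 1 c (suc k + j)) c+j
            (weight-up 1 c (suc k) j (s≤s z≤n)
              (≤-trans (≤-reflexive c+j) (≤-trans (m∸n≤m k 1) (≤-trans (n≤1+n k) (n≤1+n (suc k))))))
      where
      c+j : c + j ≡ k ∸ 1
      c+j = cong (_∸ 1) (+-cancelˡ-≡ k (suc (c + j)) k
              (trans (+-suc k (c + j)) (trans (cong (λ m → suc (k + m)) (+-comm c j)) (trans (cong suc (sym (+-assoc k j c))) eq))))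
    merge : ∀ b → 0 < b → weight 1 c b + c ! * (b ∸ 1) ! ≡ c ! * b !
    merge (suc b) _ = form (c !) (b !) b
      where
      form : ∀ c f b → c * (f * b) + c * f ≡ c * (f + b * f)
      form = solve-∀
  charged : ∀ B → k ! * k ! + (upper B + lower B) ≤ co B ! * card B !
  charged B with k <ᵇ card B in eq₁ | card B <ᵇ k in eq₂
  ... | true  | true  = absurd (<-asym (<ᵇ-to {k} eq₁) (<ᵇ-to eq₂))
  ... | true  | false = ≤-trans (≤-reflexive (form (k ! * k !) (co B ! * (card B ∸ 1) !)))
                          (above-middle (card B) (co B) (card-∁ B) (<ᵇ-to eq₁))
    where
    form : ∀ x y → x + (y + 0 + 0) ≡ x + y
    form = solve-∀
  ... | false | true  = ≤-trans (≤-reflexive (form (k ! * k !) (card B ! * (co B ∸ 1) !)))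
      (≤-trans (above-middle (co B) (card B) (trans (+-comm (co B) _) (card-∁ B)) k<co)
               (≤-reflexive (*-comm (card B !) (co B !))))
    where
    form : ∀ x y → x + (0 + (y + 0)) ≡ x + y
    form = solve-∀
    k<co : k < co B
    k<co = ≰⇒> λ le → <-irrefl (card-∁ B) (+-mono-<-≤ (<ᵇ-to eq₂) le)
  ... | false | false with ≤-antisym (<ᵇ-false {k} eq₁) (<ᵇ-false {card B} eq₂)
  ...   | b≡k = ≤-reflexive (trans (+-identityʳ _) (cong₂ (λ x y → x ! * y !) (sym co≡k) (sym b≡k)))
    where
    co≡k : co B ≡ k
    co≡k = +-cancelˡ-≡ k (co B) k (trans (cong (_+ co B) (sym b≡k)) (card-∁ B))
  -- The pair lies on `co B ! * (card B ∸ card A) ! * card A !` chains. Merging the middle factor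
  -- with the last bounds this by the charge on `B`, merging it with the first bounds it by the
  -- charge on `A`. If `B` is not above the middle, then `A` is strictly below it.
  shift : ∀ A B → 𝓖 A ≡ true → A ⊂ᵇ B ≡ true → co B ! * (card A ! * (card B ∸ card A) !) ≤ upper B + lower A
  shift A B p lt with k <ᵇ card B in eq
  ... | true = ≤-trans (*-monoʳ-≤ (co B !) (≤-trans (!-merge′ (proj₁ (hyp A p)) (m<n⇒0<n∸m a<b))
                  (≤-reflexive (cong (λ m → (m ∸ 1) !) (m+[n∸m]≡n (<⇒≤ a<b))))))
                  (≤-trans (≤-reflexive (sym (+-identityʳ _))) (m≤m+n _ (lower A)))
    where a<b = ⊂ᵇ⇒card< A B lt
  ... | false rewrite <ᵇ-from (≤-trans (⊂ᵇ⇒card< A B lt) (<ᵇ-false {k} eq)) = begin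
    co B ! * (card A ! * (card B ∸ card A) !)     ≡⟨ swap (co B !) (card A !) _ ⟩
    card A ! * (co B ! * (card B ∸ card A) !)     ≤⟨ *-monoʳ-≤ (card A !) (!-merge′ 0<co (m<n⇒0<n∸m a<b)) ⟩
    card A ! * (co B + (card B ∸ card A) ∸ 1) !   ≡⟨ cong (λ m → card A ! * (m ∸ 1) !) coA ⟩
    card A ! * (co A ∸ 1) !  ≡⟨ sym (+-identityʳ _) ⟩
    card A ! * (co A ∸ 1) ! + 0 ∎
    where
    swap : ∀ x y z → x * (y * z) ≡ y * (x * z)
    swap = solve-∀
    a<b = ⊂ᵇ⇒card< A B lt
    0<co : 0 < co B
    0<co = ≤-trans 0<k (+-cancelˡ-≤ k k (co B)
             (≤-trans (≤-reflexive (sym (card-∁ B))) (+-monoˡ-≤ (co B) (<ᵇ-false {k} eq))))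
    coA : co B + (card B ∸ card A) ≡ co A
    coA = +-cancelˡ-≡ (card A) _ _ (trans (perm (card A) (co B) _)
            (trans (cong (_+ co B) (m+[n∸m]≡n (<⇒≤ a<b))) (trans (card-∁ B) (sym (card-∁ A)))))
      where
      perm : ∀ x y z → x + (y + z) ≡ (x + z) + y
      perm = solve-∀
  Σpairs≤ : ∑ (subsets n) (λ B → ⟦ 𝓖 B ⟧ * (co B ! * below 𝓖 B)) ≤ Σcharge
  Σpairs≤ = begin
    ∑ (subsets n) (λ B → ⟦ 𝓖 B ⟧ * (co B ! * below 𝓖 B))
      ≡⟨ ∑-cong (subsets n) (λ B → sym (trans (∑-*ˡ (subsets n) ⟦ 𝓖 B ⟧ _) (cong (⟦ 𝓖 B ⟧ *_) (∑-*ˡ (subsets n) (co B !) _)))) ⟩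
    ∑ (subsets n) (λ B → ∑ (subsets n) (λ A → ⟦ 𝓖 B ⟧ * (co B ! * (⟦ 𝓖 A ∧ A ⊂ᵇ B ⟧ * (card A ! * (card B ∸ card A) !)))))
      ≤⟨ ∑-mono (subsets n) (λ B → ∑-mono (subsets n) (λ A → term A B)) ⟩
    ∑ (subsets n) (λ B → ∑ (subsets n) (λ A → ⟦ 𝓖 B ⟧ * (⟦ 𝓖 A ∧ A ⊂ᵇ B ⟧ * upper B)
                                             + ⟦ 𝓖 A ⟧ * (⟦ 𝓖 B ∧ A ⊂ᵇ B ⟧ * lower A)))
      ≡⟨ ∑-cong (subsets n) (λ B → ∑-+ (subsets n) _ _) ⟩
    ∑ (subsets n) (λ B → ∑ (subsets n) (λ A → ⟦ 𝓖 B ⟧ * (⟦ 𝓖 A ∧ A ⊂ᵇ B ⟧ * upper B))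
                       + ∑ (subsets n) (λ A → ⟦ 𝓖 A ⟧ * (⟦ 𝓖 B ∧ A ⊂ᵇ B ⟧ * lower A)))
      ≡⟨ ∑-+ (subsets n) _ _ ⟩
    ∑ (subsets n) (λ B → ∑ (subsets n) (λ A → ⟦ 𝓖 B ⟧ * (⟦ 𝓖 A ∧ A ⊂ᵇ B ⟧ * upper B)))
      + ∑ (subsets n) (λ B → ∑ (subsets n) (λ A → ⟦ 𝓖 A ⟧ * (⟦ 𝓖 B ∧ A ⊂ᵇ B ⟧ * lower A)))
      ≡⟨ cong₂ _+_
           (∑-cong (subsets n) (λ B → trans (∑-*ˡ (subsets n) ⟦ 𝓖 B ⟧ _) (cong (⟦ 𝓖 B ⟧ *_) (∑-*ʳ (subsets n) (upper B) _))))
           (trans (∑-swap (subsets n) (subsets n) _)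
             (∑-cong (subsets n) (λ A → trans (∑-*ˡ (subsets n) ⟦ 𝓖 A ⟧ _) (cong (⟦ 𝓖 A ⟧ *_) (∑-*ʳ (subsets n) (lower A) _))))) ⟩
    ∑ (subsets n) (λ B → ⟦ 𝓖 B ⟧ * (sub 𝓖 B * upper B)) + ∑ (subsets n) (λ A → ⟦ 𝓖 A ⟧ * (sup 𝓖 A * lower A))
      ≡⟨ sym (∑-+ (subsets n) _ _) ⟩
    ∑ (subsets n) (λ B → ⟦ 𝓖 B ⟧ * (sub 𝓖 B * upper B) + ⟦ 𝓖 B ⟧ * (sup 𝓖 B * lower B))
      ≤⟨ ∑-mono (subsets n) (λ B → ≤-trans (≤-reflexive (sym (*-distribˡ-+ ⟦ 𝓖 B ⟧ _ _)))
           (⟦⟧-*-mono (𝓖 B) (λ p → let _ , few , few′ = hyp B p in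
             +-mono-≤ (≤-trans (*-monoˡ-≤ (upper B) few) (≤-reflexive (*-identityˡ _)))
                      (≤-trans (*-monoˡ-≤ (lower B) few′) (≤-reflexive (*-identityˡ _)))))) ⟩
    Σcharge ∎
    where
    term : ∀ A B → ⟦ 𝓖 B ⟧ * (co B ! * (⟦ 𝓖 A ∧ A ⊂ᵇ B ⟧ * (card A ! * (card B ∸ card A) !))) ≤
      ⟦ 𝓖 B ⟧ * (⟦ 𝓖 A ∧ A ⊂ᵇ B ⟧ * upper B) + ⟦ 𝓖 A ⟧ * (⟦ 𝓖 B ∧ A ⊂ᵇ B ⟧ * lower A)
    term A B with 𝓖 B | 𝓖 A in eqA | A ⊂ᵇ B in lt
    ... | false | _     | _     = z≤n
    ... | true  | false | _     = ≤-trans (≤-reflexive (trans (+-identityʳ _) (*-zeroʳ (co B !)))) z≤n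
    ... | true  | true  | false = ≤-trans (≤-reflexive (trans (+-identityʳ _) (*-zeroʳ (co B !)))) z≤n
    ... | true  | true  | true  = ≤-trans (≤-reflexive (form₁ (co B !) _)) (≤-trans (shift A B eqA lt) (≤-reflexive (form₂ (upper B) (lower A))))
      where
      form₁ : ∀ x y → x * (y + 0) + 0 ≡ x * y
      form₁ = solve-∀
      form₂ : ∀ x y → x + y ≡ x + 0 + 0 + (y + 0 + 0)
      form₂ = solve-∀
  total : ∑ (subsets n) (λ B → ⟦ 𝓖 B ⟧ * (k ! * k !)) + Σcharge ≤ n ! + Σcharge
  total = begin
    ∑ (subsets n) (λ B → ⟦ 𝓖 B ⟧ * (k ! * k !)) + Σcharge
      ≡⟨ sym (∑-+ (subsets n) _ _) ⟩
    ∑ (subsets n) (λ B → ⟦ 𝓖 B ⟧ * (k ! * k !) + ⟦ 𝓖 B ⟧ * (upper B + lower B))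
      ≤⟨ ∑-mono (subsets n) (λ B → ≤-trans (≤-reflexive (sym (*-distribˡ-+ ⟦ 𝓖 B ⟧ _ _)))
           (*-monoʳ-≤ ⟦ 𝓖 B ⟧ (charged B))) ⟩
    ∑ (subsets n) (λ B → ⟦ 𝓖 B ⟧ * (co B ! * card B !))
      ≤⟨ chain-bound n 𝓖 ⟩
    n ! + ∑ (subsets n) (λ B → ⟦ 𝓖 B ⟧ * (co B ! * below 𝓖 B))
      ≤⟨ +-monoʳ-≤ (n !) Σpairs≤ ⟩
    n ! + Σcharge ∎

-- Averaging over permutations

range : ℕ → ℕ → List ℕ
range a zero    = []
range a (suc m) = a ∷ range (suc a) m

∑-range-suc : ∀ a m (g : ℕ → ℕ) → ∑ (range (suc a) m) g ≡ ∑ (range a m) (g ∘ suc)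
∑-range-suc a zero    g = refl
∑-range-suc a (suc m) g = cong (g (suc a) +_) (∑-range-suc (suc a) m g)

∑-range-++ : ∀ a l m (g : ℕ → ℕ) → ∑ (range a (l + m)) g ≡ ∑ (range a l) g + ∑ (range (a + l) m) g
∑-range-++ a zero    m g = cong (λ b → ∑ (range b m) g) (sym (+-identityʳ a))
∑-range-++ a (suc l) m g rewrite ∑-range-++ (suc a) l m g | +-suc a l = sym (+-assoc (g a) _ _)

∑-range-last : ∀ a m (g : ℕ → ℕ) → ∑ (range a (suc m)) g ≡ ∑ (range a m) g + g (a + m)
∑-range-last a m g = trans (cong (λ l → ∑ (range a l) g) (sym (+-comm m 1)))
  (trans (∑-range-++ a m 1 g) (cong (∑ (range a m) g +_) (+-identityʳ _)))

∑-range-cong : ∀ a m {g h : ℕ → ℕ} → (∀ i → a ≤ i → i < a + m → g i ≡ h i) → ∑ (range a m) g ≡ ∑ (range a m) h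
∑-range-cong a zero    eq = refl
∑-range-cong a (suc m) eq = cong₂ _+_ (eq a ≤-refl (m<m+n a (s≤s z≤n)))
  (∑-range-cong (suc a) m (λ i a≤ i< → eq i (<⇒≤ a≤) (subst (i <_) (sym (+-suc a m)) i<)))

∑-range-mono : ∀ a m {g h : ℕ → ℕ} → (∀ i → a ≤ i → i < a + m → g i ≤ h i) → ∑ (range a m) g ≤ ∑ (range a m) h
∑-range-mono a zero    le = z≤n
∑-range-mono a (suc m) le = +-mono-≤ (le a ≤-refl (m<m+n a (s≤s z≤n)))
  (∑-range-mono (suc a) m (λ i a≤ i< → le i (<⇒≤ a≤) (subst (i <_) (sym (+-suc a m)) i<)))

length-range : ∀ a m → length (range a m) ≡ m
length-range a zero    = refl
length-range a (suc m) = cong suc (length-range (suc a) m)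

∑-rotate : ∀ n (g : ℕ → ℕ) → (∀ i → g (n + i) ≡ g i) → ∀ j → ∑ (range 0 n) (λ i → g (j + i)) ≡ ∑ (range 0 n) g
∑-rotate n g per zero    = refl
∑-rotate n g per (suc j) = trans (+-cancelʳ-≡ (g (j + 0)) _ _ (begin
  ∑ (range 0 n) (λ i → g (suc j + i)) + g (j + 0)   ≡⟨ cong₂ _+_ (∑-cong (range 0 n) (λ i → cong g (sym (+-suc j i)))) refl ⟩
  ∑ (range 0 n) (h ∘ suc) + h 0  ≡⟨ cong (_+ h 0) (sym (∑-range-suc 0 n h)) ⟩
  ∑ (range 1 n) h + h 0  ≡⟨ +-comm _ (h 0) ⟩
  ∑ (range 0 (suc n)) h  ≡⟨ ∑-range-last 0 n h ⟩
  ∑ (range 0 n) h + g (j + n)  ≡⟨ cong (∑ (range 0 n) h +_) (trans (cong g (+-comm j n)) (trans (per j) (cong g (sym (+-identityʳ j))))) ⟩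
  ∑ (range 0 n) h + g (j + 0) ∎)) (∑-rotate n g per j)
  where
  open ≡-Reasoning
  h : ℕ → ℕ
  h i = g (j + i)

-- The reflection `c + d = a + b + k − 1` carries the window at `a` onto the window at `b` in
-- reverse order. Complementary lengths of arcs are paired this way.
∑-reflect : ∀ a b k (r : ℕ → ℕ) → (∀ c d → suc (c + d) ≡ a + b + k → r c ≡ r d) →
            ∑ (range a k) r ≡ ∑ (range b k) r
∑-reflect a b zero    r eq = refl
∑-reflect a b (suc k) r eq = begin
  r a + ∑ (range (suc a) k) r    ≡⟨ cong₂ _+_ (eq a (b + k) (trans (cong suc (sym (+-assoc a b k))) (sym (+-suc (a + b) k))))
                                      (∑-reflect (suc a) b k r (λ c d q → eq c d (trans q (sym (+-suc (a + b) k))))) ⟩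
  r (b + k) + ∑ (range b k) r    ≡⟨ +-comm (r (b + k)) _ ⟩
  ∑ (range b k) r + r (b + k)    ≡⟨ sym (∑-range-last b k r) ⟩
  ∑ (range b (suc k)) r ∎
  where open ≡-Reasoning

-- Lehmer codes: the image of 0, then a code for the remaining positions. The enumeration is a
-- product, so the count `n !` and all averages follow by induction.
data Perm : ℕ → Set where
  ε   : Perm 0
  _◂_ : ∀ {n} → Fin (suc n) → Perm n → Perm (suc n)

perms : ∀ n → List (Perm n)
perms zero    = ε ∷ []
perms (suc n) = cartesianProductWith _◂_ (fins (suc n)) (perms n)

∑-perms-suc : ∀ {n} (F : Perm (suc n) → ℕ) →
  ∑ (perms (suc n)) F ≡ ∑ (fins (suc n)) (λ x → ∑ (perms n) (λ π → F (x ◂ π)))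
∑-perms-suc {n} F = ∑-cartesian _◂_ (fins (suc n)) (perms n) F

∑-perms-const : ∀ n c → ∑ (perms n) (λ _ → c) ≡ n ! * c
∑-perms-const zero    c = refl
∑-perms-const (suc n) c = begin
  ∑ (perms (suc n)) (λ _ → c)               ≡⟨ ∑-perms-suc {n} (λ _ → c) ⟩
  ∑ (fins (suc n)) (λ _ → ∑ (perms n) (λ _ → c))  ≡⟨ ∑-const (fins (suc n)) _ ⟩
  length (fins (suc n)) * ∑ (perms n) (λ _ → c)   ≡⟨ cong₂ _*_ (length-fins (suc n)) (∑-perms-const n c) ⟩
  suc n * (n ! * c)  ≡⟨ sym (*-assoc (suc n) (n !) c) ⟩
  suc n ! * c ∎
  where open ≡-Reasoning

-- The preimage of a set of positions under the permutation sending 0 to x and the rest by π into the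
-- positions other than x.
act : ∀ {n} → Perm n → Subset n → Subset n
act ε       []    = []
act (x ◂ π) I     = lookup I x ∷ act π (removeAt I x)

-- Size and cosize both appear as parameters so that fixing the first element of the set lowers
-- exactly one of them in the recursion.
onLevel : ∀ {n} → (Subset n → ℕ) → ℕ → ℕ → ℕ
onLevel {n} φ c d = ∑ (subsets n) (λ A → ⟦ (card A ≡ᵇ c) ∧ (co A ≡ᵇ d) ⟧ * φ A)

card-removeAt : ∀ {n} (I : Subset (suc n)) x → lookup I x ≡ true →
                card I ≡ suc (card (removeAt I x)) × co I ≡ co (removeAt I x)
card-removeAt (true ∷ I)      zero    _ = refl , refl
card-removeAt (true ∷ j ∷ I)  (suc x) p with card-removeAt (j ∷ I) x p
... | q , q′ = cong suc q , q′
card-removeAt (false ∷ j ∷ I) (suc x) p with card-removeAt (j ∷ I) x p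
... | q , q′ = q , cong suc q′

co-removeAt : ∀ {n} (I : Subset (suc n)) x → lookup I x ≡ false →
              card I ≡ card (removeAt I x) × co I ≡ suc (co (removeAt I x))
co-removeAt (false ∷ I)     zero    _ = refl , refl
co-removeAt (true ∷ j ∷ I)  (suc x) p with co-removeAt (j ∷ I) x p
... | q , q′ = cong suc q , q′
co-removeAt (false ∷ j ∷ I) (suc x) p with co-removeAt (j ∷ I) x p
... | q , q′ = q , cong suc q′

∑-lookup : ∀ {n} (I : Subset n) → ∑ (fins n) (λ x → ⟦ lookup I x ⟧) ≡ card I
∑-lookup []              = refl
∑-lookup {suc n} (true ∷ I)  = cong suc (trans (∑-map suc (fins n) _) (∑-lookup I))
∑-lookup {suc n} (false ∷ I) = trans (∑-map suc (fins n) _) (∑-lookup I)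

∑-lookup-∁ : ∀ {n} (I : Subset n) → ∑ (fins n) (λ x → ⟦ not (lookup I x) ⟧) ≡ co I
∑-lookup-∁ []              = refl
∑-lookup-∁ {suc n} (true ∷ I)  = trans (∑-map suc (fins n) _) (∑-lookup-∁ I)
∑-lookup-∁ {suc n} (false ∷ I) = cong suc (trans (∑-map suc (fins n) _) (∑-lookup-∁ I))

-- Every set with as many elements as `I` is `act π I` for exactly `card I ! * co I !` codes `π`.
-- The induction splits the codes by whether their first entry lies in `I`.
∑-perms-act : ∀ {n} (φ : Subset n → ℕ) (I : Subset n) →
  ∑ (perms n) (λ π → φ (act π I)) ≡ card I ! * co I ! * onLevel φ (card I) (co I)
∑-perms-act φ [] = sym (trans (+-identityʳ _) (cong (_+ 0) (+-identityʳ _)))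
∑-perms-act {suc n} φ I = begin
  ∑ (perms (suc n)) (λ π → φ (act π I))
    ≡⟨ ∑-perms-suc (λ π → φ (act π I)) ⟩
  ∑ (fins (suc n)) (λ x → ∑ (perms n) (λ π → φ (lookup I x ∷ act π (removeAt I x))))
    ≡⟨ ∑-cong (fins (suc n)) column ⟩
  ∑ (fins (suc n)) (λ x → ⟦ lookup I x ⟧ * T + ⟦ not (lookup I x) ⟧ * F)
    ≡⟨ ∑-+ (fins (suc n)) (λ x → ⟦ lookup I x ⟧ * T) (λ x → ⟦ not (lookup I x) ⟧ * F) ⟩
  ∑ (fins (suc n)) (λ x → ⟦ lookup I x ⟧ * T) + ∑ (fins (suc n)) (λ x → ⟦ not (lookup I x) ⟧ * F)
    ≡⟨ cong₂ _+_ (trans (∑-*ʳ (fins (suc n)) T (λ x → ⟦ lookup I x ⟧)) (cong (_* T) (∑-lookup I)))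
                 (trans (∑-*ʳ (fins (suc n)) F (λ x → ⟦ not (lookup I x) ⟧)) (cong (_* F) (∑-lookup-∁ I))) ⟩
  card I * T + co I * F
    ≡⟨ cong₂ _+_ (recombine-T (card I)) (recombine-F (co I)) ⟩
  card I ! * co I ! * levelT (card I) (co I) + card I ! * co I ! * levelF (card I) (co I)
    ≡⟨ sym (*-distribˡ-+ (card I ! * co I !) _ _) ⟩
  card I ! * co I ! * (levelT (card I) (co I) + levelF (card I) (co I))
    ≡⟨ cong (card I ! * co I ! *_) (sym (∑-subsets-suc (λ A → ⟦ (card A ≡ᵇ card I) ∧ (co A ≡ᵇ co I) ⟧ * φ A))) ⟩
  card I ! * co I ! * onLevel φ (card I) (co I) ∎
  where
  open ≡-Reasoning
  φT φF : Subset n → ℕ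
  φT A = φ (true ∷ A)
  φF A = φ (false ∷ A)
  levelT levelF : ℕ → ℕ → ℕ
  levelT c d = ∑ (subsets n) (λ A → ⟦ (suc (card A) ≡ᵇ c) ∧ (co A ≡ᵇ d) ⟧ * φT A)
  levelF c d = ∑ (subsets n) (λ A → ⟦ (card A ≡ᵇ c) ∧ (suc (co A) ≡ᵇ d) ⟧ * φF A)
  T = (card I ∸ 1) ! * co I ! * onLevel φT (card I ∸ 1) (co I)
  F = card I ! * (co I ∸ 1) ! * onLevel φF (card I) (co I ∸ 1)
  column : ∀ x → ∑ (perms n) (λ π → φ (lookup I x ∷ act π (removeAt I x))) ≡
                 ⟦ lookup I x ⟧ * T + ⟦ not (lookup I x) ⟧ * F
  column x with lookup I x in eq
  ... | true  = trans (∑-perms-act φT (removeAt I x))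
    (trans (cong₂ (λ c d → c ! * d ! * onLevel φT c d) (cong (_∸ 1) (sym (proj₁ (card-removeAt I x eq)))) (sym (proj₂ (card-removeAt I x eq))))
           (sym (trans (+-identityʳ _) (+-identityʳ _))))
  ... | false = trans (∑-perms-act φF (removeAt I x))
    (trans (cong₂ (λ c d → c ! * d ! * onLevel φF c d) (sym (proj₁ (co-removeAt I x eq))) (cong (_∸ 1) (sym (proj₂ (co-removeAt I x eq)))))
           (sym (+-identityʳ _)))
  recombine-T : ∀ c → c * ((c ∸ 1) ! * co I ! * onLevel φT (c ∸ 1) (co I)) ≡ c ! * co I ! * levelT c (co I)
  recombine-T zero    = sym (trans (cong (1 * co I ! *_) (∑-0 (subsets n))) (*-zeroʳ (1 * co I !)))
  recombine-T (suc c) = form (suc c) (c !) (co I !) _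
    where
    form : ∀ a f g l → a * (f * g * l) ≡ a * f * g * l
    form = solve-∀
  recombine-F : ∀ d → d * (card I ! * (d ∸ 1) ! * onLevel φF (card I) (d ∸ 1)) ≡ card I ! * d ! * levelF (card I) d
  recombine-F zero    = sym (trans (cong (card I ! * 1 *_) (trans (∑-cong (subsets n) none) (∑-0 (subsets n)))) (*-zeroʳ (card I ! * 1)))
    where
    none : ∀ A → ⟦ (card A ≡ᵇ card I) ∧ false ⟧ * φF A ≡ 0
    none A with card A ≡ᵇ card I
    ... | true  = refl
    ... | false = refl
  recombine-F (suc d) = form (suc d) (card I !) (d !) _
    where
    form : ∀ a f g l → a * (f * g * l) ≡ f * (a * g) * l
    form = solve-∀

act-∁ : ∀ {n} (π : Perm n) I → act π (∁ I) ≡ ∁ (act π I)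
act-∁ ε       []    = refl
act-∁ (x ◂ π) I = cong₂ _∷_ (lookup-map x not I) (trans (cong (act π) (removeAt-∁ I x)) (act-∁ π (removeAt I x)))
  where
  open Data.Vec.Properties using (lookup-map)
  removeAt-∁ : ∀ {n} (I : Subset (suc n)) x → removeAt (∁ I) x ≡ ∁ (removeAt I x)
  removeAt-∁ (_ ∷ _)     zero    = refl
  removeAt-∁ (i ∷ j ∷ I) (suc x) = cong (not i ∷_) (removeAt-∁ (j ∷ I) x)

card-act : ∀ {n} (π : Perm n) I → card (act π I) ≡ card I
card-act ε       [] = refl
card-act (x ◂ π) I with lookup I x in eq
... | true  = trans (cong suc (card-act π (removeAt I x))) (sym (proj₁ (card-removeAt I x eq)))
... | false = trans (card-act π (removeAt I x)) (sym (proj₁ (co-removeAt I x eq)))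

act-⊆ᵇ : ∀ {n} (π : Perm n) I J → I ⊆ᵇ J ≡ true → act π I ⊆ᵇ act π J ≡ true
act-⊆ᵇ ε       []  []  _ = refl
act-⊆ᵇ (x ◂ π) I J p = ∧-intro (proj₁ (at I J x p)) (act-⊆ᵇ π _ _ (proj₂ (at I J x p)))
  where
  at : ∀ {n} (I J : Subset (suc n)) x → I ⊆ᵇ J ≡ true →
       not (lookup I x) ∨ lookup J x ≡ true × removeAt I x ⊆ᵇ removeAt J x ≡ true
  at (i ∷ I)     (j ∷ J)     zero    p = ∧-elimˡ {not i ∨ j} p , ∧-elimʳ {not i ∨ j} p
  at (i ∷ a ∷ I) (j ∷ b ∷ J) (suc x) p with at (a ∷ I) (b ∷ J) x (∧-elimʳ {not i ∨ j} p)
  ... | q , q′ = q , ∧-intro (∧-elimˡ {not i ∨ j} p) q′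

act-⊂ᵇ : ∀ {n} (π : Perm n) I J → I ⊂ᵇ J ≡ true → act π I ⊂ᵇ act π J ≡ true
act-⊂ᵇ π I J p = ∧-intro (act-⊆ᵇ π I J (∧-elimˡ {I ⊆ᵇ J} p))
  (trans (cong₂ _<ᵇ_ (card-act π I) (card-act π J)) (∧-elimʳ {I ⊆ᵇ J} p))

≡ᵇ-refl : ∀ a → (a ≡ᵇ a) ≡ true
≡ᵇ-refl zero    = refl
≡ᵇ-refl (suc a) = ≡ᵇ-refl a

≡ᵇ-to : ∀ {a b} → (a ≡ᵇ b) ≡ true → a ≡ b
≡ᵇ-to {zero}  {zero}  _  = refl
≡ᵇ-to {suc a} {suc b} eq = cong suc (≡ᵇ-to eq)

-- Averaging over all permutations π an inequality for the members of 𝓖 among the π-images of a system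
-- of position sets with n sets of each size d.
average : ∀ m (𝓖 : Family (suc m)) (arc : ℕ → ℕ → Subset (suc m)) M →
  (∀ i d → d ≤ suc m → card (arc i d) ≡ d) →
  (∀ A → 𝓖 A ≡ true → 0 < card A × 0 < co A) →
  (∀ π → ∑ (range 0 (suc m)) (λ i → ∑ (range 1 m) (λ d → (suc m C d) * ⟦ 𝓖 (act π (arc i d)) ⟧)) ≤ M) →
  suc m * size 𝓖 ≤ M
average m 𝓖 arc M card-arc proper bound = *-cancelˡ-≤ (n !) {{n !≢0}} (begin
  n ! * (n * size 𝓖)
    ≤⟨ *-monoʳ-≤ (n !) (*-monoʳ-≤ n levels) ⟩
  n ! * (n * ∑ (range 1 m) level)
    ≡⟨ form (n !) n _ ⟩
  n * (n ! * ∑ (range 1 m) level)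
    ≡⟨ cong (n *_) (sym (∑-*ˡ (range 1 m) (n !) level)) ⟩
  n * ∑ (range 1 m) (λ d → n ! * level d)
    ≡⟨ cong (_* ∑ (range 1 m) (λ d → n ! * level d)) (sym (length-range 0 n)) ⟩
  length (range 0 n) * ∑ (range 1 m) (λ d → n ! * level d)
    ≡⟨ sym (∑-const (range 0 n) _) ⟩
  ∑ (range 0 n) (λ i → ∑ (range 1 m) (λ d → n ! * level d))
    ≡⟨ ∑-cong (range 0 n) (λ i → ∑-range-cong 1 m (λ d _ d< → sym (uniform i d (<⇒≤ d<)))) ⟩
  ∑ (range 0 n) (λ i → ∑ (range 1 m) (λ d → ∑ (perms n) (λ π → (n C d) * ⟦ 𝓖 (act π (arc i d)) ⟧)))
    ≡⟨ ∑-cong (range 0 n) (λ i → ∑-swap (range 1 m) (perms n) _) ⟩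
  ∑ (range 0 n) (λ i → ∑ (perms n) (λ π → ∑ (range 1 m) (λ d → (n C d) * ⟦ 𝓖 (act π (arc i d)) ⟧)))
    ≡⟨ ∑-swap (range 0 n) (perms n) _ ⟩
  ∑ (perms n) (λ π → ∑ (range 0 n) (λ i → ∑ (range 1 m) (λ d → (n C d) * ⟦ 𝓖 (act π (arc i d)) ⟧)))
    ≤⟨ ∑-mono (perms n) bound ⟩
  ∑ (perms n) (λ _ → M)
    ≡⟨ ∑-perms-const n M ⟩
  n ! * M ∎)
  where
  open ≤-Reasoning
  n = suc m
  form : ∀ a b c → a * (b * c) ≡ b * (a * c)
  form = solve-∀
  level : ℕ → ℕ
  level d = onLevel (λ A → ⟦ 𝓖 A ⟧) d (n ∸ d)
  co-arc : ∀ i d → d ≤ n → co (arc i d) ≡ n ∸ d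
  co-arc i d d≤ = trans (Subₚ.∣∁p∣≡n∸∣p∣ (arc i d)) (cong (n ∸_) (card-arc i d d≤))
  -- The coefficient `n C d` compensates for the `d ! * (n ∸ d) !` permutations per set, so every
  -- level ends up with the same factor `n !`.
  uniform : ∀ i d → d ≤ n → ∑ (perms n) (λ π → (n C d) * ⟦ 𝓖 (act π (arc i d)) ⟧) ≡ n ! * level d
  uniform i d d≤ = begin-equality
    ∑ (perms n) (λ π → (n C d) * ⟦ 𝓖 (act π (arc i d)) ⟧)
      ≡⟨ ∑-*ˡ (perms n) (n C d) _ ⟩
    (n C d) * ∑ (perms n) (λ π → ⟦ 𝓖 (act π (arc i d)) ⟧)
      ≡⟨ cong ((n C d) *_) (∑-perms-act (λ A → ⟦ 𝓖 A ⟧) (arc i d)) ⟩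
    (n C d) * (card (arc i d) ! * co (arc i d) ! * onLevel (λ A → ⟦ 𝓖 A ⟧) (card (arc i d)) (co (arc i d)))
      ≡⟨ cong ((n C d) *_) (cong₂ (λ a b → a ! * b ! * onLevel (λ A → ⟦ 𝓖 A ⟧) a b) (card-arc i d d≤) (co-arc i d d≤)) ⟩
    (n C d) * (d ! * (n ∸ d) ! * level d)
      ≡⟨ sym (*-assoc (n C d) _ (level d)) ⟩
    (n C d) * (d ! * (n ∸ d) !) * level d
      ≡⟨ cong (_* level d) (trans (cong (λ k → (k C d) * (d ! * (n ∸ d) !)) (sym (m+[n∸m]≡n d≤)))
                           (trans (nCk*k!*c! d (n ∸ d)) (cong _! (m+[n∸m]≡n d≤)))) ⟩
    n ! * level d ∎
  hits : ∀ a l c → a ≤ c → c < a + l → 1 ≤ ∑ (range a l) (λ d → ⟦ c ≡ᵇ d ⟧)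
  hits a zero    c a≤c c< = absurd (<-irrefl refl (≤-trans c< (≤-trans (≤-reflexive (+-identityʳ a)) a≤c)))
  hits a (suc l) c a≤c c< with m≤n⇒m<n∨m≡n a≤c
  ... | inj₂ refl rewrite ≡ᵇ-refl a = s≤s z≤n
  ... | inj₁ lt = ≤-trans (hits (suc a) l c lt (subst (c <_) (+-suc a l) c<)) (m≤n+m _ _)
  levels : size 𝓖 ≤ ∑ (range 1 m) level
  levels = begin
    size 𝓖
      ≤⟨ ∑-mono (subsets n) member ⟩
    ∑ (subsets n) (λ A → ∑ (range 1 m) (λ d → ⟦ (card A ≡ᵇ d) ∧ (co A ≡ᵇ n ∸ d) ⟧ * ⟦ 𝓖 A ⟧))
      ≡⟨ ∑-swap (subsets n) (range 1 m) _ ⟩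
    ∑ (range 1 m) level ∎
    where
    member : ∀ A → ⟦ 𝓖 A ⟧ ≤ ∑ (range 1 m) (λ d → ⟦ (card A ≡ᵇ d) ∧ (co A ≡ᵇ n ∸ d) ⟧ * ⟦ 𝓖 A ⟧)
    member A = begin
      ⟦ 𝓖 A ⟧
        ≡⟨ sym (*-identityʳ _) ⟩
      ⟦ 𝓖 A ⟧ * 1
        ≤⟨ ⟦⟧-*-mono (𝓖 A) (λ p → hits 1 m (card A) (proj₁ (proper A p))
             (subst (card A <_) (card-∁ A) (m<m+n (card A) (proj₂ (proper A p))))) ⟩
      ⟦ 𝓖 A ⟧ * ∑ (range 1 m) (λ d → ⟦ card A ≡ᵇ d ⟧)
        ≡⟨ *-comm ⟦ 𝓖 A ⟧ _ ⟩
      ∑ (range 1 m) (λ d → ⟦ card A ≡ᵇ d ⟧) * ⟦ 𝓖 A ⟧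
        ≤⟨ *-monoˡ-≤ ⟦ 𝓖 A ⟧ (∑-mono (range 1 m) (λ d → ⟦⟧-mono (λ p → ∧-intro p (co-level d (≡ᵇ-to p))))) ⟩
      ∑ (range 1 m) (λ d → ⟦ (card A ≡ᵇ d) ∧ (co A ≡ᵇ n ∸ d) ⟧) * ⟦ 𝓖 A ⟧
        ≡⟨ sym (∑-*ʳ (range 1 m) ⟦ 𝓖 A ⟧ _) ⟩
      ∑ (range 1 m) (λ d → ⟦ (card A ≡ᵇ d) ∧ (co A ≡ᵇ n ∸ d) ⟧ * ⟦ 𝓖 A ⟧) ∎
      where
      co-level : ∀ d → card A ≡ d → (co A ≡ᵇ n ∸ d) ≡ true
      co-level d refl rewrite Subₚ.∣∁p∣≡n∸∣p∣ A = ≡ᵇ-refl (n ∸ card A)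

-- Arcs of a cycle

bits : ∀ n → (ℕ → Bool) → Subset n
bits n f = tabulate (λ p → f (toℕ p))

bits-cong : ∀ n {f g} → (∀ p → f p ≡ g p) → bits n f ≡ bits n g
bits-cong n eq = Data.Vec.Properties.tabulate-cong (λ p → eq (toℕ p))

bits-∁ : ∀ n f → ∁ (bits n f) ≡ bits n (not ∘ f)
bits-∁ n f = sym (Data.Vec.Properties.tabulate-∘ not (λ p → f (toℕ p)))

bits-⊆ᵇ : ∀ n {f g} → (∀ p → f p ≡ true → g p ≡ true) → bits n f ⊆ᵇ bits n g ≡ true
bits-⊆ᵇ zero    imp = refl
bits-⊆ᵇ (suc n) {f} {g} imp = ∧-intro (head (f 0) (imp 0)) (bits-⊆ᵇ n (λ p → imp (suc p)))
  where
  head : ∀ b → (b ≡ true → g 0 ≡ true) → not b ∨ g 0 ≡ true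
  head true  i = i refl
  head false i = refl

card-bits : ∀ n f → card (bits n f) ≡ ∑ (range 0 n) (λ p → ⟦ f p ⟧)
card-bits zero    f = refl
card-bits (suc n) f with f 0
... | true  = cong suc (trans (card-bits n (f ∘ suc)) (sym (∑-range-suc 0 n _)))
... | false = trans (card-bits n (f ∘ suc)) (sym (∑-range-suc 0 n _))

∑-<ᵇ : ∀ n d → d ≤ n → ∑ (range 0 n) (λ p → ⟦ p <ᵇ d ⟧) ≡ d
∑-<ᵇ zero    zero    _        = refl
∑-<ᵇ (suc n) zero    _        = ∑-0 (range 1 n)
∑-<ᵇ (suc n) (suc d) (s≤s d≤) = cong suc (trans (∑-range-suc 0 n _) (∑-<ᵇ n d d≤))

-- The arc of length d on the cycle ℤ/(1+m) that starts at −i.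
arc : ∀ m → ℕ → ℕ → Subset (suc m)
arc m i d = bits (suc m) (λ p → (i + p) % suc m <ᵇ d)

module _ (m : ℕ) where
  private
    n = suc m

    suc-% : ∀ x → suc x % n ≤ suc (x % n)
    suc-% x = ≤-trans (≤-reflexive (%-distribˡ-+ 1 x n))
      (≤-trans (m%n≤m (1 % n + x % n) n) (+-monoˡ-≤ (x % n) (m%n≤m 1 n)))

  card-arc : ∀ i d → d ≤ n → card (arc m i d) ≡ d
  card-arc i d d≤ = begin
    card (arc m i d)  ≡⟨ card-bits n _ ⟩
    ∑ (range 0 n) (λ p → ⟦ (i + p) % n <ᵇ d ⟧)         ≡⟨ ∑-rotate n (λ p → ⟦ p % n <ᵇ d ⟧) periodic i ⟩
    ∑ (range 0 n) (λ p → ⟦ p % n <ᵇ d ⟧)               ≡⟨ ∑-range-cong 0 n (λ p _ p<n → cong (λ x → ⟦ x <ᵇ d ⟧) (m<n⇒m%n≡m p<n)) ⟩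
    ∑ (range 0 n) (λ p → ⟦ p <ᵇ d ⟧)  ≡⟨ ∑-<ᵇ n d d≤ ⟩
    d ∎
    where
    open ≡-Reasoning
    periodic : ∀ p → ⟦ (n + p) % n <ᵇ d ⟧ ≡ ⟦ p % n <ᵇ d ⟧
    periodic p = cong (λ x → ⟦ x <ᵇ d ⟧) (trans (cong (_% n) (+-comm n p)) ([m+n]%n≡m%n p n))

  arc-periodic : ∀ i d → arc m (n + i) d ≡ arc m i d
  arc-periodic i d = bits-cong n (λ p → cong (_<ᵇ d)
    (trans (cong (_% n) (trans (+-assoc n i p) (+-comm n (i + p)))) ([m+n]%n≡m%n (i + p) n)))

  arc-⊂ᵇ : ∀ i {d d′} → d < d′ → d′ ≤ n → arc m i d ⊂ᵇ arc m i d′ ≡ true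
  arc-⊂ᵇ i {d} {d′} lt d′≤ = ∧-intro
    (bits-⊆ᵇ n {λ p → (i + p) % n <ᵇ d} {λ p → (i + p) % n <ᵇ d′} (λ p q → <ᵇ-from (<-trans (<ᵇ-to q) lt)))
    (<ᵇ-from (≤-trans (≤-reflexive (cong suc (card-arc i d (≤-trans (<⇒≤ lt) d′≤))))
                      (≤-trans lt (≤-reflexive (sym (card-arc i d′ d′≤))))))

  -- Passing from `i` to `suc i` moves the start back by one position, and one unit of additional
  -- length makes up for it.
  arc-suc-⊂ᵇ : ∀ i {d d′} → d < d′ → d′ ≤ n → arc m i d ⊂ᵇ arc m (suc i) d′ ≡ true
  arc-suc-⊂ᵇ i {d} {d′} lt d′≤ = ∧-intro
    (bits-⊆ᵇ n {λ p → (i + p) % n <ᵇ d} {λ p → (suc i + p) % n <ᵇ d′}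
      (λ p q → <ᵇ-from (≤-trans (s≤s (≤-trans (suc-% (i + p)) (<ᵇ-to q))) lt)))
    (<ᵇ-from (≤-trans (≤-reflexive (cong suc (card-arc i d (≤-trans (<⇒≤ lt) d′≤))))
                      (≤-trans lt (≤-reflexive (sym (card-arc (suc i) d′ d′≤))))))

  -- The complement starts where the arc ends, at `d − i`, which is `−(c + i)` modulo `n = c + d`.
  arc-∁ : ∀ i c d → c + d ≡ n → arc m (c + i) c ≡ ∁ (arc m i d)
  arc-∁ i c d c+d = trans (bits-cong n flip) (sym (bits-∁ n (λ p → (i + p) % n <ᵇ d)))
    where
    shifted : ∀ x → x < n → ((c + x) % n <ᵇ c) ≡ not (x <ᵇ d)
    shifted x x<n with x <ᵇ d in eq
    ... | true  with (c + x) % n <ᵇ c in eq′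
    ...   | false = refl
    ...   | true  = absurd (<-irrefl refl (≤-trans (<ᵇ-to eq′) (≤-trans (m≤m+n c x) (≤-reflexive (sym (m<n⇒m%n≡m
                      (subst (c + x <_) c+d (+-monoʳ-< c (<ᵇ-to eq)))))))))
    shifted x x<n | false with m≤n⇒∃[o]m+o≡n {m = d} {n = x} (<ᵇ-false {x} eq)
    ... | y , refl = <ᵇ-from (subst (_< c) (sym c+x) y<c)
      where
      y<c : y < c
      y<c = +-cancelˡ-< d y c (subst (d + y <_) (trans (sym c+d) (+-comm c d)) x<n)
      c+x : (c + (d + y)) % n ≡ y
      c+x = trans (cong (_% n) (trans (sym (+-assoc c d y)) (trans (cong (_+ y) c+d) (+-comm n y))))
              (trans ([m+n]%n≡m%n y n) (m<n⇒m%n≡m (≤-trans y<c (≤-trans (m≤m+n c d) (≤-reflexive c+d)))))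
    flip : ∀ p → ((c + i + p) % n <ᵇ c) ≡ not ((i + p) % n <ᵇ d)
    flip p = trans (cong (_<ᵇ c) reduce) (shifted ((i + p) % n) (m%n<n (i + p) n))
      where
      reduce : (c + i + p) % n ≡ (c + (i + p) % n) % n
      reduce = trans (cong (_% n) (+-assoc c i p)) (trans (%-distribˡ-+ c (i + p) n)
        (trans (cong (λ k → (c % n + k) % n) (sym (m%n%n≡m%n (i + p) n))) (sym (%-distribˡ-+ c ((i + p) % n) n))))

-- One hit `d` is split off, and `t` further hits are kept in the window of length `j` behind it.
-- Iterating `first` thus lists hits in increasing order, which for arcs with a common start is a
-- chain.
First : ℕ → ℕ → ℕ → (ℕ → Bool) → Set
First a l t p = ∃ λ d → ∃ λ j → a ≤ d × d + suc j ≡ a + l × p d ≡ true × t ≤ ∑ (range (suc d) j) (λ d → ⟦ p d ⟧)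

first : ∀ a l t (p : ℕ → Bool) → suc t ≤ ∑ (range a l) (λ d → ⟦ p d ⟧) → First a l t p
first a (suc l) t p le with p a in eq
... | true  = a , l , ≤-refl , refl , eq , ≤-pred le
... | false with first (suc a) l t p le
...   | d , j , a≤ , q , r , s = d , j , <⇒≤ a≤ , trans q (sym (+-suc a l)) , r , s

weight-0 : ∀ c b → 0 < b → weight 0 c b ≡ b ! * c !
weight-0 c (suc b) _ = form (c !) (b !) (suc b)
  where
  form : ∀ f g x → f * (g * x) ≡ x * g * f
  form = solve-∀

-- The case `r = 0` of `weight-min`: the product `d ! * e !` is smallest in the middle.
central-binomial-max : ∀ h c d e → 0 < h → h ≤ c → c ≤ suc h → 0 < d → d + e ≡ h + c → (h + c) C d ≤ (h + c) C h
central-binomial-max h c d e 0<h h≤c c≤ 0<d eq = *-cancelʳ-≤ _ _ (h ! * c !) {{h !* c !≢0}} (begin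
  ((h + c) C d) * (h ! * c !)      ≤⟨ *-monoʳ-≤ ((h + c) C d) small ⟩
  ((h + c) C d) * (d ! * e !)      ≡⟨ cong (λ k → (k C d) * (d ! * e !)) (sym eq) ⟩
  ((d + e) C d) * (d ! * e !)      ≡⟨ nCk*k!*c! d e ⟩
  (d + e) !  ≡⟨ cong _! eq ⟩
  (h + c) !  ≡⟨ sym (nCk*k!*c! h c) ⟩
  ((h + c) C h) * (h ! * c !) ∎)
  where
  open ≤-Reasoning
  small : h ! * c ! ≤ d ! * e !
  small = subst₂ _≤_ (weight-0 c h 0<h) (weight-0 e d 0<d) (weight-min 0 h c d e 0<h h≤c c≤ 0<d z≤n eq)

-- The cycle method in odd dimension

NoThreeChain : ∀ {n} → Family n → Set
NoThreeChain 𝓖 = ∀ A B C → 𝓖 A ≡ true → 𝓖 B ≡ true → 𝓖 C ≡ true → A ⊂ᵇ B ≡ true → B ⊂ᵇ C ≡ true → Falsum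

Antichain : ∀ {n} → Family n → Set
Antichain 𝓖 = ∀ A B → 𝓖 A ≡ true → 𝓖 B ≡ true → A ⊂ᵇ B ≡ true → Falsum

Inner : ∀ {n} → Family n → Set
Inner 𝓖 = ∀ A → 𝓖 A ≡ true → 0 < card A × 0 < co A

module Cycle (m : ℕ) (𝓖 : Family (suc m)) (sc : SelfComplementary 𝓖) (π : Perm (suc m)) where

  n = suc m

  e : ℕ → ℕ → Bool
  e i d = 𝓖 (act π (arc m i d))

  -- A row collects the arcs with a common start, which form a chain; a column collects the
  -- rotations of one arc. Order conditions on 𝓖 bound rows, complements act on columns.
  row column : ℕ → ℕ
  row i    = ∑ (range 1 m) (λ d → ⟦ e i d ⟧)
  column d = ∑ (range 0 n) (λ i → ⟦ e i d ⟧)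

  e-periodic : ∀ i d → e (n + i) d ≡ e i d
  e-periodic i d = cong (λ I → 𝓖 (act π I)) (arc-periodic m i d)

  e-∁ : ∀ i c d → c + d ≡ n → e (c + i) c ≡ e i d
  e-∁ i c d c+d = trans (cong (λ I → 𝓖 (act π I)) (arc-∁ m i c d c+d))
    (trans (cong 𝓖 (act-∁ π (arc m i d))) (sc _))

  column-∁ : ∀ c d → c + d ≡ n → column c ≡ column d
  column-∁ c d c+d = trans (sym (∑-rotate n (λ i → ⟦ e i c ⟧) (λ i → cong ⟦_⟧ (e-periodic i c)) c))
    (∑-cong (range 0 n) (λ i → cong ⟦_⟧ (e-∁ i c d c+d)))

  rows≡columns : ∑ (range 0 n) row ≡ ∑ (range 1 m) column
  rows≡columns = ∑-swap (range 0 n) (range 1 m) (λ i d → ⟦ e i d ⟧)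

  weighted : ∑ (range 0 n) (λ i → ∑ (range 1 m) (λ d → (n C d) * ⟦ e i d ⟧)) ≡ ∑ (range 1 m) (λ d → (n C d) * column d)
  weighted = trans (∑-swap (range 0 n) (range 1 m) _) (∑-cong (range 1 m) (λ d → ∑-*ˡ (range 0 n) (n C d) _))

  row-antichain : Antichain 𝓖 → ∀ i → row i ≤ 1
  row-antichain ac i = ≮⇒≥ λ lt → contra (first 1 m 1 (e i) lt)
    where
    contra : First 1 m 1 (e i) → Falsum
    contra (d , j , _ , q , p , le) with first (suc d) j 0 (e i) le
    ... | d′ , j′ , d<d′ , q′ , p′ , _ = ac _ _ p p′ (act-⊂ᵇ π _ _ (arc-⊂ᵇ m i d<d′ d′≤))
      where
      d′≤ : d′ ≤ n
      d′≤ = ≤-trans (m≤m+n d′ (suc j′)) (≤-reflexive (trans q′ (trans (sym (+-suc d j)) q)))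

  row-noThreeChain : NoThreeChain 𝓖 → ∀ i → row i ≤ 2
  row-noThreeChain nc i = ≮⇒≥ λ lt → contra (first 1 m 2 (e i) lt)
    where
    contra : First 1 m 2 (e i) → Falsum
    contra (d , j , _ , q , p , le) with first (suc d) j 1 (e i) le
    ... | d′ , j′ , d<d′ , q′ , p′ , le′ with first (suc d′) j′ 0 (e i) le′
    ... | d″ , j″ , d′<d″ , q″ , p″ , _ = nc _ _ _ p p′ p″
          (act-⊂ᵇ π _ _ (arc-⊂ᵇ m i d<d′ (≤-trans (<⇒≤ d′<d″) d″≤))) (act-⊂ᵇ π _ _ (arc-⊂ᵇ m i d′<d″ d″≤))
      where
      d″≤ : d″ ≤ n
      d″≤ = ≤-trans (m≤m+n d″ (suc j″)) (≤-reflexive (trans q″ (trans (sym (+-suc d′ j′)) (trans q′ (trans (sym (+-suc d j)) q)))))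

  rows≤ : ∀ b → (∀ i → row i ≤ b) → ∑ (range 0 n) row ≤ n * b
  rows≤ b le = ≤-trans (∑-mono (range 0 n) le)
    (≤-reflexive (trans (∑-const (range 0 n) b) (cong (_* b) (length-range 0 n))))

module OddCycle (k : ℕ) (0<k : 0 < k) (𝓖 : Family (suc (k + k))) (sc : SelfComplementary 𝓖)
                (π : Perm (suc (k + k))) where
  open Cycle (k + k) 𝓖 sc π

  -- The cycle has odd length, so no length is its own complement and the lengths 1 to `k` are
  -- matched with the lengths `k + 1` to `2k`.
  columns-even : ∑ (range 1 (k + k)) column ≡ 2 * ∑ (range 1 k) column
  columns-even = trans (∑-range-++ 1 k k column)
    (trans (cong (∑ (range 1 k) column +_) (sym (∑-reflect 1 (suc k) k column
              (λ c d q → column-∁ c d (cong (_∸ 1) q)))))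
           (cong (∑ (range 1 k) column +_) (sym (+-identityʳ _))))

  weighted≤ : ∑ (range 0 n) (λ i → ∑ (range 1 (k + k)) (λ d → (n C d) * ⟦ e i d ⟧)) ≤ (n C k) * ∑ (range 0 n) row
  weighted≤ = begin
    ∑ (range 0 n) (λ i → ∑ (range 1 (k + k)) (λ d → (n C d) * ⟦ e i d ⟧))   ≡⟨ weighted ⟩
    ∑ (range 1 (k + k)) (λ d → (n C d) * column d)
      ≤⟨ ∑-range-mono 1 (k + k) (λ d 1≤d d< → *-monoˡ-≤ (column d) (C≤ d 1≤d d<)) ⟩
    ∑ (range 1 (k + k)) (λ d → (n C k) * column d)   ≡⟨ ∑-*ˡ (range 1 (k + k)) (n C k) column ⟩
    (n C k) * ∑ (range 1 (k + k)) column             ≡⟨ cong ((n C k) *_) (sym rows≡columns) ⟩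
    (n C k) * ∑ (range 0 n) row ∎
    where
    open ≤-Reasoning
    C≤ : ∀ d → 1 ≤ d → d < n → n C d ≤ n C k
    C≤ d 1≤d d<n = subst (λ x → x C d ≤ x C k) (+-suc k k)
      (central-binomial-max k (suc k) d (n ∸ d) 0<k (n≤1+n k) ≤-refl 1≤d
        (trans (m+[n∸m]≡n (<⇒≤ d<n)) (sym (+-suc k k))))

  -- One arc per start allows `2k + 1` arcs, but their number is even by `columns-even`.
  antichain-rows : Antichain 𝓖 → ∑ (range 0 n) row ≤ k + k
  antichain-rows ac with ∑ (range 1 k) column ≤? k
  ... | yes le = ≤-trans (≤-reflexive (trans rows≡columns columns-even))
                   (≤-trans (*-monoʳ-≤ 2 le) (≤-reflexive (cong (k +_) (+-identityʳ k))))
  ... | no ≰k = absurd (<-irrefl refl (begin-strict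
    suc (k + k)  <⟨ n<1+n _ ⟩
    suc (suc (k + k))  ≡⟨ form k ⟩
    2 * suc k  ≤⟨ *-monoʳ-≤ 2 (≰⇒> ≰k) ⟩
    2 * ∑ (range 1 k) column         ≡⟨ sym (trans rows≡columns columns-even) ⟩
    ∑ (range 0 n) row  ≤⟨ rows≤ 1 (row-antichain ac) ⟩
    n * 1  ≡⟨ *-identityʳ n ⟩
    suc (k + k) ∎))
    where
    open ≤-Reasoning
    form : ∀ k → 2 + (k + k) ≡ 2 * (1 + k)
    form = solve-∀

-- The absorption identity. It converts the loss of one arc per cycle, the factor `2 * suc k` over
-- `suc (suc k + suc k)`, into the binomial coefficient of the extremal family.
binomial-odd : ∀ k → suc k * ((suc (suc k + suc k)) C suc k) ≡ suc (suc k + suc k) * ((suc k + suc k) C k)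
binomial-odd k = *-cancelʳ-≡ _ _ (k ! * (2 + k) !) {{k !* (2 + k) !≢0}} (begin
  suc k * ((suc (suc k + suc k)) C suc k) * (k ! * (2 + k) !)     ≡⟨ form (suc k) ((suc (suc k + suc k)) C suc k) (k !) ((2 + k) !) ⟩
  ((suc (suc k + suc k)) C suc k) * (suc k ! * (2 + k) !)         ≡⟨ cong (λ x → (x C suc k) * (suc k ! * (2 + k) !)) (sym (+-suc (suc k) (suc k))) ⟩
  ((suc k + (2 + k)) C suc k) * (suc k ! * (2 + k) !)             ≡⟨ nCk*k!*c! (suc k) (2 + k) ⟩
  (suc k + (2 + k)) !  ≡⟨ cong _! (+-suc (suc k) (suc k)) ⟩
  suc (suc k + suc k) * (suc k + suc k) !  ≡⟨ cong (λ x → suc (suc k + suc k) * x !) (sym (+-suc k (suc k))) ⟩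
  suc (suc k + suc k) * (k + (2 + k)) !  ≡⟨ cong (suc (suc k + suc k) *_) (sym (nCk*k!*c! k (2 + k))) ⟩
  suc (suc k + suc k) * (((k + (2 + k)) C k) * (k ! * (2 + k) !)) ≡⟨ cong (λ x → suc (suc k + suc k) * ((x C k) * (k ! * (2 + k) !))) (+-suc k (suc k)) ⟩
  suc (suc k + suc k) * (((suc k + suc k) C k) * (k ! * (2 + k) !)) ≡⟨ sym (*-assoc (suc (suc k + suc k)) ((suc k + suc k) C k) (k ! * (2 + k) !)) ⟩
  suc (suc k + suc k) * ((suc k + suc k) C k) * (k ! * (2 + k) !) ∎)
  where
  open ≡-Reasoning
  form : ∀ a x f g → a * x * (f * g) ≡ x * ((a * f) * g)
  form = solve-∀

-- On each cycle the arcs of 𝓖 starting at a given point number at most one, and they come in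
-- complementary pairs while the cycle has odd length.
odd-antichain : ∀ k (𝓖 : Family (suc (suc k + suc k))) → SelfComplementary 𝓖 → Inner 𝓖 → Antichain 𝓖 →
                size 𝓖 ≤ 2 * ((suc k + suc k) C k)
odd-antichain k′ 𝓖 sc inn ac = *-cancelˡ-≤ n (begin
  n * size 𝓖             ≤⟨ average (k + k) 𝓖 (arc (k + k)) ((n C k) * (k + k)) (card-arc (k + k)) inn
                              (λ π → ≤-trans (OddCycle.weighted≤ k (s≤s z≤n) 𝓖 sc π)
                                       (*-monoʳ-≤ (n C k) (OddCycle.antichain-rows k (s≤s z≤n) 𝓖 sc π ac))) ⟩
  (n C k) * (k + k)      ≡⟨ form₁ (n C k) k ⟩
  2 * (k * (n C k))      ≡⟨ cong (2 *_) (binomial-odd k′) ⟩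
  2 * (n * ((k + k) C k′)) ≡⟨ form₂ n ((k + k) C k′) ⟩
  n * (2 * ((k + k) C k′)) ∎)
  where
  open ≤-Reasoning
  k = suc k′
  n = suc (k + k)
  form₁ : ∀ c k → c * (k + k) ≡ 2 * (k * c)
  form₁ = solve-∀
  form₂ : ∀ a b → 2 * (a * b) ≡ a * (2 * b)
  form₂ = solve-∀

-- In odd dimension the two middle levels are complements of each other and equally large, so two
-- arcs per start, each weighted by at most the middle binomial, already give the exact bound.
odd-noThreeChain : ∀ k (𝓖 : Family (suc (k + k))) → 0 < k → SelfComplementary 𝓖 → Inner 𝓖 → NoThreeChain 𝓖 →
                   size 𝓖 ≤ 2 * (suc (k + k) C k)
odd-noThreeChain k 𝓖 0<k sc inn nc = *-cancelˡ-≤ n (begin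
  n * size 𝓖             ≤⟨ average (k + k) 𝓖 (arc (k + k)) ((n C k) * (n * 2)) (card-arc (k + k)) inn
                              (λ π → ≤-trans (OddCycle.weighted≤ k 0<k 𝓖 sc π)
                                       (*-monoʳ-≤ (n C k) (Cycle.rows≤ (k + k) 𝓖 sc π 2 (Cycle.row-noThreeChain (k + k) 𝓖 sc π nc)))) ⟩
  (n C k) * (n * 2)      ≡⟨ form n (n C k) ⟩
  n * (2 * (n C k)) ∎)
  where
  open ≤-Reasoning
  n = suc (k + k)
  form : ∀ n c → c * (n * 2) ≡ n * (2 * c)
  form = solve-∀

-- The cycle method in even dimension

∑-range-shift : ∀ a m (g : ℕ → ℕ) → ∑ (range a m) g ≡ ∑ (range 0 m) (λ i → g (a + i))
∑-range-shift zero    m g = refl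
∑-range-shift (suc a) m g = trans (∑-range-suc a m g) (∑-range-shift a m (g ∘ suc))

C-symmetric : ∀ c d → (c + d) C c ≡ (c + d) C d
C-symmetric c d = trans (nCk≡nC[n∸k] (m≤m+n c d)) (cong ((c + d) C_) (m+n∸m≡n c d))

C-mono-below : ∀ d j c → 0 < d → d + j ≤ c → (d + j + c) C d ≤ (d + j + c) C (d + j)
C-mono-below d j c 0<d le = *-cancelʳ-≤ _ _ ((d + j) ! * c !) {{(d + j) !* c !≢0}} (begin
  ((d + j + c) C d) * ((d + j) ! * c !)        ≤⟨ *-monoʳ-≤ ((d + j + c) C d) small ⟩
  ((d + j + c) C d) * (d ! * (c + j) !)        ≡⟨ cong (λ x → (x C d) * (d ! * (c + j) !)) assoc ⟩
  ((d + (c + j)) C d) * (d ! * (c + j) !)      ≡⟨ nCk*k!*c! d (c + j) ⟩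
  (d + (c + j)) !  ≡⟨ cong _! (sym assoc) ⟩
  (d + j + c) !  ≡⟨ sym (nCk*k!*c! (d + j) c) ⟩
  ((d + j + c) C (d + j)) * ((d + j) ! * c !) ∎)
  where
  open ≤-Reasoning
  assoc : d + j + c ≡ d + (c + j)
  assoc = trans (+-assoc d j c) (cong (d +_) (+-comm j c))
  small : (d + j) ! * c ! ≤ d ! * (c + j) !
  small = subst₂ _≤_ (weight-0 c (d + j) (≤-trans 0<d (m≤m+n d j))) (weight-0 (c + j) d 0<d)
            (weight-down 0 c d j 0<d z≤n le)

-- The ratio of the middle level to its neighbour. It measures by how much half-cycles outweigh all
-- other arcs.
binomial-even : ∀ k → suc k * ((suc k + suc k) C suc k) ≡ (2 + k) * ((suc k + suc k) C k)
binomial-even k = *-cancelʳ-≡ _ _ (k ! * suc k !) {{k !* suc k !≢0}} (begin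
  suc k * ((suc k + suc k) C suc k) * (k ! * suc k !)        ≡⟨ form₁ (suc k) ((suc k + suc k) C suc k) (k !) (suc k !) ⟩
  ((suc k + suc k) C suc k) * (suc k ! * suc k !)            ≡⟨ nCk*k!*c! (suc k) (suc k) ⟩
  (suc k + suc k) !  ≡⟨ cong _! (sym (+-suc k (suc k))) ⟩
  (k + (2 + k)) !  ≡⟨ sym (nCk*k!*c! k (2 + k)) ⟩
  ((k + (2 + k)) C k) * (k ! * (2 + k) !)  ≡⟨ cong (λ x → (x C k) * (k ! * (2 + k) !)) (+-suc k (suc k)) ⟩
  ((suc k + suc k) C k) * (k ! * (2 + k) !)  ≡⟨ form₂ ((suc k + suc k) C k) (k !) (2 + k) (suc k !) ⟩
  (2 + k) * ((suc k + suc k) C k) * (k ! * suc k !) ∎)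
  where
  open ≡-Reasoning
  form₁ : ∀ a x f g → a * x * (f * g) ≡ x * ((a * f) * g)
  form₁ = solve-∀
  form₂ : ∀ x f b g → x * (f * (b * g)) ≡ b * x * (f * g)
  form₂ = solve-∀

module EvenCycle (k′ : ℕ) (𝓖 : Family (suc k′ + suc k′)) (sc : SelfComplementary 𝓖)
                 (nc : NoThreeChain 𝓖) (π : Perm (suc k′ + suc k′)) where
  m = k′ + suc k′
  k = suc k′
  open Cycle m 𝓖 sc π
  open ≤-Reasoning

  -- `c` is the largest coefficient of an arc that is not a half-cycle. `S` counts the members
  -- shorter than a half-cycle, and `ν` the half-cycles up to complement.
  c = n C k′
  S = ∑ (range 1 k′) column
  ν = ∑ (range 0 k) (λ i → ⟦ e i k ⟧)

  two-halves : ∀ r → (∀ x y → x + y ≡ n → r x ≡ r y) → ∑ (range 1 m) r ≡ 2 * ∑ (range 1 k′) r + r k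
  two-halves r sym-r = begin-equality
    ∑ (range 1 m) r  ≡⟨ ∑-range-++ 1 k′ (suc k′) r ⟩
    ∑ (range 1 k′) r + (r k + ∑ (range (suc k) k′) r)
      ≡⟨ cong (λ z → ∑ (range 1 k′) r + (r k + z)) (sym (∑-reflect 1 (suc k) k′ r
           (λ x y q → sym-r x y (trans (cong (_∸ 1) q) (cong suc (sym (+-suc k′ k′))))))) ⟩
    ∑ (range 1 k′) r + (r k + ∑ (range 1 k′) r)              ≡⟨ form (∑ (range 1 k′) r) (r k) ⟩
    2 * ∑ (range 1 k′) r + r k ∎
    where
    form : ∀ s x → s + (x + s) ≡ 2 * s + x
    form = solve-∀

  column-k : column k ≡ 2 * ν
  column-k = begin-equality
    column k  ≡⟨ ∑-range-++ 0 k k (λ i → ⟦ e i k ⟧) ⟩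
    ν + ∑ (range k k) (λ i → ⟦ e i k ⟧)  ≡⟨ cong (ν +_) (∑-range-shift k k (λ i → ⟦ e i k ⟧)) ⟩
    ν + ∑ (range 0 k) (λ i → ⟦ e (k + i) k ⟧)  ≡⟨ cong (ν +_) (∑-cong (range 0 k) (λ i → cong ⟦_⟧ (e-∁ i k k refl))) ⟩
    ν + ν  ≡⟨ cong (ν +_) (sym (+-identityʳ ν)) ⟩
    2 * ν ∎

  rows-even : ∑ (range 0 n) row ≡ 2 * (S + ν)
  rows-even = begin-equality
    ∑ (range 0 n) row        ≡⟨ rows≡columns ⟩
    ∑ (range 1 m) column     ≡⟨ two-halves column column-∁ ⟩
    2 * S + column k         ≡⟨ cong (2 * S +_) column-k ⟩
    2 * S + 2 * ν            ≡⟨ sym (*-distribˡ-+ 2 S ν) ⟩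
    2 * (S + ν) ∎

  -- A half-cycle has coefficient `(k + 1) / k` times `c`, all other arcs at most `c`. After scaling
  -- by `k` the `2 * ν` half-cycles therefore cost one additional `c` each.
  weighted-scaled : k * ∑ (range 1 m) (λ d → (n C d) * column d) ≤ c * (2 * k * (S + ν) + 2 * ν)
  weighted-scaled = begin
    k * ∑ (range 1 m) (λ d → (n C d) * column d)
      ≡⟨ cong (k *_) (two-halves (λ d → (n C d) * column d) symmetric) ⟩
    k * (2 * ∑ (range 1 k′) (λ d → (n C d) * column d) + (n C k) * column k)
      ≤⟨ *-monoʳ-≤ k (+-monoˡ-≤ ((n C k) * column k) (*-monoʳ-≤ 2 (∑-range-mono 1 k′ (λ d 1≤d d< → *-monoˡ-≤ (column d) (C≤c d 1≤d (≤-pred d<)))))) ⟩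
    k * (2 * ∑ (range 1 k′) (λ d → c * column d) + (n C k) * column k)
      ≡⟨ cong₂ (λ x y → k * (2 * x + (n C k) * y)) (∑-*ˡ (range 1 k′) c column) column-k ⟩
    k * (2 * (c * S) + (n C k) * (2 * ν))
      ≡⟨ form₁ k (c * S) (n C k) ν ⟩
    2 * k * (c * S) + k * (n C k) * (2 * ν)
      ≡⟨ cong (λ x → 2 * k * (c * S) + x * (2 * ν)) (binomial-even k′) ⟩
    2 * k * (c * S) + (1 + k) * c * (2 * ν)
      ≡⟨ form₂ k c S ν ⟩
    c * (2 * k * (S + ν) + 2 * ν) ∎
    where
    form₁ : ∀ k x y v → k * (2 * x + y * (2 * v)) ≡ 2 * k * x + k * y * (2 * v)
    form₁ = solve-∀
    form₂ : ∀ k c s v → 2 * k * (c * s) + (1 + k) * c * (2 * v) ≡ c * (2 * k * (s + v) + 2 * v)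
    form₂ = solve-∀
    symmetric : ∀ x y → x + y ≡ n → (n C x) * column x ≡ (n C y) * column y
    symmetric x y eq = cong₂ _*_ (subst (λ z → z C x ≡ z C y) eq (C-symmetric x y)) (column-∁ x y eq)
    C≤c : ∀ d → 1 ≤ d → d ≤ k′ → n C d ≤ c
    C≤c d 1≤d d≤ with m≤n⇒∃[o]m+o≡n d≤
    ... | j , refl = subst (λ x → x C d ≤ x C (d + j)) (+-suc (d + j) (suc (d + j)))
          (C-mono-below d j (2 + (d + j)) 1≤d (≤-trans (n≤1+n _) (n≤1+n _)))

  module Full (full : ∑ (range 0 n) row ≡ n * 2) where

    row≡2 : ∀ j → row j ≡ 2
    row≡2 j = subst (λ i → row i ≡ 2) (+-identityʳ j) (≤-antisym (row-noThreeChain nc (j + 0))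
      (+-cancelʳ-≤ (m * 2) 2 (row (j + 0)) (begin
        n * 2  ≡⟨ sym full ⟩
        ∑ (range 0 n) row  ≡⟨ sym (∑-rotate n row row-periodic j) ⟩
        row (j + 0) + ∑ (range 1 m) (λ i → row (j + i))    ≤⟨ +-monoʳ-≤ (row (j + 0)) (∑-mono (range 1 m) (λ i → row-noThreeChain nc (j + i))) ⟩
        row (j + 0) + ∑ (range 1 m) (λ _ → 2)              ≡⟨ cong (row (j + 0) +_) (trans (∑-const (range 1 m) 2) (cong (_* 2) (length-range 1 m))) ⟩
        row (j + 0) + m * 2 ∎)))
      where
      row-periodic : ∀ i → row (n + i) ≡ row i
      row-periodic i = ∑-cong (range 1 m) (λ d → cong ⟦_⟧ (e-periodic i d))

    short : ℕ → ℕ → ℕ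
    short i d = ∑ (range 1 d) (λ x → ⟦ e i x ⟧)

    short+long : ∀ i d j → d + j ≡ m → short i d + ∑ (range (suc d) j) (λ x → ⟦ e i x ⟧) ≡ 2
    short+long i d j eq = begin-equality
      short i d + ∑ (range (suc d) j) (λ x → ⟦ e i x ⟧)    ≡⟨ sym (∑-range-++ 1 d j (λ x → ⟦ e i x ⟧)) ⟩
      ∑ (range 1 (d + j)) (λ x → ⟦ e i x ⟧)  ≡⟨ cong (λ l → ∑ (range 1 l) (λ x → ⟦ e i x ⟧)) eq ⟩
      row i  ≡⟨ row≡2 i ⟩
      2 ∎

    -- Every row has exactly two arcs. If the count of arcs up to length `d` dropped from `i` to
    -- `suc i`, then one short arc at `i` with two long ones at `suc i`, or two short with one long,
    -- would form a chain of three, as `arc-suc-⊂ᵇ` lets a chain pass from `i` to `suc i`.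
    short-mono : ∀ i d → d ≤ m → short i d ≤ short (suc i) d
    short-mono i d d≤ with m≤n⇒∃[o]m+o≡n d≤
    ... | j , d+j = ≮⇒≥ (λ lt → case lt (short (suc i) d) refl)
      where
      long : ℕ → ℕ
      long i = ∑ (range (suc d) j) (λ x → ⟦ e i x ⟧)
      in-range : ∀ {x y} → x + suc y ≡ suc d + j → x ≤ n
      in-range {x} {y} q = ≤-trans (m≤m+n x (suc y)) (≤-reflexive (trans q (cong suc d+j)))
      ends : ∀ {d′ y} → d′ + suc y ≡ 1 + d → d′ < suc d
      ends {d′} {y} q = ≤-trans (m<m+n d′ (s≤s z≤n)) (≤-reflexive q)
      short-long-long : First 1 d 0 (e i) → First (suc d) j 1 (e (suc i)) → Falsum
      short-long-long (d₁ , y , _ , q , p , _) (d₂ , j₂ , d<d₂ , q₂ , p₂ , le) = last (first (suc d₂) j₂ 0 (e (suc i)) le)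
        where
        last : First (suc d₂) j₂ 0 (e (suc i)) → Falsum
        last (d₃ , j₃ , d₂<d₃ , q₃ , p₃ , _) = nc _ _ _ p p₂ p₃
          (act-⊂ᵇ π _ _ (arc-suc-⊂ᵇ m i (≤-trans (ends {y = y} q) d<d₂) (in-range q₂)))
          (act-⊂ᵇ π _ _ (arc-⊂ᵇ m (suc i) d₂<d₃ (in-range (trans q₃ (trans (sym (+-suc d₂ j₂)) q₂)))))
      short-short-long : First 1 d 1 (e i) → First (suc d) j 0 (e (suc i)) → Falsum
      short-short-long (d₁ , y , _ , q , p , le) (d₃ , j₃ , d<d₃ , q₃ , p₃ , _) = middle (first (suc d₁) y 0 (e i) le)
        where
        middle : First (suc d₁) y 0 (e i) → Falsum
        middle (d₂ , y₂ , d₁<d₂ , q₂ , p₂ , _) = nc _ _ _ p p₂ p₃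
          (act-⊂ᵇ π _ _ (arc-⊂ᵇ m i d₁<d₂ (≤-trans (<⇒≤ (≤-trans d₂< d<d₃)) (in-range q₃))))
          (act-⊂ᵇ π _ _ (arc-suc-⊂ᵇ m i (≤-trans d₂< d<d₃) (in-range q₃)))
          where
          d₂< : d₂ < suc d
          d₂< = ends {y = y₂} (trans q₂ (trans (sym (+-suc d₁ y)) q))
      case : short (suc i) d < short i d → ∀ s → short (suc i) d ≡ s → Falsum
      case lt 0 eq = short-long-long (first 1 d 0 (e i) (≤-trans (s≤s z≤n) lt))
        (first (suc d) j 1 (e (suc i)) (≤-reflexive (trans (sym (short+long (suc i) d j d+j)) (cong (_+ long (suc i)) eq))))
      case lt 1 eq = short-short-long (first 1 d 1 (e i) (subst (λ s → suc s ≤ short i d) eq lt))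
        (first (suc d) j 0 (e (suc i)) (≤-pred (≤-reflexive (trans (sym (short+long (suc i) d j d+j)) (cong (_+ long (suc i)) eq)))))
      case lt (suc (suc s)) eq = <-irrefl refl (≤-trans (s≤s (≤-trans (s≤s (s≤s z≤n)) (≤-reflexive (sym eq))))
        (≤-trans lt (≤-trans (m≤m+n (short i d) (long i)) (≤-reflexive (short+long i d j d+j)))))

    -- A quantity that never drops along a cycle and returns to its initial value is constant.
    short-constant : ∀ i d → d ≤ m → short i d ≡ short 0 d
    short-constant i d d≤ = ≤-antisym
      (≤-trans (climb (i * m) i) (≤-reflexive (trans (cong (λ x → short x d) (trans (+-comm (i * m) i) (sym (*-suc i m)))) (around i))))
      (≤-trans (climb i 0) (≤-reflexive (cong (λ x → short x d) (+-identityʳ i))))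
      where
      climb : ∀ j i → short i d ≤ short (j + i) d
      climb zero    i = ≤-refl
      climb (suc j) i = ≤-trans (climb j i) (short-mono (j + i) d d≤)
      around : ∀ q → short (q * n) d ≡ short 0 d
      around zero    = refl
      around (suc q) = trans (∑-cong (range 1 d) (λ x → cong ⟦_⟧ (e-periodic (q * n) x))) (around q)

    -- Consecutive values of `short` differ by the indicator of a single arc, so their constancy
    -- along the cycle passes to every length separately.
    column-constant : ∀ d → 1 ≤ d → d < n → column d ≡ n * ⟦ e 0 d ⟧
    column-constant (suc d) _ d< = trans (∑-cong (range 0 n) constant)
      (trans (∑-const (range 0 n) ⟦ e 0 (suc d) ⟧) (cong (_* ⟦ e 0 (suc d) ⟧) (length-range 0 n)))
      where
      constant : ∀ i → ⟦ e i (suc d) ⟧ ≡ ⟦ e 0 (suc d) ⟧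
      constant i = +-cancelˡ-≡ (short 0 d) _ _ (begin-equality
        short 0 d + ⟦ e i (suc d) ⟧       ≡⟨ cong (_+ ⟦ e i (suc d) ⟧) (sym (short-constant i d (≤-trans (n≤1+n d) (≤-pred d<)))) ⟩
        short i d + ⟦ e i (suc d) ⟧       ≡⟨ sym (∑-range-last 1 d (λ x → ⟦ e i x ⟧)) ⟩
        short i (suc d)  ≡⟨ short-constant i (suc d) (≤-pred d<) ⟩
        short 0 (suc d)  ≡⟨ ∑-range-last 1 d (λ x → ⟦ e 0 x ⟧) ⟩
        short 0 d + ⟦ e 0 (suc d) ⟧ ∎)

    -- Each length is now present at all starts or at none. The two lengths in use come from
    -- complementary pairs plus possibly the half length, and a single half length would make their
    -- number odd.
    no-diameters : ν ≡ 0
    no-diameters = *-cancelˡ-≡ ν 0 2 (trans (sym column-k) (trans col-k (trans (cong (n *_) (even x ⟦ e 0 k ⟧ (⟦⟧≤1 (e 0 k)) parity)) (*-zeroʳ n))))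
      where
      x = ∑ (range 1 k′) (λ d → ⟦ e 0 d ⟧)
      k<n : k < n
      k<n = s≤s (m≤n+m (suc k′) k′)
      col-k : column k ≡ n * ⟦ e 0 k ⟧
      col-k = column-constant k (s≤s z≤n) k<n
      even : ∀ x b → b ≤ 1 → 2 * x + b ≡ 2 → b ≡ 0
      even x zero _ _ = refl
      even zero (suc zero) _ ()
      even (suc x) (suc zero) _ eq rewrite +-suc x (x + 0) with suc-injective (suc-injective eq)
      ... | q = absurd (1+n≢0 (trans (+-comm 1 _) q))
      even x (suc (suc b)) (s≤s ()) _
      parity : 2 * x + ⟦ e 0 k ⟧ ≡ 2
      parity = *-cancelˡ-≡ _ _ n (begin-equality
        n * (2 * x + ⟦ e 0 k ⟧)  ≡⟨ form n x ⟦ e 0 k ⟧ ⟩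
        2 * (n * x) + n * ⟦ e 0 k ⟧             ≡⟨ cong₂ (λ a b → 2 * a + b) (sym (∑-*ˡ (range 1 k′) n (λ d → ⟦ e 0 d ⟧))) (sym col-k) ⟩
        2 * ∑ (range 1 k′) (λ d → n * ⟦ e 0 d ⟧) + column k
          ≡⟨ cong (λ a → 2 * a + column k) (∑-range-cong 1 k′ (λ d 1≤d d< → sym (column-constant d 1≤d (<-trans d< k<n)))) ⟩
        2 * S + column k  ≡⟨ sym (two-halves column column-∁) ⟩
        ∑ (range 1 m) column  ≡⟨ sym rows≡columns ⟩
        ∑ (range 0 n) row  ≡⟨ full ⟩
        n * 2 ∎)
        where
        form : ∀ n x b → n * (2 * x + b) ≡ 2 * (n * x) + n * b
        form = solve-∀

  -- A cycle below the maximum lacks at least one complementary pair, worth `2 * k` after scaling,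
  -- and this pays for the excess `2 * ν` because `ν ≤ k`. A cycle at the maximum has no half-cycles
  -- and hence no excess.
  factor≤ : 2 * k * (S + ν) + 2 * ν ≤ k * (2 * n)
  factor≤ with suc (S + ν) ≤? n
  ... | yes lt = begin
    2 * k * (S + ν) + 2 * ν          ≤⟨ +-monoʳ-≤ (2 * k * (S + ν)) (*-monoʳ-≤ 2 ν≤k) ⟩
    2 * k * (S + ν) + 2 * k          ≡⟨ form k (S + ν) ⟩
    k * (2 * suc (S + ν))            ≤⟨ *-monoʳ-≤ k (*-monoʳ-≤ 2 lt) ⟩
    k * (2 * n) ∎
    where
    form : ∀ k s → 2 * k * s + 2 * k ≡ k * (2 * (1 + s))
    form = solve-∀
    ν≤k : ν ≤ k
    ν≤k = ≤-trans (∑-mono (range 0 k) (λ i → ⟦⟧≤1 (e i k)))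
      (≤-reflexive (trans (∑-const (range 0 k) 1) (trans (*-identityʳ _) (length-range 0 k))))
  ... | no ≰n = begin
    2 * k * (S + ν) + 2 * ν          ≡⟨ cong (λ v → 2 * k * (S + ν) + 2 * v) (Full.no-diameters full) ⟩
    2 * k * (S + ν) + 0              ≡⟨ form k (S + ν) ⟩
    k * (2 * (S + ν))  ≡⟨ cong (k *_) (trans (sym rows-even) (trans full (*-comm n 2))) ⟩
    k * (2 * n) ∎
    where
    form : ∀ k s → 2 * k * s + 0 ≡ k * (2 * s)
    form = solve-∀
    full : ∑ (range 0 n) row ≡ n * 2
    full = ≤-antisym (rows≤ 2 (row-noThreeChain nc))
      (≤-trans (≤-reflexive (*-comm n 2)) (≤-trans (*-monoʳ-≤ 2 (≤-pred (≰⇒> ≰n))) (≤-reflexive (sym rows-even))))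

  weighted≤ : ∑ (range 0 n) (λ i → ∑ (range 1 m) (λ d → (n C d) * ⟦ e i d ⟧)) ≤ c * (2 * n)
  weighted≤ = *-cancelˡ-≤ k (begin
    k * ∑ (range 0 n) (λ i → ∑ (range 1 m) (λ d → (n C d) * ⟦ e i d ⟧))   ≡⟨ cong (k *_) weighted ⟩
    k * ∑ (range 1 m) (λ d → (n C d) * column d)  ≤⟨ weighted-scaled ⟩
    c * (2 * k * (S + ν) + 2 * ν)  ≤⟨ *-monoʳ-≤ c factor≤ ⟩
    c * (k * (2 * n))  ≡⟨ form c k (2 * n) ⟩
    k * (c * (2 * n)) ∎)
    where
    form : ∀ c k x → c * (k * x) ≡ k * (c * x)
    form = solve-∀

-- On each cycle at most two arcs of 𝓖 start at a given point.  If this is always attained, both lengths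
-- are constant along the cycle and add up to the length of the cycle, so that no arc is a half-cycle.
even-noThreeChain : ∀ k (𝓖 : Family (suc k + suc k)) → SelfComplementary 𝓖 → Inner 𝓖 → NoThreeChain 𝓖 →
                    size 𝓖 ≤ 2 * ((suc k + suc k) C k)
even-noThreeChain k 𝓖 sc inn nc = *-cancelˡ-≤ n (begin
  n * size 𝓖             ≤⟨ average (k + suc k) 𝓖 (arc (k + suc k)) ((n C k) * (2 * n)) (card-arc (k + suc k)) inn
                              (EvenCycle.weighted≤ k 𝓖 sc nc) ⟩
  (n C k) * (2 * n)      ≡⟨ form n (n C k) ⟩
  n * (2 * (n C k)) ∎)
  where
  open ≤-Reasoning
  n = suc k + suc k
  form : ∀ n c → c * (2 * n) ≡ n * (2 * c)
  form = solve-∀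

-- Extremal systems

-- The separating-set form of the hypothesis, the counterpart of `NoSplit` for constructions. It
-- yields a system by taking `A` to be the union of `Fs`.
Crossing : ∀ {n} → ℕ → ℕ → Family n → Set
Crossing {n} s t P = (Fs : Vec (Subset n) s) (Gs : Vec (Subset n) t) →
  All (λ A → P A ≡ true) (Fs ++ᵥ Gs) → Unique (Fs ++ᵥ Gs) →
  ∀ A → All (λ F → F ⊆ᵇ A ≡ true) Fs → All (λ G → G ⊆ᵇ ∁ A ≡ true) Gs → Falsum

⊆⋃ : ∀ {n k} (v : Vec (Subset n) k) → All (λ F → F ⊆ᵇ ⋃ (toList v) ≡ true) v
⊆⋃ []      = []
⊆⋃ (F ∷ v) = ⊆ᵇ-from {A = F} (Subₚ.p⊆p∪q {p = F} (⋃ (toList v))) ∷ All.map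
  (λ {G} p → ⊆ᵇ-from {A = G} (λ x∈ → Subₚ.q⊆p∪q F (⋃ (toList v)) (⊆ᵇ-to {A = G} p x∈))) (⊆⋃ v)

crossing⇒system : ∀ {n s t} (P : Family n) → Crossing s t P → UnionIntersectingSystem n s t (size P)
crossing⇒system {n} {s} {t} P cr with pick P (size P) ≤-refl
... | v , u , p = (v , u) , ui
  where
  ui : UnionIntersecting s t (v , u)
  ui Fs Gs mem uniq with Subₚ.nonempty? (⋃ (toList Fs) Data.Fin.Subset.∩ ⋃ (toList Gs))
  ... | yes ne = ne
  ... | no  em = absurd (cr Fs Gs (All.map (All.lookup p) mem) uniq (⋃ (toList Fs)) (⊆⋃ Fs)
    (All.map (λ {G} sub → ⊆ᵇ-from {A = G} (λ {x} x∈ → Subₚ.x∉p⇒x∈∁p (λ x∈F →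
      em (x , Subₚ.x∈p∩q⁺ (x∈F , ⊆ᵇ-to {A = G} sub x∈))))) (⊆⋃ Gs)))

size≤f : ∀ {n s t} .{{_ : NonZero s}} .{{_ : NonZero t}} (P : Family n) → Crossing s t P → size P ≤ f n s t
size≤f {n} {s} {t} P cr = proj₂ (f-isMaximumSize n s t) (size P) (crossing⇒system P cr)

-- Otherwise both sets would equal `A`. All extremal families except the star rest on this:
-- requiring two different members on one side gains one element there.
distinct-grow : ∀ {n p} (A F G : Subset n) → F ≢ G → F ⊆ᵇ A ≡ true → G ⊆ᵇ A ≡ true →
                p ≤ card F → p ≤ card G → suc p ≤ card A
distinct-grow A F G ne F⊆ G⊆ pF pG = ≰⇒> λ le →
  ne (trans (⊆∧card≥⇒≡ F A F⊆ (≤-trans le pF)) (sym (⊆∧card≥⇒≡ G A G⊆ (≤-trans le pG))))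

atLeast : ∀ n → ℕ → Family n
atLeast n a A = a ≤ᵇ card A

-- The fixed element is the head of the vector, and both thresholds refer to the size of the whole
-- set. A `q` above `n` leaves the star of the fixed element.
threshold : ∀ n → ℕ → ℕ → Family (suc n)
threshold n p q (true  ∷ A) = p ≤ᵇ suc (card A)
threshold n p q (false ∷ A) = q ≤ᵇ card A

tail : ℕ → ℕ → ℕ
tail n a = size (atLeast n a)

crowded : ∀ {n a b} (A : Subset n) → a ≤ card A → b ≤ co A → n < a + b → Falsum
crowded A a≤ b≤ lt = <-irrefl (sym (card-∁ A)) (≤-trans lt (+-mono-≤ a≤ b≤))

star-crossing : ∀ n → Crossing 1 1 (threshold n 0 (2 + n))
star-crossing n ((true ∷ F) ∷ []) ((true ∷ G) ∷ []) _ _ (true ∷ A) _ (() ∷ _)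
star-crossing n ((true ∷ F) ∷ []) ((true ∷ G) ∷ []) _ _ (false ∷ A) (() ∷ _) _
star-crossing n ((false ∷ F) ∷ []) _ (p ∷ _) _ _ _ _ = <-irrefl refl (≤-trans (≤ᵇ-to p) (≤-trans (Subₚ.∣p∣≤n F) (n≤1+n n)))
star-crossing n ((true ∷ F) ∷ []) ((false ∷ G) ∷ []) (_ ∷ p ∷ _) _ _ _ _ = <-irrefl refl (≤-trans (≤ᵇ-to p) (≤-trans (Subₚ.∣p∣≤n G) (n≤1+n n)))

crossing-1-2-even : ∀ k t → Crossing 1 (2 + t) (atLeast (k + k) k)
crossing-1-2-even k t (F ∷ []) (G ∷ G′ ∷ Gs) (pF ∷ pG ∷ pG′ ∷ _) (_ AllPairs.∷ (ne ∷ _) AllPairs.∷ _) A (F⊆ ∷ _) (G⊆ ∷ G′⊆ ∷ _) =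
  crowded A (≤-trans (≤ᵇ-to pF) (⊆⇒card≤ F A F⊆))
    (distinct-grow (∁ A) G G′ ne G⊆ G′⊆ (≤ᵇ-to pG) (≤ᵇ-to pG′)) (≤-reflexive (sym (+-suc k k)))

unique-++ʳ : ∀ {n k l} (v : Vec (Subset n) k) {w : Vec (Subset n) l} → Unique (v ++ᵥ w) → Unique w
unique-++ʳ []      u                = u
unique-++ʳ (_ ∷ v) (_ AllPairs.∷ u) = unique-++ʳ v u

crossing-2-2-odd : ∀ k s t → Crossing (2 + s) (2 + t) (atLeast (suc (k + k)) k)
crossing-2-2-odd k s t (F ∷ F′ ∷ Fs) (G ∷ G′ ∷ Gs) (pF ∷ pF′ ∷ ps) ((ne ∷ _) AllPairs.∷ _ AllPairs.∷ u) A (F⊆ ∷ F′⊆ ∷ _) (G⊆ ∷ G′⊆ ∷ _)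
  with Allₚ.++ʳ⁻ Fs ps | unique-++ʳ Fs u
... | pG ∷ pG′ ∷ _ | (ne′ ∷ _) AllPairs.∷ _ =
  crowded A (distinct-grow A F F′ ne F⊆ F′⊆ (≤ᵇ-to pF) (≤ᵇ-to pF′))
    (distinct-grow (∁ A) G G′ ne′ G⊆ G′⊆ (≤ᵇ-to pG) (≤ᵇ-to pG′)) (≤-reflexive (cong suc (sym (+-suc k k))))

threshold-min : ∀ {n p q r} (A : Subset (suc n)) → r ≤ p → r ≤ q → threshold n p q A ≡ true → r ≤ card A
threshold-min (true ∷ A)  r≤p r≤q eq = ≤-trans r≤p (≤ᵇ-to eq)
threshold-min (false ∷ A) r≤p r≤q eq = ≤-trans r≤q (≤ᵇ-to eq)

threshold-out : ∀ {n p q} (F : Subset (suc n)) (A : Subset n) → F ⊆ᵇ (false ∷ A) ≡ true → threshold n p q F ≡ true → q ≤ card F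
threshold-out (false ∷ F) A _ eq = ≤ᵇ-to eq

-- Only one of `A` and `∁ A` contains the fixed element, so on the other side all members have at
-- least `suc k` elements. In either case the two sides need `2k + 2` places.
crossing-1-2-odd : ∀ k t → Crossing 1 (2 + t) (threshold (k + k) k (suc k))
crossing-1-2-odd k t (F ∷ []) (G ∷ G′ ∷ Gs) (pF ∷ pG ∷ pG′ ∷ _) (_ AllPairs.∷ (ne ∷ _) AllPairs.∷ _) (true ∷ A) (F⊆ ∷ _) (G⊆ ∷ G′⊆ ∷ _) =
  crowded (true ∷ A) (≤-trans (threshold-min F ≤-refl (n≤1+n k) pF) (⊆⇒card≤ F (true ∷ A) F⊆))
    (distinct-grow (∁ (true ∷ A)) G G′ ne G⊆ G′⊆ (threshold-out {p = k} {suc k} G (∁ A) G⊆ pG) (threshold-out {p = k} {suc k} G′ (∁ A) G′⊆ pG′))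
    (≤-reflexive (sym (trans (+-suc k (suc k)) (cong suc (+-suc k k)))))
crossing-1-2-odd k t (F ∷ []) (G ∷ G′ ∷ Gs) (pF ∷ pG ∷ pG′ ∷ _) (_ AllPairs.∷ (ne ∷ _) AllPairs.∷ _) (false ∷ A) (F⊆ ∷ _) (G⊆ ∷ G′⊆ ∷ _) =
  crowded (false ∷ A) (≤-trans (threshold-out {p = k} {suc k} F A F⊆ pF) (⊆⇒card≤ F (false ∷ A) F⊆))
    (distinct-grow (∁ (false ∷ A)) G G′ ne G⊆ G′⊆ (threshold-min G ≤-refl (n≤1+n k) pG) (threshold-min G′ ≤-refl (n≤1+n k) pG′))
    (≤-reflexive (cong suc (sym (+-suc k k))))

crossing-2-2-even : ∀ k s t → Crossing (2 + s) (2 + t) (threshold (k + suc k) k (suc k))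
crossing-2-2-even k s t (F ∷ F′ ∷ Fs) (G ∷ G′ ∷ Gs) (pF ∷ pF′ ∷ ps) ((ne ∷ _) AllPairs.∷ _ AllPairs.∷ u) (a ∷ A) (F⊆ ∷ F′⊆ ∷ _) (G⊆ ∷ G′⊆ ∷ _)
  with Allₚ.++ʳ⁻ Fs ps | unique-++ʳ Fs u
... | pG ∷ pG′ ∷ _ | (ne′ ∷ _) AllPairs.∷ _ = go a F⊆ F′⊆ G⊆ G′⊆
  where
  go : ∀ a → F ⊆ᵇ (a ∷ A) ≡ true → F′ ⊆ᵇ (a ∷ A) ≡ true → G ⊆ᵇ ∁ (a ∷ A) ≡ true → G′ ⊆ᵇ ∁ (a ∷ A) ≡ true → Falsum
  go true F⊆ F′⊆ G⊆ G′⊆ = crowded (true ∷ A)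
    (distinct-grow (true ∷ A) F F′ ne F⊆ F′⊆ (threshold-min F ≤-refl (n≤1+n k) pF) (threshold-min F′ ≤-refl (n≤1+n k) pF′))
    (distinct-grow (∁ (true ∷ A)) G G′ ne′ G⊆ G′⊆ (threshold-out {p = k} {suc k} G (∁ A) G⊆ pG) (threshold-out {p = k} {suc k} G′ (∁ A) G′⊆ pG′))
    (≤-reflexive (cong suc (sym (+-suc k (suc k)))))
  go false F⊆ F′⊆ G⊆ G′⊆ = crowded (false ∷ A)
    (distinct-grow (false ∷ A) F F′ ne F⊆ F′⊆ (threshold-out {p = k} {suc k} F A F⊆ pF) (threshold-out {p = k} {suc k} F′ A F′⊆ pF′))
    (distinct-grow (∁ (false ∷ A)) G G′ ne′ G⊆ G′⊆ (threshold-min G ≤-refl (n≤1+n k) pG) (threshold-min G′ ≤-refl (n≤1+n k) pG′))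
    ≤-refl

pigeonhole₃ : ∀ {X : Set} {x y a b c : X} → a ≡ x ⊎ a ≡ y → b ≡ x ⊎ b ≡ y → c ≡ x ⊎ c ≡ y →
              a ≢ b → a ≢ c → b ≢ c → Falsum
pigeonhole₃ (inj₁ refl) (inj₁ refl) _           ab _  _  = ab refl
pigeonhole₃ (inj₂ refl) (inj₂ refl) _           ab _  _  = ab refl
pigeonhole₃ (inj₁ refl) (inj₂ refl) (inj₁ refl) _  ac _  = ac refl
pigeonhole₃ (inj₁ refl) (inj₂ refl) (inj₂ refl) _  _  bc = bc refl
pigeonhole₃ (inj₂ refl) (inj₁ refl) (inj₁ refl) _  _  bc = bc refl
pigeonhole₃ (inj₂ refl) (inj₁ refl) (inj₂ refl) _  ac _  = ac refl

-- The family consists of the sets with at least `k` elements besides the fixed one. If `F` avoids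
-- that element, at most `k` others are left for the sets `G`, each of which then equals the
-- remainder with or without the fixed element: two candidates for three different sets.
crossing-1-3-odd : ∀ k t → Crossing 1 (3 + t) (threshold (k + k) (suc k) k)
crossing-1-3-odd k t (F ∷ []) (G ∷ G′ ∷ G″ ∷ Gs) (pF ∷ pG ∷ pG′ ∷ pG″ ∷ _)
  (_ AllPairs.∷ (ne ∷ ne′ ∷ _) AllPairs.∷ (ne″ ∷ _) AllPairs.∷ _) (true ∷ A) (F⊆ ∷ _) (G⊆ ∷ G′⊆ ∷ _) =
  crowded (true ∷ A) (big F F⊆ pF)
    (distinct-grow (∁ (true ∷ A)) G G′ ne G⊆ G′⊆ (threshold-out {p = suc k} {k} G (∁ A) G⊆ pG) (threshold-out {p = suc k} {k} G′ (∁ A) G′⊆ pG′))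
    (≤-reflexive (cong suc (sym (+-suc k k))))
  where
  big : ∀ F → F ⊆ᵇ (true ∷ A) ≡ true → threshold (k + k) (suc k) k F ≡ true → suc k ≤ card (true ∷ A)
  big (true ∷ F)  sub p = ≤-trans (≤ᵇ-to {suc k} {suc (card F)} p) (s≤s (⊆⇒card≤ F A sub))
  big (false ∷ F) sub p = s≤s (≤-trans (≤ᵇ-to p) (⊆⇒card≤ F A sub))
crossing-1-3-odd k t (F ∷ []) (G ∷ G′ ∷ G″ ∷ Gs) (pF ∷ pG ∷ pG′ ∷ pG″ ∷ _)
  (_ AllPairs.∷ (ne ∷ ne′ ∷ _) AllPairs.∷ (ne″ ∷ _) AllPairs.∷ _) (false ∷ A) (F⊆ ∷ _) (G⊆ ∷ G′⊆ ∷ G″⊆ ∷ _) =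
  pigeonhole₃ (two G G⊆ pG) (two G′ G′⊆ pG′) (two G″ G″⊆ pG″) ne ne′ ne″
  where
  small : co A ≤ k
  small = +-cancelˡ-≤ k (co A) k (≤-trans
    (+-monoˡ-≤ (co A) (≤-trans (threshold-out {p = suc k} {k} F A F⊆ pF) (⊆⇒card≤ F (false ∷ A) F⊆)))
    (≤-reflexive (card-∁ A)))
  two : ∀ G → G ⊆ᵇ ∁ (false ∷ A) ≡ true → threshold (k + k) (suc k) k G ≡ true → G ≡ true ∷ ∁ A ⊎ G ≡ false ∷ ∁ A
  two (true ∷ G)  sub p = inj₁ (cong (true ∷_) (⊆∧card≥⇒≡ G (∁ A) sub (≤-trans small (≤-pred (≤ᵇ-to {suc k} {suc (card G)} p)))))
  two (false ∷ G) sub p = inj₂ (cong (false ∷_) (⊆∧card≥⇒≡ G (∁ A) sub (≤-trans small (≤ᵇ-to p))))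

-- Sizes of the extremal systems

≤ᵇ-suc : ∀ a b → (suc a ≤ᵇ suc b) ≡ (a ≤ᵇ b)
≤ᵇ-suc zero    b = refl
≤ᵇ-suc (suc a) b = refl

size-threshold : ∀ n p q → size (threshold n (suc p) q) ≡ tail n p + tail n q
size-threshold n p q = trans (∑-subsets-suc (λ A → ⟦ threshold n (suc p) q A ⟧))
  (cong (_+ tail n q) (∑-cong (subsets n) (λ A → cong ⟦_⟧ (≤ᵇ-suc p (card A)))))

tail-pascal : ∀ n a → tail (suc n) (suc a) ≡ tail n a + tail n (suc a)
tail-pascal n a = trans (∑-subsets-suc (λ A → ⟦ atLeast (suc n) (suc a) A ⟧))
  (cong (_+ tail n (suc a)) (∑-cong (subsets n) (λ A → cong ⟦_⟧ (≤ᵇ-suc a (card A)))))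

tail-above : ∀ n a → n < a → tail n a ≡ 0
tail-above n a lt = size-empty (atLeast n a) (λ A p → <-irrefl refl (≤-trans lt (≤-trans (≤ᵇ-to p) (Subₚ.∣p∣≤n A))))

nC0≡1 : ∀ n → n C 0 ≡ 1
nC0≡1 n = *-cancelʳ-≡ _ _ (n !) {{n !≢0}}
  (trans (cong ((n C 0) *_) (sym (+-identityʳ (n !)))) (trans (nCk*k!*c! 0 n) (sym (+-identityʳ (n !)))))

size-level : ∀ n k → size {n} (λ A → card A ≡ᵇ k) ≡ n C k
size-level zero    zero    = refl
size-level zero    (suc k) = refl
size-level (suc n) zero    = begin
  size {suc n} (λ A → card A ≡ᵇ 0)  ≡⟨ ∑-subsets-suc {n} (λ A → ⟦ card A ≡ᵇ 0 ⟧) ⟩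
  ∑ (subsets n) (λ _ → 0) + size {n} (λ A → card A ≡ᵇ 0) ≡⟨ cong₂ _+_ (∑-0 (subsets n)) (size-level n 0) ⟩
  n C 0  ≡⟨ trans (nC0≡1 n) (sym (nC0≡1 (suc n))) ⟩
  suc n C 0 ∎
  where open ≡-Reasoning
size-level (suc n) (suc k) = trans (∑-subsets-suc {n} (λ A → ⟦ card A ≡ᵇ suc k ⟧))
  (trans (cong₂ _+_ (size-level n k) (size-level n (suc k))) (nCk+nC[k+1]≡[n+1]C[k+1] n k))

tail-step : ∀ n a → tail n a ≡ (n C a) + tail n (suc a)
tail-step n a = trans (∑-cong (subsets n) (λ A → split a (card A)))
  (trans (∑-+ (subsets n) _ _) (cong (_+ tail n (suc a)) (size-level n a)))
  where
  split : ∀ a c → ⟦ a ≤ᵇ c ⟧ ≡ ⟦ c ≡ᵇ a ⟧ + ⟦ suc a ≤ᵇ c ⟧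
  split zero    zero    = refl
  split zero    (suc c) = refl
  split (suc a) zero    = refl
  split (suc a) (suc c) = trans (cong ⟦_⟧ (≤ᵇ-suc a c)) (split a c)

-- Since `a + b` is `n + 1`, exactly one of `a ≤ card A` and `b ≤ co A` holds for each `A`.
tail-complement : ∀ n a b → a + b ≡ suc n → tail n a + tail n b ≡ 2 ^ n
tail-complement n a b eq = begin
  tail n a + tail n b  ≡⟨ cong (tail n a +_) (sym (∑-∁ {n} (λ A → ⟦ b ≤ᵇ card A ⟧))) ⟩
  tail n a + ∑ (subsets n) (λ A → ⟦ b ≤ᵇ co A ⟧)  ≡⟨ sym (∑-+ (subsets n) _ _) ⟩
  ∑ (subsets n) (λ A → ⟦ a ≤ᵇ card A ⟧ + ⟦ b ≤ᵇ co A ⟧)            ≡⟨ ∑-cong (subsets n) one ⟩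
  size {n} (λ _ → true)  ≡⟨ size-all n ⟩
  2 ^ n ∎
  where
  open ≡-Reasoning
  one : ∀ A → ⟦ a ≤ᵇ card A ⟧ + ⟦ b ≤ᵇ co A ⟧ ≡ 1
  one A with a ≤ᵇ card A in eq₁ | b ≤ᵇ co A in eq₂
  ... | true  | false = refl
  ... | false | true  = refl
  ... | true  | true  = absurd (<-irrefl (sym (card-∁ A))
        (≤-trans (≤-reflexive (sym eq)) (+-mono-≤ (≤ᵇ-to {a} eq₁) (≤ᵇ-to {b} eq₂))))
  ... | false | false = absurd (1+n≰n (≤-trans (≤-reflexive (sym (+-suc (suc (card A)) (co A))))
        (≤-trans (+-mono-≤ (not-≤ {a} eq₁) (not-≤ {b} eq₂)) (≤-trans (≤-reflexive eq) (≤-reflexive (cong suc (sym (card-∁ A))))))))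
    where
    not-≤ : ∀ {x y} → (x ≤ᵇ y) ≡ false → y < x
    not-≤ {x} {y} e = ≰⇒> (λ le → true≢false (≤ᵇ-from le) e)

sumFromTo≡tail : ∀ n a → a ≤ suc n → (∑[ a ≤ i ≤ n ] (n C i)) ≡ tail n a
sumFromTo≡tail n a a≤ = go (suc n ∸ a) a (m+[n∸m]≡n a≤)
  where
  applyUpTo-cong : ∀ {g h : ℕ → ℕ} j → (∀ i → g i ≡ h i) → Data.Nat.ListAction.sum (applyUpTo g j) ≡ Data.Nat.ListAction.sum (applyUpTo h j)
  applyUpTo-cong zero    eq = refl
  applyUpTo-cong (suc j) eq = cong₂ _+_ (eq 0) (applyUpTo-cong j (λ i → eq (suc i)))
  go : ∀ j a → a + j ≡ suc n → Data.Nat.ListAction.sum (applyUpTo (λ i → n C (a + i)) j) ≡ tail n a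
  go zero    a eq = sym (tail-above n a (≤-reflexive (trans (sym eq) (+-identityʳ a))))
  go (suc j) a eq = trans (cong₂ _+_ (cong (n C_) (+-identityʳ a))
      (trans (applyUpTo-cong j (λ i → cong (n C_) (+-suc a i))) (go j (suc a) (trans (sym (+-suc a j)) eq))))
    (sym (tail-step n a))

-- Exact values

extremal : ∀ n s t .{{_ : NonZero s}} .{{_ : NonZero t}} → ∃ λ (𝓕 : Family n) → size 𝓕 ≡ f n s t × NoSplit s t 𝓕
extremal n s t with f-isMaximumSize n s t
... | (𝓢 , ui) , _ = (_∈ᵇ members 𝓢) , size-∈ᵇ (members 𝓢) (distinct 𝓢) , noSplit 𝓢 ui

core-bound : ∀ {n} (𝓕 : Family n) → 2 * size 𝓕 ≤ 2 ^ n + (size (innerCore 𝓕) + 2 * ⟦ 𝓕 ⊥ ⟧)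
core-bound {n} 𝓕 = ≤-trans (size-core 𝓕) (+-monoʳ-≤ (2 ^ n) (size-innerCore 𝓕))

core-bound-∌∅ : ∀ {n} (𝓕 : Family n) → 𝓕 ⊥ ≡ false → 2 * size 𝓕 ≤ 2 ^ n + size (innerCore 𝓕)
core-bound-∌∅ {n} 𝓕 eq = ≤-trans (core-bound 𝓕) (≤-reflexive (cong (2 ^ n +_)
  (trans (cong (λ b → size (innerCore 𝓕) + 2 * ⟦ b ⟧) eq) (+-identityʳ _))))

innerCore-inner : ∀ {n} (𝓕 : Family n) → Inner (innerCore 𝓕)
innerCore-inner 𝓕 A p = innerCore-nonempty 𝓕 A p , <ᵇ-to (∧-elimʳ {0 <ᵇ card A} (∧-elimʳ {core 𝓕 A} p))

-- With `s = 1` the set `A` alone fills its side, which limits the supersets; the same bound at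
-- `∁ A` limits the subsets.
degrees-1 : ∀ {n r} (𝓕 : Family n) → NoSplit 1 (2 + r) 𝓕 → ∀ A → innerCore 𝓕 A ≡ true →
            sub (innerCore 𝓕) A ≤ r × sup (innerCore 𝓕) A ≤ r
degrees-1 {r = r} 𝓕 ns A p = subst (_≤ r) sub-sup (sup≤ (∁ A) (trans (sc A) p)) , sup≤ A p
  where
  sc = innerCore-selfComplementary 𝓕
  sup≤ : ∀ A → innerCore 𝓕 A ≡ true → sup (innerCore 𝓕) A ≤ r
  sup≤ A p = ≤-pred (≰⇒> λ le → innerCore-degrees 𝓕 ns A p (s≤s z≤n) (s≤s le))
  sub-sup : sup (innerCore 𝓕) (∁ A) ≡ sub (innerCore 𝓕) A
  sub-sup = trans (sym (sub-∁ (innerCore 𝓕) sc (∁ A))) (cong (sub (innerCore 𝓕)) (∁-involutive A))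

member⇒size>0 : ∀ {n} (P : Family n) A → P A ≡ true → 0 < size P
member⇒size>0 P A p = subst (λ b → ⟦ b ⟧ ≤ size P) p (∑-term-≤ A (λ B → ⟦ P B ⟧))

antichain-1-2 : ∀ {n} (𝓕 : Family n) → NoSplit 1 2 𝓕 → Antichain (innerCore 𝓕)
antichain-1-2 𝓕 ns A B p q lt = <-irrefl refl (≤-trans
  (member⇒size>0 (λ B → innerCore 𝓕 B ∧ A ⊂ᵇ B) B (∧-intro q lt)) (proj₂ (degrees-1 𝓕 ns A p)))

noThreeChain-2-2 : ∀ {n} (𝓕 : Family n) → NoSplit 2 2 𝓕 → NoThreeChain (innerCore 𝓕)
noThreeChain-2-2 𝓕 ns A B D pA pB pD A⊂B B⊂D = innerCore-degrees 𝓕 ns B pB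
  (s≤s (member⇒size>0 (λ A → innerCore 𝓕 A ∧ A ⊂ᵇ B) A (∧-intro pA A⊂B)))
  (s≤s (member⇒size>0 (λ D → innerCore 𝓕 D ∧ B ⊂ᵇ D) D (∧-intro pD B⊂D)))

-- If `A ⊂ B` in the core, then ∅ and `A` lie inside `A`, while `∁ A` and `∁ B` lie inside `∁ A`: a
-- forbidden split into two and two.
antichain-2-2 : ∀ {n} (𝓕 : Family n) → NoSplit 2 2 𝓕 → 𝓕 ⊥ ≡ true → Antichain (innerCore 𝓕)
antichain-2-2 {n} 𝓕 ns 𝓕⊥ A B pA pB A⊂B = ns A (_∈ᵇ vP) (_∈ᵇ vQ)
  (λ X p → inP (∈ᵇ-to vP p)) (λ X q → inQ (∈ᵇ-to vQ q)) (λ X p q → disjoint {X} (∈ᵇ-to vP p) (∈ᵇ-to vQ q))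
  (≤-reflexive (sym (size-∈ᵇ vP ((⊥≢A ∷ []) AllPairs.∷ [] AllPairs.∷ AllPairs.[]))))
  (≤-reflexive (sym (size-∈ᵇ vQ ((∁≢∁ ∷ []) AllPairs.∷ [] AllPairs.∷ AllPairs.[]))))
  where
  vP vQ : Vec (Subset n) 2
  vP = ⊥ ∷ A ∷ []
  vQ = ∁ A ∷ ∁ B ∷ []
  A⊆B : A ⊆ᵇ B ≡ true
  A⊆B = ∧-elimˡ {A ⊆ᵇ B} A⊂B
  ∁B⊆∁A : ∁ B ⊆ᵇ ∁ A ≡ true
  ∁B⊆∁A = trans (∁-⊆ᵇ A B) A⊆B
  0<A = proj₁ (innerCore-inner 𝓕 A pA)
  in𝓕 : ∀ X → innerCore 𝓕 X ≡ true → 𝓕 X ≡ true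
  in𝓕 X p = ∧-elimˡ {𝓕 X} (∧-elimˡ {core 𝓕 X} p)
  in𝓕∁ : ∀ X → innerCore 𝓕 X ≡ true → 𝓕 (∁ X) ≡ true
  in𝓕∁ X p = ∧-elimʳ {𝓕 X} (∧-elimˡ {core 𝓕 X} p)
  ⊥≢A : ⊥ ≢ A
  ⊥≢A eq = <-irrefl (trans (sym (Subₚ.∣⊥∣≡0 n)) (cong card eq)) 0<A
  ∁≢∁ : ∁ A ≢ ∁ B
  ∁≢∁ eq = <-irrefl (cong card (trans (sym (∁-involutive A)) (trans (cong ∁ eq) (∁-involutive B)))) (⊂ᵇ⇒card< A B A⊂B)
  inP : ∀ {X} → X ∈ᵥ vP → 𝓕 X ≡ true × X ⊆ᵇ A ≡ true
  inP (here refl)         = 𝓕⊥ , ⊆ᵇ-from {A = ⊥} {A} Subₚ.⊥⊆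
  inP (there (here refl)) = in𝓕 A pA , ⊆ᵇ-refl A
  inQ : ∀ {X} → X ∈ᵥ vQ → 𝓕 X ≡ true × X ⊆ᵇ ∁ A ≡ true
  inQ (here refl)         = in𝓕∁ A pA , ⊆ᵇ-refl (∁ A)
  inQ (there (here refl)) = in𝓕∁ B pB , ∁B⊆∁A
  disjoint : ∀ {X} → X ∈ᵥ vP → X ∈ᵥ vQ → Falsum
  disjoint (here refl) (here eq) = <-irrefl (trans (sym (Subₚ.∣⊥∣≡0 n)) (cong card eq)) (proj₂ (innerCore-inner 𝓕 A pA))
  disjoint (here refl) (there (here eq)) = <-irrefl (trans (sym (Subₚ.∣⊥∣≡0 n)) (cong card eq)) (proj₂ (innerCore-inner 𝓕 B pB))
  disjoint (there (here refl)) q = <-irrefl (sym (⊆∧⊆∁⇒card≡0 A A (⊆ᵇ-refl A) (proj₂ (inQ q)))) 0<A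

size-halves : ∀ {n} (𝓖 : Family (suc n)) → SelfComplementary 𝓖 → size 𝓖 ≡ 2 * size (λ A → 𝓖 (false ∷ A))
size-halves {n} 𝓖 sc = begin
  size 𝓖  ≡⟨ ∑-subsets-suc (λ A → ⟦ 𝓖 A ⟧) ⟩
  size (λ A → 𝓖 (true ∷ A)) + size (λ A → 𝓖 (false ∷ A))          ≡⟨ cong (_+ size (λ A → 𝓖 (false ∷ A))) other ⟩
  size (λ A → 𝓖 (false ∷ A)) + size (λ A → 𝓖 (false ∷ A))         ≡⟨ cong (size (λ A → 𝓖 (false ∷ A)) +_) (sym (+-identityʳ _)) ⟩
  2 * size (λ A → 𝓖 (false ∷ A)) ∎
  where
  open ≡-Reasoning
  other : size (λ A → 𝓖 (true ∷ A)) ≡ size (λ A → 𝓖 (false ∷ A))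
  other = trans (∑-cong (subsets n) (λ A → cong ⟦_⟧ (sym (sc (true ∷ A))))) (∑-∁ (λ A → ⟦ 𝓖 (false ∷ A) ⟧))

-- Of each complementary pair exactly one set avoids the fixed element. These sets live in dimension
-- `k + k`, where `pair-bound` applies, and their degrees do not exceed those in 𝓖.
odd-pairs : ∀ k (𝓖 : Family (suc (k + k))) → 0 < k → SelfComplementary 𝓖 →
  (∀ A → 𝓖 A ≡ true → 0 < card A × sub 𝓖 A ≤ 1 × sup 𝓖 A ≤ 1) → size 𝓖 ≤ 2 * ((k + k) C k)
odd-pairs k 𝓖 0<k sc hyp = ≤-trans (≤-reflexive (size-halves 𝓖 sc)) (*-monoʳ-≤ 2 (pair-bound k (λ A → 𝓖 (false ∷ A)) 0<k
  (λ A p → let pos , few , few′ = hyp (false ∷ A) p in pos ,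
    ≤-trans (∑-insertAt-≤ zero (λ B → ⟦ 𝓖 B ∧ B ⊂ᵇ (false ∷ A) ⟧)) few ,
    ≤-trans (∑-insertAt-≤ zero (λ B → ⟦ 𝓖 B ∧ (false ∷ A) ⊂ᵇ B ⟧)) few′)))

binomial-positive : ∀ a b → 0 < (a + b) C a
binomial-positive a b = n≢0⇒n>0 λ eq → <-irrefl (trans (cong (_* (a ! * b !)) (sym eq)) (nCk*k!*c! a b)) (1≤n! (a + b))

double-tail-even : ∀ k → 2 * tail (k + k) k ≡ 2 ^ (k + k) + ((k + k) C k)
double-tail-even k = begin
  2 * tail (k + k) k  ≡⟨ cong (tail (k + k) k +_) (+-identityʳ _) ⟩
  tail (k + k) k + tail (k + k) k  ≡⟨ cong (tail (k + k) k +_) (trans (tail-step (k + k) k) (+-comm ((k + k) C k) _)) ⟩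
  tail (k + k) k + (tail (k + k) (suc k) + ((k + k) C k))  ≡⟨ sym (+-assoc (tail (k + k) k) _ _) ⟩
  tail (k + k) k + tail (k + k) (suc k) + ((k + k) C k)    ≡⟨ cong (_+ ((k + k) C k)) (tail-complement (k + k) k (suc k) (+-suc k k)) ⟩
  2 ^ (k + k) + ((k + k) C k) ∎
  where open ≡-Reasoning

double-tail-odd : ∀ k → 2 * tail (suc (k + k)) (suc k) ≡ 2 ^ suc (k + k)
double-tail-odd k = trans (cong (tail (suc (k + k)) (suc k) +_) (+-identityʳ _))
  (tail-complement (suc (k + k)) (suc k) (suc k) (cong suc (+-suc k k)))

size-threshold-suc : ∀ n k → size (threshold n (suc k) (2 + k)) ≡ (n C k) + tail (suc n) (2 + k)
size-threshold-suc n k = begin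
  size (threshold n (suc k) (2 + k))          ≡⟨ size-threshold n k (2 + k) ⟩
  tail n k + tail n (2 + k)  ≡⟨ cong (_+ tail n (2 + k)) (tail-step n k) ⟩
  (n C k) + tail n (suc k) + tail n (2 + k)   ≡⟨ +-assoc (n C k) _ _ ⟩
  (n C k) + (tail n (suc k) + tail n (2 + k)) ≡⟨ cong ((n C k) +_) (sym (tail-pascal n (suc k))) ⟩
  (n C k) + tail (suc n) (2 + k) ∎
  where open ≡-Reasoning

size-threshold-1-3 : ∀ k → size (threshold (k + k) (suc k) k) ≡ ((k + k) C k) + tail (suc (k + k)) (suc k)
size-threshold-1-3 k = begin
  size (threshold n (suc k) k)  ≡⟨ size-threshold n k k ⟩
  tail n k + tail n k  ≡⟨ cong (tail n k +_) (trans (tail-step n k) (+-comm (n C k) _)) ⟩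
  tail n k + (tail n (suc k) + (n C k))  ≡⟨ sym (+-assoc (tail n k) _ _) ⟩
  tail n k + tail n (suc k) + (n C k)  ≡⟨ cong (_+ (n C k)) (sym (tail-pascal n k)) ⟩
  tail (suc n) (suc k) + (n C k)  ≡⟨ +-comm _ (n C k) ⟩
  (n C k) + tail (suc n) (suc k) ∎
  where
  open ≡-Reasoning
  n = k + k

-- Pascal's rule for both binomials and the equality of the two middle terms in the odd row. It
-- reconciles the cycle bound with the size of the threshold family.
central-split : ∀ k → (((2 + k) + (2 + k)) C (2 + k)) + 2 * ((suc k + (2 + k)) C k) ≡ 2 * (((2 + k) + (2 + k)) C suc k)
central-split k = begin
  (suc n C (2 + k)) + 2 * (n C k)  ≡⟨ cong (_+ 2 * (n C k)) (sym (nCk+nC[k+1]≡[n+1]C[k+1] n (suc k))) ⟩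
  (n C suc k) + (n C (2 + k)) + 2 * (n C k)  ≡⟨ cong (λ x → (n C suc k) + x + 2 * (n C k)) (sym (C-symmetric (suc k) (2 + k))) ⟩
  (n C suc k) + (n C suc k) + 2 * (n C k)  ≡⟨ form (n C suc k) (n C k) ⟩
  2 * ((n C k) + (n C suc k))  ≡⟨ cong (2 *_) (nCk+nC[k+1]≡[n+1]C[k+1] n k) ⟩
  2 * (suc n C suc k) ∎
  where
  open ≡-Reasoning
  n = suc k + (2 + k)
  form : ∀ x y → x + x + 2 * y ≡ 2 * (y + x)
  form = solve-∀

-- At `n = 3` and `x = 3` this is `6 ≤ 8`. It disposes of the families that contain ∅, whose size is
-- at most `t ≤ 3` in the exact cases with `s = 1`.
2x≤2^n : ∀ {x y n} → 3 ≤ n → x ≤ 3 → 2 * x ≤ 2 ^ n + y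
2x≤2^n {x} {y} {n} 3≤n x≤3 = ≤-trans (*-monoʳ-≤ 2 x≤3) (≤-trans (s≤s (s≤s (s≤s (s≤s (s≤s (s≤s z≤n))))))
  (≤-trans (^-monoʳ-≤ 2 3≤n) (m≤m+n (2 ^ n) y)))

f-upper-1 : ∀ n r → 3 ≤ n → r ≤ 1 → ∃ λ (𝓕 : Family n) → NoSplit 1 (2 + r) 𝓕 ×
  (∀ b → size (innerCore 𝓕) ≤ b → 2 * f n 1 (2 + r) ≤ 2 ^ n + b)
f-upper-1 n r 3≤n r≤1 with extremal n 1 (2 + r)
... | 𝓕 , eq , ns = 𝓕 , ns , λ b le → subst (λ x → 2 * x ≤ 2 ^ n + b) eq (bound b le (bool-cases (𝓕 ⊥)))
  where
  bound : ∀ b → size (innerCore 𝓕) ≤ b → 𝓕 ⊥ ≡ true ⊎ 𝓕 ⊥ ≡ false → 2 * size 𝓕 ≤ 2 ^ n + b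
  bound b le (inj₁ e) = 2x≤2^n 3≤n (≤-trans (size-with-∅ 𝓕 ns e) (s≤s (s≤s r≤1)))
  bound b le (inj₂ e) = ≤-trans (core-bound-∌∅ 𝓕 e) (+-monoʳ-≤ (2 ^ n) le)

f-1-1 : ∀ n → f (suc n) 1 1 ≡ 2 ^ n
f-1-1 n = ≤-antisym upper (≤-trans (≤-reflexive (sym size-star)) (size≤f (threshold n 0 (2 + n)) (star-crossing n)))
  where
  size-star : size (threshold n 0 (2 + n)) ≡ 2 ^ n
  size-star = trans (∑-subsets-suc (λ A → ⟦ threshold n 0 (2 + n) A ⟧))
    (trans (cong₂ _+_ (size-all n) (tail-above n (2 + n) (n≤1+n (suc n)))) (+-identityʳ _))
  upper : f (suc n) 1 1 ≤ 2 ^ n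
  upper with extremal (suc n) 1 1
  ... | 𝓕 , eq , ns with bool-cases (𝓕 ⊥)
  ...   | inj₁ e = subst (_≤ 2 ^ n) eq (≤-trans (size-with-∅ 𝓕 ns e) (m^n>0 2 n))
  ...   | inj₂ e = subst (_≤ 2 ^ n) eq (*-cancelˡ-≤ 2 (≤-trans (core-bound-∌∅ 𝓕 e)
          (≤-reflexive (trans (cong (2 ^ suc n +_) empty) (+-identityʳ _)))))
    where
    empty : size (innerCore 𝓕) ≡ 0
    empty = size-empty (innerCore 𝓕) (λ A p → innerCore-degrees 𝓕 ns A p (s≤s z≤n) (s≤s z≤n))

-- `pair-bound` tolerates one subset and one superset per member, so in even dimension a third set
-- on the second side gains nothing over two.
f-1-even : ∀ k r → 3 ≤ k + k → r ≤ 1 → f (k + k) 1 (2 + r) ≡ tail (k + k) k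
f-1-even k r 3≤n r≤1 = ≤-antisym (*-cancelˡ-≤ 2 upper) (size≤f (atLeast (k + k) k) (crossing-1-2-even k r))
  where
  0<k : ∀ k → 3 ≤ k + k → 0 < k
  0<k (suc k) _ = s≤s z≤n
  upper : 2 * f (k + k) 1 (2 + r) ≤ 2 * tail (k + k) k
  upper with f-upper-1 (k + k) r 3≤n r≤1
  ... | 𝓕 , ns , bound = ≤-trans (bound _ (pair-bound k (innerCore 𝓕) (0<k k 3≤n) (λ A p →
          let few , few′ = degrees-1 𝓕 ns A p in innerCore-nonempty 𝓕 A p , ≤-trans few r≤1 , ≤-trans few′ r≤1)))
        (≤-reflexive (sym (double-tail-even k)))

f-1-2-odd : ∀ k → f (suc (suc k + suc k)) 1 2 ≡ ((suc k + suc k) C k) + tail (suc (suc k + suc k)) (2 + k)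
f-1-2-odd k = ≤-antisym (*-cancelˡ-≤ 2 upper)
  (≤-trans (≤-reflexive (sym (size-threshold-suc (suc k + suc k) k))) (size≤f (threshold (suc k + suc k) (suc k) (2 + k)) (crossing-1-2-odd (suc k) 0)))
  where
  n = suc (suc k + suc k)
  upper : 2 * f n 1 2 ≤ 2 * (((suc k + suc k) C k) + tail n (2 + k))
  upper with f-upper-1 n 0 (s≤s (s≤s (≤-trans (s≤s z≤n) (m≤n+m (suc k) k)))) z≤n
  ... | 𝓕 , ns , bound = ≤-trans
        (bound _ (odd-antichain k (innerCore 𝓕) (innerCore-selfComplementary 𝓕) (innerCore-inner 𝓕) (antichain-1-2 𝓕 ns)))
        (≤-reflexive (trans (+-comm (2 ^ n) _) (trans (cong (2 * ((suc k + suc k) C k) +_) (sym (double-tail-odd (suc k))))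
          (sym (*-distribˡ-+ 2 ((suc k + suc k) C k) (tail n (2 + k)))))))

f-1-3-odd : ∀ k → 0 < k → f (suc (k + k)) 1 3 ≡ ((k + k) C k) + tail (suc (k + k)) (suc k)
f-1-3-odd k 0<k = ≤-antisym (*-cancelˡ-≤ 2 upper)
  (≤-trans (≤-reflexive (sym (size-threshold-1-3 k))) (size≤f (threshold (k + k) (suc k) k) (crossing-1-3-odd k 0)))
  where
  n = suc (k + k)
  upper : 2 * f n 1 3 ≤ 2 * (((k + k) C k) + tail n (suc k))
  upper with f-upper-1 n 1 (s≤s (+-mono-≤ 0<k 0<k)) ≤-refl
  ... | 𝓕 , ns , bound = ≤-trans
        (bound _ (odd-pairs k (innerCore 𝓕) 0<k (innerCore-selfComplementary 𝓕) (λ A p →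
          let few , few′ = degrees-1 𝓕 ns A p in innerCore-nonempty 𝓕 A p , few , few′)))
        (≤-reflexive (trans (+-comm (2 ^ n) _) (trans (cong (2 * ((k + k) C k) +_) (sym (double-tail-odd k)))
          (sym (*-distribˡ-+ 2 ((k + k) C k) (tail n (suc k)))))))

-- Two demands on `b`, one for each case: without ∅ the core has no three-chain; with ∅ the count
-- grows by 2, but the core is even an antichain.
f-upper-2-2 : ∀ n → ∃ λ (𝓕 : Family n) → NoSplit 2 2 𝓕 ×
  (∀ b → (NoThreeChain (innerCore 𝓕) → size (innerCore 𝓕) ≤ b) → (Antichain (innerCore 𝓕) → 2 + size (innerCore 𝓕) ≤ b) →
   2 * f n 2 2 ≤ 2 ^ n + b)
f-upper-2-2 n with extremal n 2 2
... | 𝓕 , eq , ns = 𝓕 , ns , λ b le le′ → subst (λ x → 2 * x ≤ 2 ^ n + b) eq (bound b le le′ (bool-cases (𝓕 ⊥)))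
  where
  bound : ∀ b → (NoThreeChain (innerCore 𝓕) → size (innerCore 𝓕) ≤ b) → (Antichain (innerCore 𝓕) → 2 + size (innerCore 𝓕) ≤ b) →
          𝓕 ⊥ ≡ true ⊎ 𝓕 ⊥ ≡ false → 2 * size 𝓕 ≤ 2 ^ n + b
  bound b le le′ (inj₁ e) = ≤-trans (core-bound 𝓕) (+-monoʳ-≤ (2 ^ n)
    (≤-trans (≤-reflexive (trans (cong (λ x → size (innerCore 𝓕) + 2 * ⟦ x ⟧) e) (+-comm (size (innerCore 𝓕)) 2)))
             (le′ (antichain-2-2 𝓕 ns e))))
  bound b le le′ (inj₂ e) = ≤-trans (core-bound-∌∅ 𝓕 e) (+-monoʳ-≤ (2 ^ n) (le (noThreeChain-2-2 𝓕 ns)))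

double-tail-odd-k : ∀ k → 2 * tail (suc (k + k)) k ≡ 2 ^ suc (k + k) + 2 * (suc (k + k) C k)
double-tail-odd-k k = trans (cong (2 *_) (tail-step n k)) (trans (*-distribˡ-+ 2 (n C k) _)
  (trans (cong (2 * (n C k) +_) (double-tail-odd k)) (+-comm (2 * (n C k)) _)))
  where n = suc (k + k)

f-2-2-odd : ∀ k → f (suc (suc k + suc k)) 2 2 ≡ tail (suc (suc k + suc k)) (suc k)
f-2-2-odd k = ≤-antisym (*-cancelˡ-≤ 2 upper) (size≤f (atLeast n (suc k)) (crossing-2-2-odd (suc k) 0 0))
  where
  n = suc (suc k + suc k)
  -- By Pascal's rule the three-chain bound exceeds the antichain bound by twice a positive
  -- binomial, which leaves space for ∅ and the full set.
  room : 2 + 2 * ((suc k + suc k) C k) ≤ 2 * (n C suc k)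
  room = ≤-trans (≤-reflexive (sym (*-distribˡ-+ 2 1 _))) (*-monoʳ-≤ 2 (≤-trans
    (+-monoˡ-≤ ((suc k + suc k) C k) (binomial-positive (suc k) (suc k)))
    (≤-reflexive (trans (+-comm _ ((suc k + suc k) C k)) (nCk+nC[k+1]≡[n+1]C[k+1] (suc k + suc k) k)))))
  upper : 2 * f n 2 2 ≤ 2 * tail n (suc k)
  upper with f-upper-2-2 n
  ... | 𝓕 , ns , bound = ≤-trans (bound (2 * (n C suc k))
          (odd-noThreeChain (suc k) 𝓖 (s≤s z≤n) sc (innerCore-inner 𝓕))
          (λ ac → ≤-trans (+-monoʳ-≤ 2 (odd-antichain k 𝓖 sc (innerCore-inner 𝓕) ac)) room))
        (≤-reflexive (sym (double-tail-odd-k (suc k))))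
    where
    𝓖 = innerCore 𝓕
    sc = innerCore-selfComplementary 𝓕

double-even-2-2 : ∀ k → 2 * (((suc k + (2 + k)) C k) + tail ((2 + k) + (2 + k)) (2 + k)) ≡
  2 ^ ((2 + k) + (2 + k)) + 2 * (((2 + k) + (2 + k)) C suc k)
double-even-2-2 k = begin
  2 * (((suc k + (2 + k)) C k) + tail n (2 + k))  ≡⟨ *-distribˡ-+ 2 ((suc k + (2 + k)) C k) (tail n (2 + k)) ⟩
  2 * ((suc k + (2 + k)) C k) + 2 * tail n (2 + k)  ≡⟨ cong (2 * ((suc k + (2 + k)) C k) +_) (double-tail-even (2 + k)) ⟩
  2 * ((suc k + (2 + k)) C k) + (2 ^ n + (n C (2 + k)))           ≡⟨ form (2 * ((suc k + (2 + k)) C k)) (2 ^ n) (n C (2 + k)) ⟩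
  2 ^ n + ((n C (2 + k)) + 2 * ((suc k + (2 + k)) C k))           ≡⟨ cong (2 ^ n +_) (central-split k) ⟩
  2 ^ n + 2 * (n C suc k) ∎
  where
  open ≡-Reasoning
  n = (2 + k) + (2 + k)
  form : ∀ x y z → x + (y + z) ≡ y + (z + x)
  form = solve-∀

f-2-2-even : ∀ k → f ((2 + k) + (2 + k)) 2 2 ≡ ((suc k + (2 + k)) C k) + tail ((2 + k) + (2 + k)) (2 + k)
f-2-2-even k = ≤-antisym (*-cancelˡ-≤ 2 upper)
  (≤-trans (≤-reflexive (sym (size-threshold-suc (suc k + (2 + k)) k))) (size≤f (threshold (suc k + (2 + k)) (suc k) (2 + k)) (crossing-2-2-even (suc k) 0 0)))
  where
  n = (2 + k) + (2 + k)
  -- In an antichain both degrees vanish, so `pair-bound` specializes to Sperner's bound.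
  zero-degree : ∀ (𝓖 : Family n) → Antichain 𝓖 → ∀ A → 𝓖 A ≡ true → sub 𝓖 A ≤ 1 × sup 𝓖 A ≤ 1
  zero-degree 𝓖 ac A p =
    ≤-trans (≤-reflexive (size-empty (λ B → 𝓖 B ∧ B ⊂ᵇ A) (λ B q → ac B A (∧-elimˡ {𝓖 B} q) p (∧-elimʳ {𝓖 B} q)))) z≤n ,
    ≤-trans (≤-reflexive (size-empty (λ B → 𝓖 B ∧ A ⊂ᵇ B) (λ B q → ac A B p (∧-elimˡ {𝓖 B} q) (∧-elimʳ {𝓖 B} q)))) z≤n
  upper : 2 * f n 2 2 ≤ 2 * (((suc k + (2 + k)) C k) + tail n (2 + k))
  upper with f-upper-2-2 n
  ... | 𝓕 , ns , bound = ≤-trans (bound (2 * (n C suc k))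
          (even-noThreeChain (suc k) 𝓖 (innerCore-selfComplementary 𝓕) (innerCore-inner 𝓕))
          (λ ac → ≤-trans (+-monoʳ-≤ 2 (pair-bound (2 + k) 𝓖 (s≤s z≤n)
             (λ A p → innerCore-nonempty 𝓕 A p , zero-degree 𝓖 ac A p))) room))
        (≤-reflexive (sym (double-even-2-2 k)))
    where
    𝓖 = innerCore 𝓕
    -- Here the gap between the two bounds is the term `2 * ((suc k + (2 + k)) C k)` of
    -- `central-split`.
    room : 2 + (n C (2 + k)) ≤ 2 * (n C suc k)
    room = ≤-trans (≤-trans (≤-reflexive (+-comm 2 _)) (+-monoʳ-≤ (n C (2 + k)) (*-monoʳ-≤ 2 positive))) (≤-reflexive (central-split k))
      where
      positive : 0 < (suc k + (2 + k)) C k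
      positive = subst (λ x → 0 < x C k) (+-suc k (2 + k)) (binomial-positive k (3 + k))

-- Asymptotic bounds

-- Two steps up the row multiply `n C i` by `(n − i)(n − i − 1) / ((i + 1)(i + 2))`, and the result
-- is at most the central binomial. Since `2 * (i + 1) ≤ n`, both numerators are at least `n / 2`,
-- whence the 4.
level-bound : ∀ h c i M → 0 < h → h ≤ c → c ≤ suc h → i < M → 2 * M ≤ h + c →
  ((h + c) C i) * ((h + c) * (h + c)) ≤ 4 * (suc M * suc M) * ((h + c) C h)
level-bound h c i M 0<h h≤c c≤ i<M 2M≤ with m≤n⇒∃[o]m+o≡n (≤-trans i+2≤2M 2M≤)
  where
  i+2≤2M : suc (suc i) ≤ 2 * M
  i+2≤2M = ≤-trans (s≤s i<M) (≤-trans (+-monoˡ-≤ M (≤-trans (s≤s z≤n) i<M)) (≤-reflexive (cong (M +_) (sym (+-identityʳ M)))))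
... | e , eq = *-cancelʳ-≤ _ _ (i ! * e !) {{i !* e !≢0}} (begin
  (n C i) * (n * n) * (i ! * e !)
    ≤⟨ *-monoˡ-≤ (i ! * e !) (*-monoʳ-≤ (n C i) (*-mono-≤ n≤ (≤-trans n≤ (*-monoʳ-≤ 2 (n≤1+n (suc e)))))) ⟩
  (n C i) * (2 * suc e * (2 * (2 + e))) * (i ! * e !)
    ≡⟨ form₁ (n C i) e (i !) (e !) ⟩
  4 * ((n C i) * (i ! * (2 + e) !))
    ≡⟨ cong (4 *_) (trans (cong (λ x → (x C i) * (i ! * (2 + e) !)) n≡) (trans (nCk*k!*c! i (2 + e)) (cong _! (sym n≡)))) ⟩
  4 * n !
    ≡⟨ cong (4 *_) (sym (trans (cong (λ x → (x C (2 + i)) * ((2 + i) ! * e !)) (sym eq)) (trans (nCk*k!*c! (2 + i) e) (cong _! eq)))) ⟩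
  4 * ((n C (2 + i)) * ((2 + i) ! * e !))
    ≤⟨ *-monoʳ-≤ 4 (*-monoˡ-≤ ((2 + i) ! * e !) (central-binomial-max h c (2 + i) e 0<h h≤c c≤ (s≤s z≤n) eq)) ⟩
  4 * ((n C h) * ((2 + i) ! * e !))
    ≡⟨ form₂ (n C h) i (i !) (e !) ⟩
  4 * ((2 + i) * (1 + i)) * (n C h) * (i ! * e !)
    ≤⟨ *-monoˡ-≤ (i ! * e !) (*-monoˡ-≤ (n C h) (*-monoʳ-≤ 4 (*-mono-≤ (s≤s i<M) (≤-trans i<M (n≤1+n M))))) ⟩
  4 * (suc M * suc M) * (n C h) * (i ! * e !) ∎)
  where
  open ≤-Reasoning
  n = h + c
  n≡ : n ≡ i + (2 + e)
  n≡ = trans (sym eq) (trans (cong suc (sym (+-suc i e))) (sym (+-suc i (suc e))))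
  n≤ : n ≤ 2 * suc e
  n≤ = +-cancelˡ-≤ (2 * suc i) n (2 * suc e) (≤-trans (+-monoˡ-≤ n (≤-trans (*-monoʳ-≤ 2 i<M) 2M≤))
         (≤-reflexive (trans (cong₂ _+_ n≡ n≡) (form₃ i e))))
    where
    form₃ : ∀ i e → i + (2 + e) + (i + (2 + e)) ≡ 2 * (1 + i) + 2 * (1 + e)
    form₃ = solve-∀
  form₁ : ∀ x e f g → x * (2 * (1 + e) * (2 * (2 + e))) * (f * g) ≡ 4 * (x * (f * ((2 + e) * ((1 + e) * g))))
  form₁ = solve-∀
  form₂ : ∀ x i f g → 4 * (x * ((2 + i) * ((1 + i) * f) * g)) ≡ 4 * ((2 + i) * (1 + i)) * x * (f * g)
  form₂ = solve-∀

-- The number `R` of levels runs down while `M` stays fixed, so that every level receives the same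
-- bound.
small-sets-bound : ∀ h c M R → 0 < h → h ≤ c → c ≤ suc h → R ≤ M → 2 * M ≤ h + c →
  size {h + c} (λ A → card A <ᵇ R) * ((h + c) * (h + c)) ≤ R * (4 * (suc M * suc M) * ((h + c) C h))
small-sets-bound h c M zero    0<h h≤c c≤ R≤ 2M≤ = ≤-reflexive (cong (_* ((h + c) * (h + c))) (∑-0 (subsets (h + c))))
small-sets-bound h c M (suc R) 0<h h≤c c≤ R≤ 2M≤ = begin
  size {n} (λ A → card A <ᵇ suc R) * (n * n)
    ≤⟨ *-monoˡ-≤ (n * n) (≤-trans (∑-mono (subsets n) (λ A → split (card A) R)) (≤-reflexive (∑-+ (subsets n) _ _))) ⟩
  (size {n} (λ A → card A ≡ᵇ R) + size {n} (λ A → card A <ᵇ R)) * (n * n)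
    ≡⟨ *-distribʳ-+ (n * n) (size {n} (λ A → card A ≡ᵇ R)) _ ⟩
  size {n} (λ A → card A ≡ᵇ R) * (n * n) + size {n} (λ A → card A <ᵇ R) * (n * n)
    ≤⟨ +-mono-≤ (≤-trans (≤-reflexive (cong (_* (n * n)) (size-level n R))) (level-bound h c R M 0<h h≤c c≤ R≤ 2M≤))
                (small-sets-bound h c M R 0<h h≤c c≤ (<⇒≤ R≤) 2M≤) ⟩
  suc R * (4 * (suc M * suc M) * (n C h)) ∎
  where
  open ≤-Reasoning
  n = h + c
  split : ∀ a R → ⟦ a <ᵇ suc R ⟧ ≤ ⟦ a ≡ᵇ R ⟧ + ⟦ a <ᵇ R ⟧
  split zero    zero    = s≤s z≤n
  split zero    (suc R) = ≤-refl
  split (suc a) zero    = z≤n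
  split (suc a) (suc R) = split a R

-- The first summand comes from `fork-ratio`; the second is `2 * r` small levels at the cost of
-- `level-bound` with `M = 2 * r`.
forkError : ℕ → ℕ
forkError r = 4 * (r * suc (2 * r)) + 2 * r * (4 * (suc (2 * r) * suc (2 * r)))

-- h / (h − r) = 1 + 2r/n + O(n⁻²), cleared of denominators.
fork-ratio : ∀ h n r d → r + d ≡ h → n ≤ suc (h + h) → 2 * suc (2 * r) ≤ n →
  h * (n * n) ≤ d * (n * n + 2 * r * n + 4 * (r * suc (2 * r)))
fork-ratio h n r d refl n≤ large = begin
  (r + d) * (n * n)  ≡⟨ form₁ r d (n * n) ⟩
  d * (n * n) + r * (n * n)  ≤⟨ +-monoʳ-≤ (d * (n * n)) (*-cancelˡ-≤ 2 main) ⟩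
  d * (n * n) + d * (2 * r * n + 4 * (r * m))     ≡⟨ form₂ d (n * n) (2 * r * n) (4 * (r * m)) ⟩
  d * (n * n + 2 * r * n + 4 * (r * m)) ∎
  where
  open ≤-Reasoning
  m = suc (2 * r)
  form₁ : ∀ r d x → (r + d) * x ≡ d * x + r * x
  form₁ = solve-∀
  form₂ : ∀ d x y z → d * x + d * (y + z) ≡ d * (x + y + z)
  form₂ = solve-∀
  main : 2 * (r * (n * n)) ≤ 2 * (d * (2 * r * n + 4 * (r * m)))
  -- With `n = m + y` the claim reduces to `m ≤ y` and `y ≤ 2 * d`. The former is the assumption
  -- `2 * m ≤ n`, the latter is `n ≤ 2 * h + 1 = 2 * d + m`.
  main with m≤n⇒∃[o]m+o≡n (≤-trans (m≤m+n m (m + 0)) large)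
  ... | y , eq = begin
    2 * (r * (n * n))  ≡⟨ cong (λ x → 2 * (r * (x * x))) (sym eq) ⟩
    2 * (r * ((m + y) * (m + y)))  ≡⟨ form₃ r m y ⟩
    2 * r * (m * m + 2 * (m * y) + y * y)         ≤⟨ *-monoʳ-≤ (2 * r) (+-monoˡ-≤ (y * y) (+-monoˡ-≤ (2 * (m * y)) (*-monoʳ-≤ m m≤y))) ⟩
    2 * r * (m * y + 2 * (m * y) + y * y)         ≡⟨ form₄ r m y ⟩
    y * (2 * r * (m + y) + 4 * (r * m))           ≤⟨ *-monoˡ-≤ (2 * r * (m + y) + 4 * (r * m)) y≤2d ⟩
    2 * d * (2 * r * (m + y) + 4 * (r * m))       ≡⟨ cong (λ x → 2 * d * (2 * r * x + 4 * (r * m))) eq ⟩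
    2 * d * (2 * r * n + 4 * (r * m))             ≡⟨ *-assoc 2 d _ ⟩
    2 * (d * (2 * r * n + 4 * (r * m))) ∎
    where
    form₃ : ∀ r m y → 2 * (r * ((m + y) * (m + y))) ≡ 2 * r * (m * m + 2 * (m * y) + y * y)
    form₃ = solve-∀
    form₄ : ∀ r m y → 2 * r * (m * y + 2 * (m * y) + y * y) ≡ y * (2 * r * (m + y) + 4 * (r * m))
    form₄ = solve-∀
    m≤y : m ≤ y
    m≤y = +-cancelˡ-≤ m m y (≤-trans (≤-reflexive (cong (m +_) (sym (+-identityʳ m)))) (≤-trans large (≤-reflexive (sym eq))))
    y≤2d : y ≤ 2 * d
    y≤2d = +-cancelˡ-≤ m y (2 * d) (≤-trans (≤-reflexive eq) (≤-trans n≤ (≤-reflexive (form₅ r d))))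
      where
      form₅ : ∀ r d → 1 + (r + d + (r + d)) ≡ 1 + 2 * r + 2 * d
      form₅ = solve-∀

-- The weights behave only from size `2 * r` on, so smaller sets are split off. Their levels are of
-- order `n⁻²` relative to the middle one and enter the error.
fork-asymptotic : ∀ h c r (𝓖 : Family (h + c)) → 0 < h → h ≤ c → c ≤ suc h → 2 * suc (2 * r) ≤ h + c →
  (∀ A → 𝓖 A ≡ true → 0 < card A × sub 𝓖 A ≤ r) →
  size 𝓖 * ((h + c) * (h + c)) ≤ ((h + c) * (h + c) + 2 * r * (h + c) + forkError r) * ((h + c) C h)
fork-asymptotic h c r 𝓖 0<h h≤c c≤ large hyp = begin
  size 𝓖 * n²  ≤⟨ *-monoˡ-≤ n² (≤-trans (∑-mono (subsets n) split) (≤-reflexive (∑-+ (subsets n) _ _))) ⟩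
  (size big + size {n} (λ A → card A <ᵇ 2 * r)) * n²   ≡⟨ *-distribʳ-+ n² (size big) _ ⟩
  size big * n² + size {n} (λ A → card A <ᵇ 2 * r) * n²
    ≤⟨ +-mono-≤ big-bound (small-sets-bound h c (2 * r) (2 * r) 0<h h≤c c≤ ≤-refl
         (≤-trans (*-monoʳ-≤ 2 (n≤1+n (2 * r))) large)) ⟩
  (n² + 2 * r * n + E₁) * (n C h) + 2 * r * (E₂ * (n C h))
    ≡⟨ form (n² + 2 * r * n) E₁ (2 * r) E₂ (n C h) ⟩
  (n² + 2 * r * n + forkError r) * (n C h) ∎
  where
  open ≤-Reasoning
  n = h + c
  n² = n * n
  E₁ = 4 * (r * suc (2 * r))
  E₂ = 4 * (suc (2 * r) * suc (2 * r))
  form : ∀ x e r f c → (x + e) * c + r * (f * c) ≡ (x + (e + r * f)) * c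
  form = solve-∀
  big : Family n
  big A = 𝓖 A ∧ (2 * r ≤ᵇ card A)
  split : ∀ A → ⟦ 𝓖 A ⟧ ≤ ⟦ big A ⟧ + ⟦ card A <ᵇ 2 * r ⟧
  split A with 𝓖 A | 2 * r ≤ᵇ card A in eq
  ... | false | _     = z≤n
  ... | true  | true  = s≤s z≤n
  ... | true  | false rewrite <ᵇ-from {card A} {2 * r} (≰⇒> (λ le → true≢false (≤ᵇ-from le) eq)) = ≤-refl
  r<h : r < h
  r<h = ≰⇒> λ h≤r → <-irrefl refl (begin-strict
    n  ≤⟨ +-mono-≤ h≤r (≤-trans c≤ (s≤s h≤r)) ⟩
    r + suc r               <⟨ m<m+n (r + suc r) (s≤s z≤n) ⟩
    r + suc r + suc (2 * r) ≡⟨ form′ r ⟩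
    2 * suc (2 * r)         ≤⟨ large ⟩
    n ∎)
    where
    form′ : ∀ r → r + (1 + r) + (1 + 2 * r) ≡ 2 * (1 + 2 * r)
    form′ = solve-∀
  big-bound : size big * n² ≤ (n² + 2 * r * n + E₁) * (n C h)
  big-bound = *-cancelʳ-≤ _ _ (h ∸ r) {{>-nonZero (m<n⇒0<n∸m r<h)}} (begin
    size big * n² * (h ∸ r)  ≡⟨ swap (size big) n² (h ∸ r) ⟩
    size big * (h ∸ r) * n²  ≤⟨ *-monoˡ-≤ n² (fork-bound h c r big 0<h h≤c c≤ (λ A p →
      let pos , few = hyp A (∧-elimˡ {𝓖 A} p) in pos , ≤ᵇ-to (∧-elimʳ {𝓖 A} p) ,
      ≤-trans (size-mono (λ B q → ∧-intro (∧-elimˡ {𝓖 B} (∧-elimˡ {big B} q)) (∧-elimʳ {big B} q))) few)) ⟩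
    h * (n C h) * n²  ≡⟨ swap h (n C h) n² ⟩
    h * n² * (n C h)  ≤⟨ *-monoˡ-≤ (n C h) (fork-ratio h n r (h ∸ r) (m+[n∸m]≡n (<⇒≤ r<h))
                                                        (≤-trans (+-monoʳ-≤ h c≤) (≤-reflexive (+-suc h h))) large) ⟩
    (h ∸ r) * (n² + 2 * r * n + E₁) * (n C h)      ≡⟨ rotate (h ∸ r) (n² + 2 * r * n + E₁) (n C h) ⟩
    (n² + 2 * r * n + E₁) * (n C h) * (h ∸ r) ∎)
    where
    swap : ∀ a b c → a * b * c ≡ a * c * b
    swap = solve-∀
    rotate : ∀ a b c → a * b * c ≡ b * c * a
    rotate = solve-∀

size-∨ : ∀ {n} (P Q R : Family n) → (∀ A → P A ≡ true → Q A ≡ true ⊎ R A ≡ true) → size P ≤ size Q + size R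
size-∨ {n} P Q R cover = ≤-trans (∑-mono (subsets n) split) (≤-reflexive (∑-+ (subsets n) _ _))
  where
  split : ∀ A → ⟦ P A ⟧ ≤ ⟦ Q A ⟧ + ⟦ R A ⟧
  split A with P A in p
  ... | false = z≤n
  ... | true  with cover A p
  ...   | inj₁ q rewrite q = s≤s z≤n
  ...   | inj₂ r rewrite r = m≤n+m 1 ⟦ Q A ⟧

module _ {h c : ℕ} (0<h : 0 < h) (h≤c : h ≤ c) (c≤ : c ≤ suc h) where
  private
    n = h + c
    n² = n * n

  -- Pays for ∅ and the full set: `level-bound` at level 0 with `M = 1` has the constant 16, and two
  -- sets give the 32 in the error terms.
  two-sets-bound : 2 ≤ n → 2 * n² ≤ 32 * (n C h)
  two-sets-bound 2≤n = begin
    2 * n²  ≡⟨ cong (2 *_) (sym (trans (cong (_* n²) (nC0≡1 n)) (+-identityʳ n²))) ⟩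
    2 * ((n C 0) * n²)  ≤⟨ *-monoʳ-≤ 2 (level-bound h c 0 1 0<h h≤c c≤ (s≤s z≤n) 2≤n) ⟩
    2 * (16 * (n C h))  ≡⟨ sym (*-assoc 2 16 (n C h)) ⟩
    32 * (n C h) ∎
    where open ≤-Reasoning

  asymptotic-1 : ∀ r → 2 * suc (2 * r) ≤ n →
    2 * f n 1 (2 + r) * n² ≤ 2 ^ n * n² + (n² + 2 * r * n + (forkError r + 32)) * (n C h)
  asymptotic-1 r large with extremal n 1 (2 + r)
  ... | 𝓕 , eq , ns = subst (λ x → 2 * x * n² ≤ 2 ^ n * n² + (n² + 2 * r * n + (forkError r + 32)) * (n C h)) eq (begin
    2 * size 𝓕 * n²  ≤⟨ *-monoˡ-≤ n² (≤-trans (core-bound 𝓕) (+-monoʳ-≤ (2 ^ n) (+-monoʳ-≤ (size 𝓖) (*-monoʳ-≤ 2 (⟦⟧≤1 (𝓕 ⊥)))))) ⟩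
    (2 ^ n + (size 𝓖 + 2)) * n²  ≡⟨ form₁ (2 ^ n) (size 𝓖) n² ⟩
    2 ^ n * n² + (size 𝓖 * n² + 2 * n²)          ≤⟨ +-monoʳ-≤ (2 ^ n * n²) (+-mono-≤
      (fork-asymptotic h c r 𝓖 0<h h≤c c≤ large (λ A p → innerCore-nonempty 𝓕 A p , proj₁ (degrees-1 𝓕 ns A p)))
      (two-sets-bound (≤-trans (*-monoʳ-≤ 2 (s≤s z≤n)) large))) ⟩
    2 ^ n * n² + ((n² + 2 * r * n + forkError r) * (n C h) + 32 * (n C h))
      ≡⟨ form₂ (2 ^ n * n²) (n² + 2 * r * n) (forkError r) (n C h) ⟩
    2 ^ n * n² + (n² + 2 * r * n + (forkError r + 32)) * (n C h) ∎)
    where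
    open ≤-Reasoning
    𝓖 = innerCore 𝓕
    form₁ : ∀ p s x → (p + (s + 2)) * x ≡ p * x + (s * x + 2 * x)
    form₁ = solve-∀
    form₂ : ∀ p x e c → p + ((x + e) * c + 32 * c) ≡ p + (x + (e + 32)) * c
    form₂ = solve-∀

  -- No member of the core has both more than `a` subsets and more than `b` supersets. Hence `few a`
  -- and the complements of `few b` cover the core, and each part obeys the fork bound, which
  -- doubles the middle binomial and adds the coefficients `a` and `b`.
  asymptotic-2 : ∀ a b → 2 * suc (2 * a) ≤ n → 2 * suc (2 * b) ≤ n →
    2 * f n (2 + a) (2 + b) * n² ≤
    2 ^ n * n² + (2 * n² + 2 * (a + b) * n + (forkError a + forkError b + 32)) * (n C h)
  asymptotic-2 a b large large′ with extremal n (2 + a) (2 + b)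
  ... | 𝓕 , eq , ns = subst (λ x → 2 * x * n² ≤ 2 ^ n * n² + (2 * n² + 2 * (a + b) * n + (forkError a + forkError b + 32)) * (n C h)) eq (begin
    2 * size 𝓕 * n²  ≤⟨ *-monoˡ-≤ n² (≤-trans (core-bound 𝓕) (+-monoʳ-≤ (2 ^ n) (+-mono-≤ halves (*-monoʳ-≤ 2 (⟦⟧≤1 (𝓕 ⊥)))))) ⟩
    (2 ^ n + (size (few a) + size (few b) + 2)) * n²     ≡⟨ form₁ (2 ^ n) (size (few a)) (size (few b)) n² ⟩
    2 ^ n * n² + (size (few a) * n² + size (few b) * n² + 2 * n²)
      ≤⟨ +-monoʳ-≤ (2 ^ n * n²) (+-mono-≤ (+-mono-≤ (few-bound a large) (few-bound b large′))
           (two-sets-bound (≤-trans (*-monoʳ-≤ 2 (s≤s z≤n)) large))) ⟩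
    2 ^ n * n² + ((n² + 2 * a * n + forkError a) * (n C h) + (n² + 2 * b * n + forkError b) * (n C h) + 32 * (n C h))
      ≡⟨ form₂ (2 ^ n * n²) n² a b n (forkError a) (forkError b) (n C h) ⟩
    2 ^ n * n² + (2 * n² + 2 * (a + b) * n + (forkError a + forkError b + 32)) * (n C h) ∎)
    where
    open ≤-Reasoning
    𝓖 = innerCore 𝓕
    sc = innerCore-selfComplementary 𝓕
    few : ℕ → Family n
    few r A = 𝓖 A ∧ (sub 𝓖 A ≤ᵇ r)
    form₁ : ∀ p s t x → (p + (s + t + 2)) * x ≡ p * x + (s * x + t * x + 2 * x)
    form₁ = solve-∀
    form₂ : ∀ p q a b n x y c → p + ((q + 2 * a * n + x) * c + (q + 2 * b * n + y) * c + 32 * c) ≡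
                                p + (2 * q + 2 * (a + b) * n + (x + y + 32)) * c
    form₂ = solve-∀
    few-bound : ∀ r → 2 * suc (2 * r) ≤ n → size (few r) * n² ≤ (n² + 2 * r * n + forkError r) * (n C h)
    few-bound r large = fork-asymptotic h c r (few r) 0<h h≤c c≤ large (λ A p →
      innerCore-nonempty 𝓕 A (∧-elimˡ {𝓖 A} p) ,
      ≤-trans (size-mono (λ B q → ∧-intro (∧-elimˡ {𝓖 B} (∧-elimˡ {few r B} q)) (∧-elimʳ {few r B} q)))
              (≤ᵇ-to (∧-elimʳ {𝓖 A} p)))
    halves : size 𝓖 ≤ size (few a) + size (few b)
    halves = ≤-trans (size-∨ 𝓖 (few a) (few b ∘ ∁) cover) (≤-reflexive (cong (size (few a) +_) (∑-∁ (λ A → ⟦ few b A ⟧))))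
      where
      cover : ∀ A → 𝓖 A ≡ true → few a A ≡ true ⊎ few b (∁ A) ≡ true
      cover A p with sub 𝓖 A ≤? a | sup 𝓖 A ≤? b
      ... | yes le | _      = inj₁ (∧-intro p (≤ᵇ-from le))
      ... | no _   | yes le = inj₂ (∧-intro (trans (sc A) p) (≤ᵇ-from (≤-trans (≤-reflexive (sub-∁ 𝓖 sc A)) le)))
      ... | no gt  | no gt′ = absurd (innerCore-degrees 𝓕 ns A p (s≤s (≰⇒> gt)) (s≤s (≰⇒> gt′)))

-- The finitely many n below N are absorbed into the error term.
absorb : ∀ {n N F Y K C₀} → F ≤ 2 ^ n → 0 < C₀ →
  (N ≤ n → 2 * F * (n * n) ≤ 2 ^ n * (n * n) + (Y + K) * C₀) →
  2 * F * (n * n) ≤ 2 ^ n * (n * n) + (Y + (K + 2 * 2 ^ N * (N * N))) * C₀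
absorb {n} {N} {F} {Y} {K} {C₀} F≤ 0<C large with N ≤? n
... | yes N≤n = ≤-trans (large N≤n) (+-monoʳ-≤ (2 ^ n * (n * n)) (*-monoˡ-≤ C₀ (+-monoʳ-≤ Y (m≤m+n K _))))
... | no  N≰n = begin
  2 * F * (n * n)  ≤⟨ *-mono-≤ (*-monoʳ-≤ 2 (≤-trans F≤ (^-monoʳ-≤ 2 n≤N))) (*-mono-≤ n≤N n≤N) ⟩
  L  ≡⟨ sym (*-identityʳ L) ⟩
  L * 1  ≤⟨ *-mono-≤ (≤-trans (m≤n+m L K) (m≤n+m (K + L) Y)) 0<C ⟩
  (Y + (K + L)) * C₀              ≤⟨ m≤n+m _ (2 ^ n * (n * n)) ⟩
  2 ^ n * (n * n) + (Y + (K + L)) * C₀ ∎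
  where
  open ≤-Reasoning
  L = 2 * 2 ^ N * (N * N)
  n≤N = <⇒≤ (≰⇒> N≰n)

f≤2^n : ∀ n s t .{{_ : NonZero s}} .{{_ : NonZero t}} → f n s t ≤ 2 ^ n
f≤2^n n s t with extremal n s t
... | 𝓕 , eq , _ = subst (_≤ 2 ^ n) eq (≤-trans (size-mono {n} {𝓕} {λ _ → true} (λ _ _ → refl)) (≤-reflexive (size-all n)))

parity : ∀ n → ∃ λ h → n / 2 ≡ h × (n ≡ h + h ⊎ n ≡ h + suc h)
parity n = n / 2 , refl , cases (n % 2) refl (m%n<n n 2)
  where
  cases : ∀ r → n % 2 ≡ r → r < 2 → n ≡ n / 2 + n / 2 ⊎ n ≡ n / 2 + suc (n / 2)
  cases zero          eq _ = inj₁ (trans (m≡m%n+[m/n]*n n 2) (trans (cong (_+ n / 2 * 2) eq) (form (n / 2))))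
    where
    form : ∀ x → x * 2 ≡ x + x
    form = solve-∀
  cases (suc zero)    eq _ = inj₂ (trans (m≡m%n+[m/n]*n n 2) (trans (cong (_+ n / 2 * 2) eq) (form (n / 2))))
    where
    form : ∀ x → 1 + x * 2 ≡ x + (1 + x)
    form = solve-∀
  cases (suc (suc r)) _ (s≤s (s≤s ()))

half-positive : ∀ h c → 3 ≤ h + c → c ≤ suc h → 0 < h
half-positive zero    c 3≤ c≤ = absurd (1+n≰n (≤-trans 3≤ (≤-trans c≤ (n≤1+n 1))))
half-positive (suc h) c _  _  = s≤s z≤n

halves-of : ∀ n → 3 ≤ n → ∃ λ h → ∃ λ c → n / 2 ≡ h × n ≡ h + c × h ≤ c × c ≤ suc h × 0 < h
halves-of n 3≤n with parity n
... | h , eq , inj₁ e = h , h , eq , e , ≤-refl , n≤1+n h , half-positive h h (subst (3 ≤_) e 3≤n) (n≤1+n h)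
... | h , eq , inj₂ e = h , suc h , eq , e , n≤1+n h , ≤-refl , half-positive h (suc h) (subst (3 ≤_) e 3≤n) ≤-refl

-- The last summand is what `absorb` charges for the `n` below `2 * suc (2 * r)`, where
-- `asymptotic-1` says nothing.
error-1 : ℕ → ℕ
error-1 r = forkError r + 32 + 2 * 2 ^ (2 * suc (2 * r)) * (2 * suc (2 * r) * (2 * suc (2 * r)))

upper-1 : ∀ r n → 3 ≤ n → 2 * f n 1 (2 + r) * (n * n) ≤
  2 ^ n * (n * n) + (n * n + 2 * r * n + error-1 r) * (n C (n / 2))
upper-1 r n 3≤n with halves-of n 3≤n
... | h , c , eq , refl , h≤c , c≤ , 0<h rewrite eq =
  absorb {Y = (h + c) * (h + c) + 2 * r * (h + c)} {K = forkError r + 32}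
    (f≤2^n (h + c) 1 (2 + r)) (binomial-positive h c) (asymptotic-1 0<h h≤c c≤ r)

error-2 : ℕ → ℕ → ℕ
error-2 a b = forkError a + forkError b + 32 + 2 * 2 ^ N * (N * N)
  where N = 2 * suc (2 * (a + b))

upper-2 : ∀ a b n → 3 ≤ n → 2 * f n (2 + a) (2 + b) * (n * n) ≤
  2 ^ n * (n * n) + (2 * (n * n) + 2 * (a + b) * n + error-2 a b) * (n C (n / 2))
upper-2 a b n 3≤n with halves-of n 3≤n
... | h , c , eq , refl , h≤c , c≤ , 0<h rewrite eq =
  absorb {Y = 2 * ((h + c) * (h + c)) + 2 * (a + b) * (h + c)} {K = forkError a + forkError b + 32}
    (f≤2^n (h + c) (2 + a) (2 + b)) (binomial-positive h c)
    (λ large → asymptotic-2 0<h h≤c c≤ a b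
      (≤-trans (*-monoʳ-≤ 2 (s≤s (*-monoʳ-≤ 2 (m≤m+n a b)))) large)
      (≤-trans (*-monoʳ-≤ 2 (s≤s (*-monoʳ-≤ 2 (m≤n+m b a)))) large))

-- Rational form

-- Normalisation hides the numerators, so the laws of `fromℕ` are checked on unnormalised fractions,
-- where they are integer identities, and transported back.
toℚᵘ-/ : ∀ i d → ℚ.toℚᵘ (i /ℚ suc d) ℚᵘ.≃ ℚᵘ.mkℚᵘ i d
toℚᵘ-/ i d = ℚₚ.toℚᵘ-fromℚᵘ (ℚᵘ.mkℚᵘ i d)

fromℕ-+ : ∀ a b → fromℕ (a + b) ≡ fromℕ a +ℚ fromℕ b
fromℕ-+ a b = ℚₚ.toℚᵘ-injective (ℚᵘₚ.≃-trans (toℚᵘ-/ (ℤ.+ (a + b)) 0) (ℚᵘₚ.≃-trans (ℚᵘ.*≡* eq)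
  (ℚᵘₚ.≃-sym (ℚᵘₚ.≃-trans (ℚₚ.toℚᵘ-homo-+ (fromℕ a) (fromℕ b)) (ℚᵘₚ.+-cong (toℚᵘ-/ (ℤ.+ a) 0) (toℚᵘ-/ (ℤ.+ b) 0))))))
  where
  eq : ℤ.+ (a + b) ℤ.* ℤ.+ 1 ≡ (ℤ.+ a ℤ.* ℤ.+ 1 ℤ.+ ℤ.+ b ℤ.* ℤ.+ 1) ℤ.* ℤ.+ 1
  eq = cong (ℤ._* ℤ.+ 1) (trans (ℤₚ.pos-+ a b) (sym (cong₂ ℤ._+_ (ℤₚ.*-identityʳ (ℤ.+ a)) (ℤₚ.*-identityʳ (ℤ.+ b)))))

fromℕ-* : ∀ a b → fromℕ (a * b) ≡ fromℕ a *ℚ fromℕ b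
fromℕ-* a b = ℚₚ.toℚᵘ-injective (ℚᵘₚ.≃-trans (toℚᵘ-/ (ℤ.+ (a * b)) 0) (ℚᵘₚ.≃-trans (ℚᵘ.*≡* (cong (ℤ._* ℤ.+ 1) (ℤₚ.pos-* a b)))
  (ℚᵘₚ.≃-sym (ℚᵘₚ.≃-trans (ℚₚ.toℚᵘ-homo-* (fromℕ a) (fromℕ b)) (ℚᵘₚ.*-cong (toℚᵘ-/ (ℤ.+ a) 0) (toℚᵘ-/ (ℤ.+ b) 0))))))

fromℕ-mono : ∀ {a b} → a ≤ b → fromℕ a ≤ℚ fromℕ b
fromℕ-mono {a} {b} le = ℚₚ.toℚᵘ-cancel-≤ (ℚᵘₚ.≤-respˡ-≃ (ℚᵘₚ.≃-sym (toℚᵘ-/ (ℤ.+ a) 0))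
  (ℚᵘₚ.≤-respʳ-≃ (ℚᵘₚ.≃-sym (toℚᵘ-/ (ℤ.+ b) 0)) (ℚᵘ.*≤* (ℤₚ.*-monoʳ-≤-nonNeg (ℤ.+ 1) (ℤ.+≤+ le)))))

/-* : ∀ i n .{{_ : NonZero n}} → (i /ℚ n) *ℚ fromℕ n ≡ i /ℚ 1
/-* i (suc d) = ℚₚ.toℚᵘ-injective (ℚᵘₚ.≃-trans (ℚₚ.toℚᵘ-homo-* (i /ℚ suc d) (fromℕ (suc d)))
  (ℚᵘₚ.≃-trans (ℚᵘₚ.*-cong (toℚᵘ-/ i d) (toℚᵘ-/ (ℤ.+ suc d) 0)) (ℚᵘₚ.≃-trans (ℚᵘ.*≡* eq) (ℚᵘₚ.≃-sym (toℚᵘ-/ i 0)))))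
  where
  eq : i ℤ.* ℤ.+ suc d ℤ.* ℤ.+ 1 ≡ i ℤ.* ℤ.+ (suc d * 1)
  eq = trans (ℤₚ.*-identityʳ _) (cong (λ k → i ℤ.* ℤ.+ k) (sym (*-identityʳ (suc d))))

fromℕ-cancel : ∀ d .{{_ : NonZero d}} {x y : ℚ} → x *ℚ fromℕ d ≤ℚ y *ℚ fromℕ d → x ≤ℚ y
fromℕ-cancel (suc d) {x} {y} = ℚₚ.*-cancelʳ-≤-pos (fromℕ (suc d)) {{positive}}
  where
  positive : ℚ.Positive (fromℕ (suc d))
  positive = ℚ.positive (ℚₚ.toℚᵘ-cancel-< (ℚᵘₚ.<-respʳ-≃ (ℚᵘₚ.≃-sym (toℚᵘ-/ (ℤ.+ suc d) 0)) (ℚᵘ.*<* (ℤ.+<+ (s≤s z≤n)))))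

fromℕ-nonNeg : ∀ a → ℚ.NonNegative (fromℕ a)
fromℕ-nonNeg a = ℚ.nonNegative (fromℕ-mono {0} {a} z≤n)

open Data.Rational.Solver.+-*-Solver using (_:=_; _:+_; _:*_; con) renaming (solve to solveℚ)

-- Multiplication by the common denominator `2 * (n * n)` leaves an inequality of natural numbers.
-- The pair of `half` and `α` is `½` and 1 for (e), and 1 and 2 for (f).
rational-upper : ∀ (half : ℚ) α → half *ℚ fromℕ 2 ≡ fromℕ α → ∀ F p C₀ n .{{_ : NonZero n}} β K →
  2 * F * (n * n) ≤ 2 * p * (n * n) + (α * (n * n) + 2 * β * n + K) * C₀ →
  fromℕ F ≤ℚ fromℕ p +ℚ fromℕ C₀ *ℚ (half +ℚ ((ℤ.+ β) /ℚ n) +ℚ fromℕ K *ℚ (_/ℚ_ (ℤ.+ 1) (n ^ 2) {{m^n≢0 n 2}}))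
rational-upper half α half*2 F p C₀ n {{nz}} β K le = fromℕ-cancel (2 * (n * n)) {{m*n≢0 2 (n * n) {{_}} {{m*n≢0 n n}}}} (begin
  fromℕ F *ℚ fromℕ (2 * (n * n))         ≡⟨ trans (sym (fromℕ-* F (2 * (n * n)))) (cong fromℕ (form F n)) ⟩
  -- Enlarging `K` to `2 * K` cancels the 2 of the denominator, so that the error is `K / n²`.
  fromℕ (2 * F * (n * n))  ≤⟨ fromℕ-mono (≤-trans le (+-monoʳ-≤ _ (*-monoˡ-≤ C₀ (+-monoʳ-≤ (α * (n * n) + 2 * β * n) (m≤m+n K (K + 0)))))) ⟩
  fromℕ (2 * p * (n * n) + (α * (n * n) + 2 * β * n + 2 * K) * C₀)
    ≡⟨ push ⟩
  fromℕ 2 *ℚ P *ℚ (N *ℚ N) +ℚ (fromℕ α *ℚ (N *ℚ N) +ℚ fromℕ 2 *ℚ fromℕ β *ℚ N +ℚ fromℕ 2 *ℚ κ) *ℚ D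
    ≡⟨ cong (λ z → fromℕ 2 *ℚ P *ℚ (N *ℚ N) +ℚ (z *ℚ (N *ℚ N) +ℚ fromℕ 2 *ℚ fromℕ β *ℚ N +ℚ fromℕ 2 *ℚ κ) *ℚ D) (sym half*2) ⟩
  fromℕ 2 *ℚ P *ℚ (N *ℚ N) +ℚ (half *ℚ fromℕ 2 *ℚ (N *ℚ N) +ℚ fromℕ 2 *ℚ fromℕ β *ℚ N +ℚ fromℕ 2 *ℚ κ) *ℚ D
    ≡⟨ cong (λ z → fromℕ 2 *ℚ P *ℚ (N *ℚ N) +ℚ (half *ℚ fromℕ 2 *ℚ (N *ℚ N) +ℚ fromℕ 2 *ℚ z *ℚ N +ℚ fromℕ 2 *ℚ κ) *ℚ D) (sym (/-* (ℤ.+ β) n)) ⟩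
  fromℕ 2 *ℚ P *ℚ (N *ℚ N) +ℚ (half *ℚ fromℕ 2 *ℚ (N *ℚ N) +ℚ fromℕ 2 *ℚ (b *ℚ N) *ℚ N +ℚ fromℕ 2 *ℚ κ) *ℚ D
    ≡⟨ cong (λ z → fromℕ 2 *ℚ P *ℚ (N *ℚ N) +ℚ (half *ℚ fromℕ 2 *ℚ (N *ℚ N) +ℚ fromℕ 2 *ℚ (b *ℚ N) *ℚ N +ℚ fromℕ 2 *ℚ z) *ℚ D)
         (trans (sym (ℚₚ.*-identityʳ κ)) (cong (κ *ℚ_) (sym u*N²))) ⟩
  fromℕ 2 *ℚ P *ℚ (N *ℚ N) +ℚ (half *ℚ fromℕ 2 *ℚ (N *ℚ N) +ℚ fromℕ 2 *ℚ (b *ℚ N) *ℚ N +ℚ fromℕ 2 *ℚ (κ *ℚ (u *ℚ (N *ℚ N)))) *ℚ D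
    ≡⟨ solveℚ 8 (λ two P N h b κ u D →
         two :* P :* (N :* N) :+ (h :* two :* (N :* N) :+ two :* (b :* N) :* N :+ two :* (κ :* (u :* (N :* N)))) :* D :=
         (P :+ D :* (h :+ b :+ κ :* u)) :* (two :* (N :* N))) refl (fromℕ 2) P N half b κ u D ⟩
  (P +ℚ D *ℚ (half +ℚ b +ℚ κ *ℚ u)) *ℚ (fromℕ 2 *ℚ (N *ℚ N))
    ≡⟨ cong ((P +ℚ D *ℚ (half +ℚ b +ℚ κ *ℚ u)) *ℚ_) (sym (trans (fromℕ-* 2 (n * n)) (cong (fromℕ 2 *ℚ_) (fromℕ-* n n)))) ⟩
  (P +ℚ D *ℚ (half +ℚ b +ℚ κ *ℚ u)) *ℚ fromℕ (2 * (n * n)) ∎)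
  where
  open ℚₚ.≤-Reasoning
  P = fromℕ p
  N = fromℕ n
  D = fromℕ C₀
  κ = fromℕ K
  b = (ℤ.+ β) /ℚ n
  u = _/ℚ_ (ℤ.+ 1) (n ^ 2) {{m^n≢0 n 2}}
  form : ∀ F n → F * (2 * (n * n)) ≡ 2 * F * (n * n)
  form = solve-∀
  u*N² : u *ℚ (N *ℚ N) ≡ 1ℚ
  u*N² = trans (cong (u *ℚ_) (sym (trans (cong fromℕ (cong (n *_) (*-identityʳ n))) (fromℕ-* n n)))) (/-* (ℤ.+ 1) (n ^ 2) {{m^n≢0 n 2}})
  triple : ∀ a b c → fromℕ (a * b * c) ≡ fromℕ a *ℚ fromℕ b *ℚ fromℕ c
  triple a b c = trans (fromℕ-* (a * b) c) (cong (_*ℚ fromℕ c) (fromℕ-* a b))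
  push : fromℕ (2 * p * (n * n) + (α * (n * n) + 2 * β * n + 2 * K) * C₀) ≡
    fromℕ 2 *ℚ P *ℚ (N *ℚ N) +ℚ (fromℕ α *ℚ (N *ℚ N) +ℚ fromℕ 2 *ℚ fromℕ β *ℚ N +ℚ fromℕ 2 *ℚ κ) *ℚ D
  push = trans (fromℕ-+ (2 * p * (n * n)) _) (cong₂ _+ℚ_
    (trans (triple 2 p (n * n)) (cong (fromℕ 2 *ℚ P *ℚ_) (fromℕ-* n n)))
    (trans (fromℕ-* (α * (n * n) + 2 * β * n + 2 * K) C₀) (cong (_*ℚ D)
      (trans (fromℕ-+ (α * (n * n) + 2 * β * n) (2 * K)) (cong₂ _+ℚ_
        (trans (fromℕ-+ (α * (n * n)) (2 * β * n)) (cong₂ _+ℚ_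
          (trans (fromℕ-* α (n * n)) (cong (fromℕ α *ℚ_) (fromℕ-* n n))) (triple 2 β n)))
        (fromℕ-* 2 K))))))

rational-half : ∀ p C₀ F → 2 * p + C₀ ≤ 2 * F → fromℕ p +ℚ ½ *ℚ fromℕ C₀ ≤ℚ fromℕ F
rational-half p C₀ F le = fromℕ-cancel 2 (begin
  (fromℕ p +ℚ ½ *ℚ fromℕ C₀) *ℚ fromℕ 2     ≡⟨ solveℚ 2 (λ p c → (p :+ con ½ :* c) :* con (fromℕ 2) := con (fromℕ 2) :* p :+ c) refl (fromℕ p) (fromℕ C₀) ⟩
  fromℕ 2 *ℚ fromℕ p +ℚ fromℕ C₀           ≡⟨ sym (trans (fromℕ-+ (2 * p) C₀) (cong (_+ℚ fromℕ C₀) (fromℕ-* 2 p))) ⟩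
  fromℕ (2 * p + C₀)  ≤⟨ fromℕ-mono le ⟩
  fromℕ (2 * F)  ≡⟨ trans (fromℕ-* 2 F) (ℚₚ.*-comm (fromℕ 2) (fromℕ F)) ⟩
  fromℕ F *ℚ fromℕ 2 ∎)
  where open ℚₚ.≤-Reasoning

rational-fraction : ∀ p C₀ F a d .{{_ : NonZero d}} → d * p + C₀ * a ≤ d * F →
  fromℕ p +ℚ fromℕ C₀ *ℚ ((ℤ.+ a) /ℚ d) ≤ℚ fromℕ F
rational-fraction p C₀ F a d le = fromℕ-cancel d (begin
  (fromℕ p +ℚ fromℕ C₀ *ℚ q) *ℚ fromℕ d             ≡⟨ solveℚ 4 (λ p c q d → (p :+ c :* q) :* d := d :* p :+ c :* (q :* d)) refl (fromℕ p) (fromℕ C₀) q (fromℕ d) ⟩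
  fromℕ d *ℚ fromℕ p +ℚ fromℕ C₀ *ℚ (q *ℚ fromℕ d) ≡⟨ cong (λ z → fromℕ d *ℚ fromℕ p +ℚ fromℕ C₀ *ℚ z) (/-* (ℤ.+ a) d) ⟩
  fromℕ d *ℚ fromℕ p +ℚ fromℕ C₀ *ℚ fromℕ a        ≡⟨ sym (trans (fromℕ-+ (d * p) (C₀ * a)) (cong₂ _+ℚ_ (fromℕ-* d p) (fromℕ-* C₀ a))) ⟩
  fromℕ (d * p + C₀ * a)  ≤⟨ fromℕ-mono le ⟩
  fromℕ (d * F)  ≡⟨ trans (fromℕ-* d F) (ℚₚ.*-comm (fromℕ d) (fromℕ F)) ⟩
  fromℕ F *ℚ fromℕ d ∎)
  where
  open ℚₚ.≤-Reasoning
  q = (ℤ.+ a) /ℚ d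

-- The quotient has no meaning at 0, where a default value stands in; the growth condition speaks of
-- nonzero `n` only.
errorTerm : ℕ → ℕ → ℚ
errorTerm K zero      = fromℕ 0
errorTerm K n@(suc _) = fromℕ K *ℚ (_/ℚ_ (ℤ.+ 1) (n ^ 2) {{m^n≢0 n 2}})

errorTerm-O : ∀ K → O[n⁻²] (errorTerm K)
errorTerm-O K = fromℕ K , 0 , bound
  where
  bound : ∀ n .{{_ : NonZero n}} → 0 ≤ n → ℚ.∣ errorTerm K n ∣ ≤ℚ fromℕ K *ℚ (_/ℚ_ (ℤ.+ 1) (n ^ 2) {{m^n≢0 n 2}})
  bound n@(suc _) _ = ℚₚ.≤-reflexive (ℚₚ.0≤p⇒∣p∣≡p (ℚₚ.nonNegative⁻¹ _ {{ℚₚ.nonNeg*nonNeg⇒nonNeg (fromℕ K) {{fromℕ-nonNeg K}}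
    (_/ℚ_ (ℤ.+ 1) (n ^ 2) {{m^n≢0 n 2}}) {{ℚₚ.normalize-nonNeg 1 (n ^ 2) {{m^n≢0 n 2}}}}}}))

-- Parity of n and the parts of the theorem

half-double : ∀ k → (k + k) / 2 ≡ k
half-double k = trans (cong (_/ 2) (form k)) (m*n/n≡m k 2)
  where
  form : ∀ k → k + k ≡ k * 2
  form = solve-∀

even-form : ∀ {n} → 2 ∣ n → ∃ λ k → n ≡ k + k
even-form (divides k eq) = k , trans eq (trans (*-comm k 2) (cong (k +_) (+-identityʳ k)))

odd-form : ∀ {n} → 3 ≤ n → 2 ∤ n → ∃ λ k → n ≡ suc (suc k + suc k)
odd-form {n} 3≤n odd with parity n
... | h , _ , inj₁ e = absurd (odd (divides h (trans e (trans (cong (h +_) (sym (+-identityʳ h))) (*-comm 2 h)))))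
... | zero  , _ , inj₂ e = absurd (1+n≰n (≤-trans 3≤n (≤-trans (≤-reflexive e) (s≤s z≤n))))
... | suc k , _ , inj₂ e = k , trans e (+-suc (suc k) (suc k))

even-form-4 : ∀ {n} → 3 ≤ n → 2 ∣ n → ∃ λ k → n ≡ (2 + k) + (2 + k)
even-form-4 3≤n even with even-form even
... | zero        , e = absurd (1+n≰n (≤-trans 3≤n (≤-trans (≤-reflexive e) z≤n)))
... | suc zero    , e = absurd (1+n≰n (≤-trans 3≤n (≤-reflexive e)))
... | suc (suc k) , e = k , e

sum-from : ∀ n a {b} → b ≡ a → a ≤ suc n → tail n a ≡ (∑[ b ≤ i ≤ n ] (n C i))
sum-from n a refl a≤ = sym (sumFromTo≡tail n a a≤)

k≤k+k : ∀ k → k ≤ suc (k + k)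
k≤k+k k = ≤-trans (m≤m+n k k) (n≤1+n (k + k))

part-a : ∀ n → 3 ≤ n → f n 1 1 ≡ 2 ^ (n ∸ 1)
part-a (suc n) _ = f-1-1 n

part-even : ∀ r → r ≤ 1 → ∀ n → 3 ≤ n → 2 ∣ n → f n 1 (2 + r) ≡ (∑[ n / 2 ≤ i ≤ n ] (n C i))
part-even r r≤1 n 3≤n even with even-form even
... | k , refl = trans (f-1-even k r 3≤n r≤1) (sum-from (k + k) k (half-double k) (k≤k+k k))

half-suc : ∀ k → (suc (k + k) + 1) / 2 ≡ suc k
half-suc k = trans (cong (_/ 2) (form k)) (half-double (suc k))
  where
  form : ∀ k → 1 + (k + k) + 1 ≡ (1 + k) + (1 + k)
  form = solve-∀

part-b-odd : ∀ n → 3 ≤ n → 2 ∤ n → f n 1 2 ≡ ((n ∸ 1) C ((n ∸ 3) / 2)) + (∑[ (n + 1) / 2 ≤ i ≤ n ] (n C i))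
part-b-odd n 3≤n odd with odd-form 3≤n odd
... | k , refl = trans (f-1-2-odd k) (cong₂ _+_ (cong ((suc k + suc k) C_) (sym index))
      (sum-from (suc (suc k + suc k)) (2 + k) (half-suc (suc k)) (s≤s (s≤s (≤-trans (m≤m+n k (suc k)) (n≤1+n _))))))
  where
  index : (suc (suc k + suc k) ∸ 3) / 2 ≡ k
  index = trans (cong (λ x → (x ∸ 1) / 2) (+-suc k k)) (half-double k)

part-c-odd : ∀ n → 3 ≤ n → 2 ∤ n → f n 2 2 ≡ (∑[ (n ∸ 1) / 2 ≤ i ≤ n ] (n C i))
part-c-odd n 3≤n odd with odd-form 3≤n odd
... | k , refl = trans (f-2-2-odd k) (sum-from (suc (suc k + suc k)) (suc k) (half-double (suc k)) (≤-trans (k≤k+k (suc k)) (n≤1+n _)))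

part-c-even : ∀ n → 3 ≤ n → 2 ∣ n → f n 2 2 ≡ ((n ∸ 1) C (n / 2 ∸ 2)) + (∑[ n / 2 ≤ i ≤ n ] (n C i))
part-c-even n 3≤n even with even-form-4 3≤n even
... | k , refl = trans (f-2-2-even k) (cong₂ _+_ (cong (λ x → (suc k + (2 + k)) C (x ∸ 2)) (sym (half-double (2 + k))))
      (sum-from ((2 + k) + (2 + k)) (2 + k) (half-double (2 + k)) (k≤k+k (2 + k))))

part-d-odd : ∀ n → 3 ≤ n → 2 ∤ n → f n 1 3 ≡ ((n ∸ 1) C ((n ∸ 1) / 2)) + (∑[ (n + 1) / 2 ≤ i ≤ n ] (n C i))
part-d-odd n 3≤n odd with odd-form 3≤n odd
... | k , refl = trans (f-1-3-odd (suc k) (s≤s z≤n)) (cong₂ _+_ (cong ((suc k + suc k) C_) (sym (half-double (suc k))))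
      (sum-from (suc (suc k + suc k)) (2 + k) (half-suc (suc k)) (s≤s (s≤s (≤-trans (m≤m+n k (suc k)) (n≤1+n _))))))

-- For even `n` the sets of at least half size attain the bound exactly. For odd `n` the twin family
-- for (1,3) gains `2 * (2k C suc k)`, which is at least `n′ C suc k` by Pascal's rule because the
-- middle of the even row is its maximum.
lower-e : ∀ r n → 3 ≤ n → 2 ^ n + (n C (n / 2)) ≤ 2 * f n 1 (3 + r)
lower-e r n 3≤n with parity n
... | k , eq , inj₁ refl = begin
  2 ^ (k + k) + ((k + k) C ((k + k) / 2))    ≡⟨ cong (λ x → 2 ^ (k + k) + ((k + k) C x)) eq ⟩
  2 ^ (k + k) + ((k + k) C k)  ≡⟨ sym (double-tail-even k) ⟩
  2 * tail (k + k) k  ≤⟨ *-monoʳ-≤ 2 (size≤f (atLeast (k + k) k) (crossing-1-2-even k (1 + r))) ⟩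
  2 * f (k + k) 1 (3 + r) ∎
  where open ≤-Reasoning
... | zero  , eq , inj₂ refl = absurd (1+n≰n (≤-trans 3≤n (s≤s z≤n)))
... | suc k , eq , inj₂ refl = subst (λ x → 2 ^ x + (x C (x / 2)) ≤ 2 * f x 1 (3 + r)) (sym (+-suc (suc k) (suc k))) (begin
  2 ^ n′ + (n′ C (n′ / 2))  ≡⟨ cong (λ x → 2 ^ n′ + (n′ C x)) (trans (cong (_/ 2) (sym (+-suc (suc k) (suc k)))) eq) ⟩
  2 ^ n′ + (n′ C suc k)  ≤⟨ +-monoʳ-≤ (2 ^ n′) central ⟩
  2 ^ n′ + 2 * (2k C suc k)  ≡⟨ +-comm (2 ^ n′) _ ⟩
  2 * (2k C suc k) + 2 ^ n′  ≡⟨ cong (2 * (2k C suc k) +_) (sym (double-tail-odd (suc k))) ⟩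
  2 * (2k C suc k) + 2 * tail n′ (2 + k)       ≡⟨ sym (*-distribˡ-+ 2 (2k C suc k) _) ⟩
  2 * ((2k C suc k) + tail n′ (2 + k))         ≡⟨ cong (2 *_) (sym (size-threshold-1-3 (suc k))) ⟩
  2 * size (threshold 2k (2 + k) (suc k))      ≤⟨ *-monoʳ-≤ 2 (size≤f (threshold 2k (2 + k) (suc k)) (crossing-1-3-odd (suc k) r)) ⟩
  2 * f n′ 1 (3 + r) ∎)
  where
  open ≤-Reasoning
  2k = suc k + suc k
  n′ = suc 2k
  central : n′ C suc k ≤ 2 * (2k C suc k)
  central = ≤-trans (≤-reflexive (sym (nCk+nC[k+1]≡[n+1]C[k+1] 2k k)))
    (≤-trans (+-monoˡ-≤ (2k C suc k) (*-cancelˡ-≤ (suc k) (≤-trans (*-monoˡ-≤ (2k C k) (n≤1+n (suc k))) (≤-reflexive (sym (binomial-even k))))))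
             (≤-reflexive (cong ((2k C suc k) +_) (sym (+-identityʳ _)))))

2*2^pred : ∀ n → 3 ≤ n → 2 * 2 ^ (n ∸ 1) ≡ 2 ^ n
2*2^pred (suc n) _ = refl

-- For even `n` the factor `n / (n + 2)` turns the middle binomial into its neighbour, so this is
-- the exact size of the family for (2,2). For odd `n` the family gains the whole middle binomial.
lower-f : ∀ a b n → 3 ≤ n → (2 + n) * 2 ^ (n ∸ 1) + (n C (n / 2)) * n ≤ (2 + n) * f n (2 + a) (2 + b)
lower-f a b n 3≤n with parity n
... | zero          , eq , inj₁ refl = absurd (1+n≰n (≤-trans 3≤n z≤n))
... | suc zero      , eq , inj₁ refl = absurd (1+n≰n 3≤n)
... | suc (suc k)   , eq , inj₁ refl = begin
  (2 + n′) * p + (n′ C (n′ / 2)) * n′           ≡⟨ cong (λ x → (2 + n′) * p + (n′ C x) * n′) eq ⟩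
  (2 + n′) * p + (n′ C (2 + k)) * n′            ≡⟨ cong ((2 + n′) * p +_) ratio ⟩
  (2 + n′) * p + (2 + n′) * (n′ C suc k)        ≡⟨ sym (*-distribˡ-+ (2 + n′) p _) ⟩
  (2 + n′) * (p + (n′ C suc k))  ≤⟨ *-monoʳ-≤ (2 + n′) undoubled ⟩
  (2 + n′) * f n′ (2 + a) (2 + b) ∎
  where
  open ≤-Reasoning
  n′ = (2 + k) + (2 + k)
  p = 2 ^ (n′ ∸ 1)
  ratio : (n′ C (2 + k)) * n′ ≡ (2 + n′) * (n′ C suc k)
  ratio = trans (form₁ (n′ C (2 + k)) k) (trans (cong (2 *_) (binomial-even (suc k))) (form₂ (n′ C suc k) k))
    where
    form₁ : ∀ x k → x * ((2 + k) + (2 + k)) ≡ 2 * ((2 + k) * x)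
    form₁ = solve-∀
    form₂ : ∀ x k → 2 * ((3 + k) * x) ≡ (2 + ((2 + k) + (2 + k))) * x
    form₂ = solve-∀
  doubled : 2 * (p + (n′ C suc k)) ≤ 2 * f n′ (2 + a) (2 + b)
  doubled = begin
    2 * (p + (n′ C suc k))  ≡⟨ *-distribˡ-+ 2 p _ ⟩
    2 ^ n′ + 2 * (n′ C suc k)  ≡⟨ sym (double-even-2-2 k) ⟩
    2 * (((suc k + (2 + k)) C k) + tail n′ (2 + k))     ≡⟨ cong (2 *_) (sym (size-threshold-suc (suc k + (2 + k)) k)) ⟩
    2 * size (threshold (suc k + (2 + k)) (suc k) (2 + k))
      ≤⟨ *-monoʳ-≤ 2 (size≤f (threshold (suc k + (2 + k)) (suc k) (2 + k)) (crossing-2-2-even (suc k) a b)) ⟩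
    2 * f n′ (2 + a) (2 + b) ∎
  undoubled : p + (n′ C suc k) ≤ f n′ (2 + a) (2 + b)
  undoubled = *-cancelˡ-≤ 2 doubled
... | k , eq , inj₂ refl = subst (λ x → (2 + x) * 2 ^ (x ∸ 1) + (x C (x / 2)) * x ≤ (2 + x) * f x (2 + a) (2 + b)) (sym (+-suc k k)) (begin
  (2 + n′) * p + (n′ C (n′ / 2)) * n′           ≡⟨ cong (λ x → (2 + n′) * p + (n′ C x) * n′) (trans (cong (_/ 2) (sym (+-suc k k))) eq) ⟩
  (2 + n′) * p + (n′ C k) * n′  ≤⟨ +-monoʳ-≤ ((2 + n′) * p) (≤-trans (*-monoʳ-≤ (n′ C k) (m≤n+m n′ 2)) (≤-reflexive (*-comm (n′ C k) (2 + n′)))) ⟩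
  (2 + n′) * p + (2 + n′) * (n′ C k)            ≡⟨ sym (*-distribˡ-+ (2 + n′) p _) ⟩
  (2 + n′) * (p + (n′ C k))  ≤⟨ *-monoʳ-≤ (2 + n′) undoubled ⟩
  (2 + n′) * f n′ (2 + a) (2 + b) ∎)
  where
  open ≤-Reasoning
  n′ = suc (k + k)
  p = 2 ^ (n′ ∸ 1)
  doubled : 2 * (p + (n′ C k)) ≤ 2 * f n′ (2 + a) (2 + b)
  doubled = begin
    2 * (p + (n′ C k))  ≡⟨ *-distribˡ-+ 2 p _ ⟩
    2 ^ n′ + 2 * (n′ C k)  ≡⟨ sym (double-tail-odd-k k) ⟩
    2 * tail n′ k  ≤⟨ *-monoʳ-≤ 2 (size≤f (atLeast n′ k) (crossing-2-2-odd k a b)) ⟩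
    2 * f n′ (2 + a) (2 + b) ∎
  undoubled : p + (n′ C k) ≤ f n′ (2 + a) (2 + b)
  undoubled = *-cancelˡ-≤ 2 doubled

rational-upper-f : ∀ (half : ℚ) α → half *ℚ fromℕ 2 ≡ fromℕ α → ∀ F n .{{_ : NonZero n}} β K → 3 ≤ n →
  2 * F * (n * n) ≤ 2 ^ n * (n * n) + (α * (n * n) + 2 * β * n + K) * (n C (n / 2)) →
  fromℕ F ≤ℚ fromℕ (2 ^ (n ∸ 1)) +ℚ fromℕ (n C (n / 2)) *ℚ (half +ℚ ((ℤ.+ β) /ℚ n) +ℚ errorTerm K n)
rational-upper-f half α half*2 F n@(suc _) β K 3≤n le =
  rational-upper half α half*2 F (2 ^ (n ∸ 1)) (n C (n / 2)) n β K
    (subst (λ x → 2 * F * (n * n) ≤ x * (n * n) + (α * (n * n) + 2 * β * n + K) * (n C (n / 2))) (sym (2*2^pred n 3≤n)) le)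

part-e : ∀ t .{{_ : NonZero t}} → 4 ≤ t →
  (∀ n → 3 ≤ n → fromℕ (2 ^ (n ∸ 1)) +ℚ ½ *ℚ fromℕ (n C (n / 2)) ≤ℚ fromℕ (f n 1 t)) ×
  (Σ (ℕ → ℚ) λ ε → O[n⁻²] ε × (∀ n .{{_ : NonZero n}} → 3 ≤ n →
    fromℕ (f n 1 t) ≤ℚ fromℕ (2 ^ (n ∸ 1)) +ℚ fromℕ (n C (n / 2)) *ℚ (½ +ℚ ((ℤ.+ t ℤ.- ℤ.+ 2) /ℚ n) +ℚ ε n)))
part-e (suc zero) (s≤s ())
part-e (suc (suc zero)) (s≤s (s≤s ()))
part-e (suc (suc (suc r))) _ = lower , errorTerm (error-1 (suc r)) , errorTerm-O (error-1 (suc r)) , upper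
  where
  lower : ∀ n → 3 ≤ n → fromℕ (2 ^ (n ∸ 1)) +ℚ ½ *ℚ fromℕ (n C (n / 2)) ≤ℚ fromℕ (f n 1 (3 + r))
  lower n 3≤n = rational-half (2 ^ (n ∸ 1)) (n C (n / 2)) (f n 1 (3 + r))
    (≤-trans (≤-reflexive (cong (_+ (n C (n / 2))) (2*2^pred n 3≤n))) (lower-e r n 3≤n))
  upper : ∀ n .{{_ : NonZero n}} → 3 ≤ n → fromℕ (f n 1 (3 + r)) ≤ℚ
    fromℕ (2 ^ (n ∸ 1)) +ℚ fromℕ (n C (n / 2)) *ℚ (½ +ℚ ((ℤ.+ (3 + r) ℤ.- ℤ.+ 2) /ℚ n) +ℚ errorTerm (error-1 (suc r)) n)
  upper n 3≤n = rational-upper-f ½ 1 refl (f n 1 (3 + r)) n (suc r) (error-1 (suc r)) 3≤n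
    (subst (λ x → 2 * f n 1 (3 + r) * (n * n) ≤ 2 ^ n * (n * n) + (x + 2 * suc r * n + error-1 (suc r)) * (n C (n / 2)))
      (sym (+-identityʳ (n * n))) (upper-1 (suc r) n 3≤n))

part-f : ∀ s t .{{_ : NonZero s}} .{{_ : NonZero t}} → 2 ≤ s → 3 ≤ t →
  (∀ n → 3 ≤ n → fromℕ (2 ^ (n ∸ 1)) +ℚ fromℕ (n C (n / 2)) *ℚ (ℤ.+ n /ℚ (2 + n)) ≤ℚ fromℕ (f n s t)) ×
  (Σ (ℕ → ℚ) λ ε → O[n⁻²] ε × (∀ n .{{_ : NonZero n}} → 3 ≤ n →
    fromℕ (f n s t) ≤ℚ fromℕ (2 ^ (n ∸ 1)) +ℚ fromℕ (n C (n / 2)) *ℚ (1ℚ +ℚ ((ℤ.+ t ℤ.+ ℤ.+ s ℤ.- ℤ.+ 3) /ℚ n) +ℚ ε n)))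
part-f (suc zero) _ (s≤s ()) _
part-f (suc (suc a)) (suc (suc zero)) _ (s≤s (s≤s ()))
part-f (suc (suc a)) (suc (suc (suc b))) _ _ = lower , errorTerm K , errorTerm-O K , upper
  where
  K = error-2 a (suc b)
  lower : ∀ n → 3 ≤ n → fromℕ (2 ^ (n ∸ 1)) +ℚ fromℕ (n C (n / 2)) *ℚ (ℤ.+ n /ℚ (2 + n)) ≤ℚ fromℕ (f n (2 + a) (3 + b))
  lower n 3≤n = rational-fraction (2 ^ (n ∸ 1)) (n C (n / 2)) (f n (2 + a) (3 + b)) n (2 + n) (lower-f a (suc b) n 3≤n)
  upper : ∀ n .{{_ : NonZero n}} → 3 ≤ n → fromℕ (f n (2 + a) (3 + b)) ≤ℚ
    fromℕ (2 ^ (n ∸ 1)) +ℚ fromℕ (n C (n / 2)) *ℚ (1ℚ +ℚ ((ℤ.+ (3 + b) ℤ.+ ℤ.+ (2 + a) ℤ.- ℤ.+ 3) /ℚ n) +ℚ errorTerm K n)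
  upper n 3≤n = rational-upper-f 1ℚ 2 refl (f n (2 + a) (3 + b)) n (b + (2 + a)) K 3≤n
    (≤-trans (upper-2 a (suc b) n 3≤n) (+-monoʳ-≤ (2 ^ n * (n * n)) (*-monoˡ-≤ (n C (n / 2))
      (+-monoˡ-≤ K (+-monoʳ-≤ (2 * (n * n)) (*-monoˡ-≤ n (*-monoʳ-≤ 2 weaker)))))))
    where
    -- The covering of the core gives the coefficient `s + t − 4`, relaxed here to the stated
    -- `s + t − 3`.
    weaker : a + suc b ≤ b + (2 + a)
    weaker = ≤-trans (≤-reflexive (trans (+-comm a (suc b)) (sym (+-suc b a)))) (+-monoʳ-≤ b (n≤1+n (suc a)))

open import Data.Integer using (+_) renaming (_+_ to _+ℤ_; _-_ to _-ℤ_)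

theorem3p1 : (∀ n → 3 ≤ n → f n 1 1 ≡ 2 ^ (n ∸ 1))
    ×
    (∀ n → 3 ≤ n →
    (2 ∣ n → f n 1 2 ≡ ∑[ n / 2 ≤ i ≤ n ] (n C i)) ×
    (2 ∤ n → f n 1 2 ≡ ((n ∸ 1) C ((n ∸ 3) / 2)) + (∑[ (n + 1) / 2 ≤ i ≤ n ] (n C i))))
    ×
    (∀ n → 3 ≤ n →
    (2 ∤ n → f n 2 2 ≡ ∑[ (n ∸ 1) / 2 ≤ i ≤ n ] (n C i)) ×
    (2 ∣ n → f n 2 2 ≡ ((n ∸ 1) C (n / 2 ∸ 2)) + (∑[ n / 2 ≤ i ≤ n ] (n C i))))
    ×
    (∀ n → 3 ≤ n →
    (2 ∣ n → f n 1 3 ≡ ∑[ n / 2 ≤ i ≤ n ] (n C i)) ×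
    (2 ∤ n → f n 1 3 ≡ ((n ∸ 1) C ((n ∸ 1) / 2)) + (∑[ (n + 1) / 2 ≤ i ≤ n ] (n C i))))
    ×
    (∀ t .{{_ : NonZero t}} → 4 ≤ t →
    (∀ n → 3 ≤ n →
    fromℕ (2 ^ (n ∸ 1)) +ℚ ½ *ℚ fromℕ (n C (n / 2)) ≤ℚ fromℕ (f n 1 t)) ×
    (Σ (ℕ → ℚ) λ ε → O[n⁻²] ε ×
    (∀ n .{{_ : NonZero n}} → 3 ≤ n →
    fromℕ (f n 1 t) ≤ℚ
    fromℕ (2 ^ (n ∸ 1)) +ℚ
    fromℕ (n C (n / 2)) *ℚ (½ +ℚ ((+ t -ℤ + 2) /ℚ n) +ℚ ε n))))
    ×
    (∀ s t .{{_ : NonZero s}} .{{_ : NonZero t}} → 2 ≤ s → 3 ≤ t →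
    (∀ n → 3 ≤ n →
    fromℕ (2 ^ (n ∸ 1)) +ℚ fromℕ (n C (n / 2)) *ℚ (+ n /ℚ (2 + n)) ≤ℚ fromℕ (f n s t)) ×
    (Σ (ℕ → ℚ) λ ε → O[n⁻²] ε ×
    (∀ n .{{_ : NonZero n}} → 3 ≤ n →
    fromℕ (f n s t) ≤ℚ
    fromℕ (2 ^ (n ∸ 1)) +ℚ
    fromℕ (n C (n / 2)) *ℚ (1ℚ +ℚ ((+ t +ℤ + s -ℤ + 3) /ℚ n) +ℚ ε n))))
theorem3p1 =
  part-a ,
  (λ n 3≤n → part-even 0 z≤n n 3≤n , part-b-odd n 3≤n) ,
  (λ n 3≤n → part-c-odd n 3≤n , part-c-even n 3≤n) ,
  (λ n 3≤n → part-even 1 ≤-refl n 3≤n , part-d-odd n 3≤n) ,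
  (λ t 4≤t → part-e t 4≤t) ,
  (λ s t 2≤s 3≤t → part-f s t 2≤s 3≤t)
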